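{- For $n\ge 2$ let $F_n^{1,3}$ be the set of words $\omega_1\cdots\omega_n$ of nonnegative integers such that $\omega_1=0$, $0\le \omega_{i+1}\le\omega_i+1$ for $1\le i\le n-1$, and for every $i$ with $2\le i\le n$, if $\omega_i=0$ then $i\le n-2$ and $\omega_{i+1}\omega_{i+2}=12$. Let $\mathcal{H}_1=\{1324,2314,2413,3124,3142,3214\}$, $\mathcal{H}_2=\{1234,1243,1324,1423,2314,3124\}$, $\mathcal{H}_3=\{2341,2413,2431,3412,3421,4231\}$, $\mathcal{H}_4=\{2134,2143,2314,3124,3214,4213\}$, $\mathcal{H}_5=\{1234,1243,1324,1423,2134,3124\}$. Then for every $n\ge 2$ and every $j\in\{1,\dots,5\}$, $|F_n^{1,3}| = |S_{n-1}(\mathcal{H}_j)|$.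
   Context: $S_m(\mathcal{E})$ denotes the set of permutations of $\{1,\dots,m\}$ that avoid every pattern in $\mathcal{E}$, where a permutation $\pi$ contains a pattern $\tau$ of length $k$ if there are indices $i_1<\dots<i_k$ such that $\pi(i_a)<\pi(i_b)$ iff $\tau(a)<\tau(b)$, and avoids it otherwise. $F_n^{1,3}$ is the set of generalized Fine sequences congruous $1$ modulo $3$. -}

module Defs where

open import Data.Bool using (Bool; true; false; _∧_; _∨_; not; T; if_then_else_)
open import Data.Nat using (ℕ; zero; suc; _≡ᵇ_; _<ᵇ_; _≤ᵇ_)
open import Data.Fin using (Fin; toℕ)
open import Data.List using (List; []; _∷_; map; length; zip; _++_)
open import Data.Bool.ListAction using (any; all)
open import Data.Vec using (Vec; toList)
open import Data.Product using (Σ)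

stepOK : List ℕ → Bool
stepOK []           = true
stepOK (x ∷ [])     = true
stepOK (x ∷ y ∷ xs) = (y ≤ᵇ suc x) ∧ stepOK (y ∷ xs)

starts12 : List ℕ → Bool
starts12 (1 ∷ 2 ∷ _) = true
starts12 _           = false

zeroCond : List ℕ → Bool
zeroCond []       = true
zeroCond (x ∷ xs) = (if x ≡ᵇ 0 then starts12 xs else true) ∧ zeroCond xs

isFine13 : List ℕ → Bool
isFine13 []       = false
isFine13 (x ∷ xs) = (x ≡ᵇ 0) ∧ stepOK (x ∷ xs) ∧ zeroCond xs

F13 : ℕ → Set
F13 n = Σ (Vec ℕ n) (λ w → T (isFine13 (toList w)))

distinct : List ℕ → Bool
distinct []       = true
distinct (x ∷ xs) = all (λ y → not (x ≡ᵇ y)) xs ∧ distinct xs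

subseqs : ℕ → List ℕ → List (List ℕ)
subseqs zero    _        = [] ∷ []
subseqs (suc k) []       = []
subseqs (suc k) (x ∷ xs) = map (x ∷_) (subseqs k xs) ++ subseqs (suc k) xs

orderIso : List ℕ → List ℕ → Bool
orderIso σ τ = (length σ ≡ᵇ length τ) ∧
  all (λ p → all (λ q → (Data.Product.proj₁ p <ᵇ Data.Product.proj₁ q)
                        ≡B (Data.Product.proj₂ p <ᵇ Data.Product.proj₂ q))
                 (zip σ τ))
      (zip σ τ)
  where
  _≡B_ : Bool → Bool → Bool
  true  ≡B b = b
  false ≡B b = not b

contains : List ℕ → List ℕ → Bool
contains π τ = any (λ s → orderIso s τ) (subseqs (length τ) π)

avoidsAll : List ℕ → List (List ℕ) → Bool
avoidsAll π E = all (λ τ → not (contains π τ)) E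

-- a permutation of {1,…,m} in one-line notation: a Vec (Fin m) m with
-- distinct entries (entry k : Fin m stands for the value k+1; the order
-- relations, hence pattern containment, are unaffected by the shift)
permEntries : {m : ℕ} → Vec (Fin m) m → List ℕ
permEntries v = map toℕ (toList v)

S : ℕ → List (List ℕ) → Set
S m E = Σ (Vec (Fin m) m)
          (λ v → T (distinct (permEntries v) ∧ avoidsAll (permEntries v) E))

H : Fin 5 → List (List ℕ)
H Fin.zero = (1 ∷ 3 ∷ 2 ∷ 4 ∷ []) ∷ (2 ∷ 3 ∷ 1 ∷ 4 ∷ []) ∷ (2 ∷ 4 ∷ 1 ∷ 3 ∷ [])
           ∷ (3 ∷ 1 ∷ 2 ∷ 4 ∷ []) ∷ (3 ∷ 1 ∷ 4 ∷ 2 ∷ []) ∷ (3 ∷ 2 ∷ 1 ∷ 4 ∷ []) ∷ []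
H (Fin.suc Fin.zero) = (1 ∷ 2 ∷ 3 ∷ 4 ∷ []) ∷ (1 ∷ 2 ∷ 4 ∷ 3 ∷ []) ∷ (1 ∷ 3 ∷ 2 ∷ 4 ∷ [])
           ∷ (1 ∷ 4 ∷ 2 ∷ 3 ∷ []) ∷ (2 ∷ 3 ∷ 1 ∷ 4 ∷ []) ∷ (3 ∷ 1 ∷ 2 ∷ 4 ∷ []) ∷ []
H (Fin.suc (Fin.suc Fin.zero)) = (2 ∷ 3 ∷ 4 ∷ 1 ∷ []) ∷ (2 ∷ 4 ∷ 1 ∷ 3 ∷ []) ∷ (2 ∷ 4 ∷ 3 ∷ 1 ∷ [])
           ∷ (3 ∷ 4 ∷ 1 ∷ 2 ∷ []) ∷ (3 ∷ 4 ∷ 2 ∷ 1 ∷ []) ∷ (4 ∷ 2 ∷ 3 ∷ 1 ∷ []) ∷ []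
H (Fin.suc (Fin.suc (Fin.suc Fin.zero))) = (2 ∷ 1 ∷ 3 ∷ 4 ∷ []) ∷ (2 ∷ 1 ∷ 4 ∷ 3 ∷ []) ∷ (2 ∷ 3 ∷ 1 ∷ 4 ∷ [])
           ∷ (3 ∷ 1 ∷ 2 ∷ 4 ∷ []) ∷ (3 ∷ 2 ∷ 1 ∷ 4 ∷ []) ∷ (4 ∷ 2 ∷ 1 ∷ 3 ∷ []) ∷ []
H (Fin.suc (Fin.suc (Fin.suc (Fin.suc Fin.zero)))) = (1 ∷ 2 ∷ 3 ∷ 4 ∷ []) ∷ (1 ∷ 2 ∷ 4 ∷ 3 ∷ []) ∷ (1 ∷ 3 ∷ 2 ∷ 4 ∷ [])
           ∷ (1 ∷ 4 ∷ 2 ∷ 3 ∷ []) ∷ (2 ∷ 1 ∷ 3 ∷ 4 ∷ []) ∷ (3 ∷ 1 ∷ 2 ∷ 4 ∷ []) ∷ []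

{-# OPTIONS --safe #-}

-- Permutations are generated by inserting a new first entry. For each of the five classes
-- (after reverse-complement-inverse for the second, third and fourth) the number of sites at
-- which such an insertion creates no forbidden pattern, and the states it leads to, depend
-- only on one of two states of the permutation and a number j. This gives two systems of
-- succession rules: the classes of H₁ to H₄ share the first one, H₅ has the second one. If
-- w_h is the generating function of the words that may follow a letter h in a Fine sequence,
-- then w_{h+1} = w_h + x w_{h+2}; the state functions b_j of both systems satisfy
-- b_{j+1} = b_j + x b_{j+2} + x² b_0, and this forces b_j + x b_0 = (1 + x) w_j, in
-- particular b_0 = w_0.
module Submission where

open import Defs
open import Data.Nat using (ℕ; _≤_; _∸_)
open import Data.Fin using (Fin)
open import Function.Bundles using (_↔_)

open import Data.Bool using (Bool; true; false; T; _∧_; not; if_then_else_)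
open import Data.Bool.ListAction using (all)
open import Data.Bool.Properties using (T-∧; T-irrelevant)
open import Data.Empty using (⊥; ⊥-elim)
open import Data.Fin as Fin using (zero; suc; toℕ; fromℕ<; opposite; punchIn; punchOut)
open import Data.Fin.Patterns
open import Data.Fin.Properties as Finₚ
  using (1↔⊤; +↔⊎; toℕ<n; toℕ-fromℕ<; toℕ-injective; opposite-involutive;
         punchInᵢ≢i; punchIn-injective; punchIn-punchOut; punchOut-injective)
open import Data.List as List using (List; []; _∷_; zip; length; map; _++_)
open import Data.List.Membership.Propositional using (_∈_; find; lose)
open import Data.List.Membership.Propositional.Properties
  using (∈-++⁻; ∈-++⁺ˡ; ∈-++⁺ʳ; ∈-map⁺; ∈-map⁻)
open import Data.List.Properties using (map-++; map-∘)
open import Data.List.Relation.Unary.All as All using ()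
open import Data.List.Relation.Unary.All.Properties as Allₚ using ()
open import Data.List.Relation.Unary.Any as Any using (Any; here; there)
open import Data.List.Relation.Unary.Any.Properties as Anyₚ using (any⁺; any⁻)
open import Data.Nat
  using (zero; suc; _+_; _*_; _<_; _≡ᵇ_; _<ᵇ_; _≟_; _≤?_; z≤n; s≤s; z<s; s<s)
open import Data.Nat.Properties
  using (≤-refl; ≤-reflexive; ≤-trans; ≤-antisym; ≤-pred; <-trans; <-≤-trans; ≤-<-trans; <-irrefl; <-cmp;
         <⇒≤; <⇒≱; <⇒≢; >⇒≢; ≮⇒≥; ≰⇒>; n≮0; 1+n≰n; n≤1+n; m≤n+m; m≤m+n; m<m+n; m<n⇒m<1+n; m≤n⇒m≤1+n;
         m≤n⇒m<n∨m≡n; suc-injective; +-suc; +-comm; +-assoc; +-identityʳ; +-cancelʳ-≡; +-monoʳ-<; *-zeroʳ;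
         m+[n∸m]≡n; ∸-monoʳ-<; ≡ᵇ⇒≡; ≡⇒≡ᵇ; <ᵇ⇒<; <⇒<ᵇ)
open import Data.Nat.Tactic.RingSolver using (solve-∀)
open import Data.Product using (Σ; ∃; _×_; _,_; proj₁; proj₂)
open import Data.Sum using (_⊎_; inj₁; inj₂)
open import Data.Sum.Function.Propositional using (_⊎-cong_)
open import Data.Unit using (⊤)
open import Data.Vec as Vec using (Vec; []; _∷_; toList; lookup; tabulate)
open import Data.Vec.Properties
  using (lookup∘tabulate; lookup-map; ∷-injective; tabulate∘lookup; tabulate-cong)
open import Function using (_∘_; _⇔_; mk⇔; mk↔ₛ′; Equivalence)
open import Function.Properties.Inverse using (↔-refl; ↔-sym; ↔-trans)
open import Relation.Binary.Definitions using (tri<; tri≈; tri>)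
open import Relation.Binary.PropositionalEquality
  using (_≡_; _≢_; refl; sym; trans; cong; cong₂; subst; subst₂; module ≡-Reasoning)
open import Relation.Nullary using (yes; no; ¬_; does)
open import Relation.Nullary.Decidable using (True; toWitness)

open Equivalence using (to; from)
open ≡-Reasoning

-- Permutations are replaced by codes because a new first entry is then a cons, whereas in one-line
-- notation it renames the later values. What makes the rules checkable is that an occurrence
-- through the new first entry either skips the previous first entry, and then already lived at the
-- corresponding site of the shorter code, or consists of both and a later pair. So a dead site
-- stays dead, and the survival of a living one is a question about pairs of later values: six
-- patterns, three inequalities each. Under reverse-complement-inverse, a new first entry is a new
-- maximum of the original permutation. For j > 0 the numbers b_j and w_j differ, so states are not
-- matched with letters: both sides are counted, and the bijection is composed through `Fin`. Adding
-- the constant x b_0 to every b_j absorbs the term x² b_0 of the recurrence and leaves the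
-- recurrence of the w_j; at j = 0 the factor 1 + x cancels.

-- Sums over sites and counts of marked sites

∑ : (ℕ → ℕ) → ℕ → ℕ
∑ g zero    = 0
∑ g (suc n) = ∑ g n + g n

∑[_] : (ℕ → ℕ) → ℕ → ℕ → ℕ
∑[ g ] a zero    = 0
∑[ g ] a (suc n) = g a + ∑[ g ] (suc a) n

∑-const : ∀ b n → ∑ (λ _ → b) n ≡ n * b
∑-const b zero    = refl
∑-const b (suc n) = trans (+-comm _ b) (cong (b +_) (∑-const b n))

∑[]-cong : ∀ {g h} a b n → (∀ i → i < n → g (a + i) ≡ h (b + i)) → ∑[ g ] a n ≡ ∑[ h ] b n
∑[]-cong a b zero    eq = refl
∑[]-cong {g} {h} a b (suc n) eq = cong₂ _+_
  (subst₂ (λ x y → g x ≡ h y) (+-identityʳ a) (+-identityʳ b) (eq 0 z<s))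
  (∑[]-cong (suc a) (suc b) n λ i i<n →
    subst₂ (λ x y → g x ≡ h y) (+-suc a i) (+-suc b i) (eq (suc i) (s<s i<n)))

∑[]-split : ∀ g a m n → ∑[ g ] a (m + n) ≡ ∑[ g ] a m + ∑[ g ] (a + m) n
∑[]-split g a zero    n rewrite +-identityʳ a = refl
∑[]-split g a (suc m) n rewrite ∑[]-split g (suc a) m n | +-suc a m =
  sym (+-assoc (g a) _ _)

∑[]-snoc : ∀ g a n → ∑[ g ] a (suc n) ≡ ∑[ g ] a n + g (a + n)
∑[]-snoc g a n = trans (cong (∑[ g ] a) (+-comm 1 n))
  (trans (∑[]-split g a n 1) (cong (∑[ g ] a n +_) (+-identityʳ (g (a + n)))))

∑[]-zero : ∀ {g} a n → (∀ i → i < n → g (a + i) ≡ 0) → ∑[ g ] a n ≡ 0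
∑[]-zero {g} a n eq = trans (∑[]-cong {g} {λ _ → 0} a 0 n eq) (zeros 0 n)
  where
  zeros : ∀ a n → ∑[ (λ _ → 0) ] a n ≡ 0
  zeros a zero    = refl
  zeros a (suc n) = zeros (suc a) n

when : Bool → ℕ → ℕ
when b x = if b then x else 0

# : (ℕ → Bool) → ℕ → ℕ → ℕ
# P = ∑[ (λ u → when (P u) 1) ]

#-cong : ∀ (P Q : ℕ → Bool) a b n → (∀ i → i < n → P (a + i) ≡ Q (b + i)) → # P a n ≡ # Q b n
#-cong P Q a b n eq = ∑[]-cong {λ u → when (P u) 1} {λ u → when (Q u) 1} a b n
  λ i i<n → cong (λ t → when t 1) (eq i i<n)

∑[]-dead : ∀ (P : ℕ → Bool) (g : ℕ → ℕ) a n → (∀ w → a ≤ w → w < a + n → P w ≡ false) →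
           ∑[ (λ u → when (P u) (g u)) ] a n ≡ 0
∑[]-dead P g a n dead = ∑[]-zero {λ u → when (P u) (g u)} a n λ i i<n →
  cong (λ b → when b (g (a + i))) (dead (a + i) (m≤m+n a i) (+-monoʳ-< a i<n))

#-dead : ∀ (P : ℕ → Bool) a n → (∀ w → a ≤ w → w < a + n → P w ≡ false) → # P a n ≡ 0
#-dead P = ∑[]-dead P (λ _ → 1)

#-same : ∀ (P Q : ℕ → Bool) a n → (∀ w → a ≤ w → w < a + n → P w ≡ Q w) → # P a n ≡ # Q a n
#-same P Q a n eq = #-cong P Q a a n λ i i<n → eq (a + i) (m≤m+n a i) (+-monoʳ-< a i<n)

#-shift : ∀ (P Q : ℕ → Bool) a n → (∀ w → a ≤ w → w < a + n → P (suc w) ≡ Q w) → # P (suc a) n ≡ # Q a n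
#-shift P Q a n eq = #-cong P Q (suc a) a n λ i i<n → eq (a + i) (m≤m+n a i) (+-monoʳ-< a i<n)

#-split : ∀ (P : ℕ → Bool) a m n → # P a (m + n) ≡ # P a m + # P (a + m) n
#-split P = ∑[]-split λ u → when (P u) 1

#-snoc : ∀ (P : ℕ → Bool) a n → P (a + n) ≡ true → # P a (suc n) ≡ suc (# P a n)
#-snoc P a n last = trans (∑[]-snoc (λ u → when (P u) 1) a n)
  (trans (cong (λ b → # P a n + when b 1) last) (+-comm _ 1))

#-cons : ∀ (P : ℕ → Bool) a n → P a ≡ true → # P a (suc n) ≡ suc (# P (suc a) n)
#-cons P a n head = cong (λ b → when b 1 + # P (suc a) n) head

-- As `u` runs downwards through the marked sites, the number of marked sites above it runs through
-- 0, 1, 2, ... . This turns the list of children of a state into a sum `∑ G`. The equation for `r`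
-- makes `# P (suc u) r` count up to the end of the range.
∑-by-above : ∀ (P : ℕ → Bool) (g G : ℕ → ℕ) a n →
  (∀ u r → u + suc r ≡ a + n → a ≤ u → T (P u) → g u ≡ G (# P (suc u) r)) →
  ∑[ (λ u → when (P u) (g u)) ] a n ≡ ∑ G (# P a n)
∑-by-above P g G a zero    eq = refl
∑-by-above P g G a (suc n) eq with P a in Pa | eq a n refl ≤-refl
... | false | _ = ∑-by-above P g G (suc a) n λ u r e a<u → eq u r (trans e (sym (+-suc a n))) (<⇒≤ a<u)
... | true  | f = trans
  (cong₂ _+_ (f _) (∑-by-above P g G (suc a) n λ u r e a<u → eq u r (trans e (sym (+-suc a n))) (<⇒≤ a<u)))
  (+-comm (G (# P (suc a) n)) _)

∑-by-distance : ∀ (g G : ℕ → ℕ) a n → (∀ u r → u + suc r ≡ a + n → a ≤ u → g u ≡ G r) →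
                ∑[ g ] a n ≡ ∑ G n
∑-by-distance g G a zero    eq = refl
∑-by-distance g G a (suc n) eq = trans
  (cong₂ _+_ (eq a n refl ≤-refl)
             (∑-by-distance g G (suc a) n λ u r e a<u → eq u r (trans e (sym (+-suc a n))) (<⇒≤ a<u)))
  (+-comm (G n) _)

∑-by-below : ∀ (P : ℕ → Bool) (g G : ℕ → ℕ) n →
  (∀ u → u < n → T (P u) → g u ≡ G (# P 0 u)) →
  ∑[ (λ u → when (P u) (g u)) ] 0 n ≡ ∑ G (# P 0 n)
∑-by-below P g G zero    eq = refl
∑-by-below P g G (suc n) eq = begin
  ∑[ (λ u → when (P u) (g u)) ] 0 (suc n)
    ≡⟨ ∑[]-snoc (λ u → when (P u) (g u)) 0 n ⟩
  ∑[ (λ u → when (P u) (g u)) ] 0 n + when (P n) (g n)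
    ≡⟨ cong (_+ when (P n) (g n)) (∑-by-below P g G n λ u u<n → eq u (m<n⇒m<1+n u<n)) ⟩
  ∑ G (# P 0 n) + when (P n) (g n)
    ≡⟨ last (P n) (eq n ≤-refl) ⟩
  ∑ G (# P 0 n + when (P n) 1)
    ≡⟨ cong (∑ G) (∑[]-snoc (λ u → when (P u) 1) 0 n) ⟨
  ∑ G (# P 0 (suc n)) ∎
  where
  last : ∀ b → (T b → g n ≡ G (# P 0 n)) →
         ∑ G (# P 0 n) + when b (g n) ≡ ∑ G (# P 0 n + when b 1)
  last false _ = trans (+-identityʳ _) (cong (∑ G) (sym (+-identityʳ (# P 0 n))))
  last true  f = trans (cong (∑ G (# P 0 n) +_) (f _)) (cong (∑ G) (sym (+-comm (# P 0 n) 1)))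

-- The recurrences of the Fine words and of the two systems of succession rules

-- W n h counts the words of n letters that may follow a letter h, and Z n those that may
-- follow a letter 0 other than the first one, which have to start with 12.
mutual
  W : ℕ → ℕ → ℕ
  W zero    h = 1
  W (suc n) h = ∑ (λ y → W n (suc y)) (suc h) + Z n

  Z : ℕ → ℕ
  Z (suc (suc n)) = W n 2
  Z _             = 0

-- After the larger letter exactly one more next letter is allowed, namely h + 2.
W-suc : ∀ n h → W (suc n) (suc h) ≡ W (suc n) h + W n (2 + h)
W-suc n h = lemma (∑ (λ y → W n (suc y)) (suc h)) (W n (2 + h)) (Z n)
  where
  lemma : ∀ a b c → a + b + c ≡ a + c + b
  lemma = solve-∀

-- The succession rules β_j → α_0 … α_{j-1} β_{j+1} and α_j → α_0 … α_j β_0 β_{j+2}.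
mutual
  α : ℕ → ℕ → ℕ
  α zero    j = 1
  α (suc n) j = ∑ (α n) (suc j) + β n 0 + β n (2 + j)

  β : ℕ → ℕ → ℕ
  β zero    j = 1
  β (suc n) j = ∑ (α n) j + β n (suc j)

-- Multiplication of a generating function by x.
delay : (ℕ → ℕ) → ℕ → ℕ
delay f zero    = 0
delay f (suc n) = f n

-- The states α_j and β_{j+1} have the same children, except that α_j has β_0 in addition.
α≡β : ∀ n j → α n j ≡ β n (suc j) + delay (λ i → β i 0) n
α≡β zero    j = refl
α≡β (suc n) j = lemma (∑ (α n) (suc j)) (β n 0) (β n (2 + j))
  where
  lemma : ∀ a b c → a + b + c ≡ a + c + b
  lemma = solve-∀

-- Compared with β_j, the state β_{j+1} has the additional child α_j. By `α≡β` it counts as β_{j+1},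
-- which completes the children of β_j, plus a delayed β_0.
β-suc : ∀ n j → β (suc n) (suc j) ≡ β (suc n) j + delay (λ i → β i 0) n + β n (2 + j)
β-suc n j rewrite α≡β n j = lemma (∑ (α n) j) (β n (suc j)) (delay (λ i → β i 0) n) (β n (2 + j))
  where
  lemma : ∀ a b c d → a + (b + c) + d ≡ a + b + c + d
  lemma = solve-∀

mutual
  -- Coefficientwise, b_j + x b_0 = (1 + x) w_j. Both sides satisfy p_{j+1} = p_j + x p_{j+2}, so
  -- the step on `j` is linear; the initial conditions of the Fine words enter at j = 0 only.
  β≡W : ∀ n j → β n j + delay (λ i → β i 0) n ≡ W n j + delay (λ i → W i j) n
  β≡W zero    j       = refl
  β≡W (suc n) (suc j) = begin
    β (suc n) (suc j) + β n 0
      ≡⟨ cong (_+ β n 0) (β-suc n j) ⟩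
    β (suc n) j + d + β n (2 + j) + β n 0
      ≡⟨ lemma₁ (β (suc n) j) d (β n (2 + j)) (β n 0) ⟩
    (β (suc n) j + β n 0) + (β n (2 + j) + d)
      ≡⟨ cong₂ _+_ (β≡W (suc n) j) (β≡W n (2 + j)) ⟩
    (W (suc n) j + W n j) + (W n (2 + j) + delay (λ i → W i (2 + j)) n)
      ≡⟨ lemma₂ (W (suc n) j) (W n j) (W n (2 + j)) _ ⟩
    W (suc n) j + W n (2 + j) + (W n j + delay (λ i → W i (2 + j)) n)
      ≡⟨ cong₂ _+_ (sym (W-suc n j)) (sym (W-step n)) ⟩
    W (suc n) (suc j) + W n (suc j) ∎
    where
    d = delay (λ i → β i 0) n
    lemma₁ : ∀ a b c e → a + b + c + e ≡ (a + e) + (c + b)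
    lemma₁ = solve-∀
    lemma₂ : ∀ a b c e → (a + b) + (c + e) ≡ a + c + (b + e)
    lemma₂ = solve-∀
    W-step : ∀ n → W n (suc j) ≡ W n j + delay (λ i → W i (2 + j)) n
    W-step zero    = refl
    W-step (suc n) = W-suc n j
  β≡W (suc n) zero = cong₂ _+_ (β₀ n) (β≡W₀ n)
    where
    -- β_0 has the single child β_1, whereas a letter 0 is followed by 1 or by a 0 that starts 012.
    -- The claim comes from the case j = 1 one size lower, by cancelling the already known equality
    -- at j = 0.
    β₀ : ∀ n → β n 1 ≡ W n 1 + Z n
    β₀ zero    = refl
    β₀ (suc n) = +-cancelʳ-≡ (β n 0) _ _ (begin
      β (suc n) 1 + β n 0       ≡⟨ β≡W (suc n) 1 ⟩
      W (suc n) 1 + W n 1       ≡⟨ cong (W (suc n) 1 +_) (W₁ n) ⟩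
      W (suc n) 1 + (Z (suc n) + W n 0) ≡⟨ +-assoc (W (suc n) 1) _ _ ⟨
      W (suc n) 1 + Z (suc n) + W n 0 ≡⟨ cong (W (suc n) 1 + Z (suc n) +_) (β≡W₀ n) ⟨
      W (suc n) 1 + Z (suc n) + β n 0 ∎)
      where
      W₁ : ∀ n → W n 1 ≡ Z (suc n) + W n 0
      W₁ zero    = refl
      W₁ (suc n) = trans (W-suc n 0) (+-comm (W (suc n) 0) _)

  -- At j = 0 both sides of `β≡W` carry the factor 1 + x; induction on `n` divides by it.
  β≡W₀ : ∀ n → β n 0 ≡ W n 0
  β≡W₀ zero    = refl
  β≡W₀ (suc n) = +-cancelʳ-≡ (β n 0) _ _ (trans (β≡W (suc n) 0) (cong (W (suc n) 0 +_) (sym (β≡W₀ n))))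

-- The rules β′_0 → β′_1, β′_{j+1} → β′_2 … β′_{j+1} α′_j β′_{j+2} and
-- α′_j → (j+1 times β′_0) α′_0 β′_2.
mutual
  α′ : ℕ → ℕ → ℕ
  α′ zero    j = 1
  α′ (suc n) j = suc j * β′ n 0 + α′ n 0 + β′ n 2

  β′ : ℕ → ℕ → ℕ
  β′ zero    j       = 1
  β′ (suc n) zero    = β′ n 1
  β′ (suc n) (suc j) = ∑ (λ i → β′ n (2 + i)) j + α′ n j + β′ n (2 + j)

mutual
  -- The index `j` only counts copies of the child β′_0, so α′_j is affine in `j`; the remaining
  -- children α′_0 and β′_2 are those of β_1.
  α′≡β : ∀ n j → α′ n j ≡ β n 1 + suc j * delay (λ i → β i 0) n
  α′≡β zero    j = sym (cong suc (*-zeroʳ j))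
  α′≡β (suc n) j = trans (cong₂ (λ x y → suc j * x + α′ n 0 + y) (β′≡β n 0) (β′≡β n 2))
    (trans (+-assoc (suc j * β n 0) _ _) (trans (+-comm (suc j * β n 0) _)
      (cong (λ k → k + β n 2 + suc j * β n 0) (α′₀≡α₀ n))))

  α′₀≡α₀ : ∀ n → α′ n 0 ≡ α n 0
  α′₀≡α₀ n = trans (α′≡β n 0) (trans (cong (β n 1 +_) (+-identityʳ _)) (sym (α≡β n 0)))

  -- From β′_1 on, consecutive terms differ by x β′_{j+2} plus x times the increment x β_0 of α′,
  -- which is the difference found in `β-suc`. Only j = 0 and j = 1 are compared directly.
  β′≡β : ∀ n j → β′ n j ≡ β n j
  β′≡β zero    j       = refl
  β′≡β (suc n) zero    = β′≡β n 1
  β′≡β (suc n) (suc zero) = cong₂ _+_ (α′₀≡α₀ n) (β′≡β n 2)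
  β′≡β (suc n) (suc (suc j)) = begin
    ∑ (λ i → β′ n (2 + i)) j + β′ n (2 + j) + α′ n (suc j) + β′ n (3 + j)
      ≡⟨ cong (λ x → ∑ (λ i → β′ n (2 + i)) j + β′ n (2 + j) + x + β′ n (3 + j)) α′-suc ⟩
    ∑ (λ i → β′ n (2 + i)) j + β′ n (2 + j) + (α′ n j + d) + β′ n (3 + j)
      ≡⟨ lemma (∑ (λ i → β′ n (2 + i)) j) (β′ n (2 + j)) (α′ n j) d (β′ n (3 + j)) ⟩
    (∑ (λ i → β′ n (2 + i)) j + α′ n j + β′ n (2 + j)) + d + β′ n (3 + j)
      ≡⟨ cong₂ (λ x y → x + d + y) (β′≡β (suc n) (suc j)) (β′≡β n (3 + j)) ⟩
    β (suc n) (suc j) + d + β n (3 + j)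
      ≡⟨ β-suc n (suc j) ⟨
    β (suc n) (2 + j) ∎
    where
    d = delay (λ i → β i 0) n
    lemma : ∀ a b c d e → a + b + (c + d) + e ≡ (a + c + b) + d + e
    lemma = solve-∀
    α′-suc : α′ n (suc j) ≡ α′ n j + d
    α′-suc rewrite α′≡β n (suc j) | α′≡β n j = lem (β n 1) d j
      where
      lem : ∀ b d j → b + (d + (d + j * d)) ≡ b + (d + j * d) + d
      lem = solve-∀

-- Counting the Fine words

≡⇒Fin↔ : ∀ {m n} → m ≡ n → Fin m ↔ Fin n
≡⇒Fin↔ refl = ↔-refl

Σ-Fin-suc : ∀ {n} (B : Fin (suc n) → Set) → Σ (Fin (suc n)) B ↔ (B zero ⊎ Σ (Fin n) (B ∘ suc))
Σ-Fin-suc B = mk↔ₛ′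
  (λ { (zero , b) → inj₁ b ; (suc i , b) → inj₂ (i , b) })
  (λ { (inj₁ b) → zero , b ; (inj₂ (i , b)) → suc i , b })
  (λ { (inj₁ b) → refl ; (inj₂ (i , b)) → refl })
  (λ { (zero , b) → refl ; (suc i , b) → refl })

Σ-Fin-range : ∀ (g : ℕ → ℕ) a n {B : Fin n → Set} → (∀ i → B i ↔ Fin (g (a + toℕ i))) →
              Σ (Fin n) B ↔ Fin (∑[ g ] a n)
Σ-Fin-range g a zero    e = mk↔ₛ′ (λ { (() , _) }) (λ ()) (λ ()) (λ { (() , _) })
Σ-Fin-range g a (suc n) {B} e = ↔-trans (Σ-Fin-suc B) (↔-trans
  (↔-trans (e zero) (≡⇒Fin↔ (cong g (+-identityʳ a))) ⊎-cong
   Σ-Fin-range g (suc a) n λ i → ↔-trans (e (suc i)) (≡⇒Fin↔ (cong g (+-suc a (toℕ i)))))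
  (↔-sym +↔⊎))

∑[]≡∑ : ∀ g n → ∑[ g ] 0 n ≡ ∑ g n
∑[]≡∑ g zero    = refl
∑[]≡∑ g (suc n) = trans (∑[]-snoc g 0 n) (cong (_+ g n) (∑[]≡∑ g n))

Σ-T-≡ : ∀ {A : Set} {p : A → Bool} {x y : Σ A (T ∘ p)} → proj₁ x ≡ proj₁ y → x ≡ y
Σ-T-≡ {p = p} {x , a} {.x , b} refl = cong (x ,_) (T-irrelevant {p x} a b)

-- The words completing a prefix that ends in h.
Tail : ℕ → ℕ → Set
Tail h n = Σ (Vec ℕ n) λ w → T (stepOK (h ∷ toList w) ∧ zeroCond (toList w))

-- The words completing a prefix that ends in a letter 0 other than the first one.
ZeroTail : ℕ → Set
ZeroTail n = Σ (Vec ℕ n) λ w → T (stepOK (0 ∷ toList w) ∧ (starts12 (toList w) ∧ zeroCond (toList w)))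

private
  ∧-swap : ∀ {a b c} → T ((a ∧ b) ∧ c) → T a × T (b ∧ c)
  ∧-swap {true} t = _ , t

  ∧-unswap : ∀ {a b c} → T a → T (b ∧ c) → T ((a ∧ b) ∧ c)
  ∧-unswap {true} _ t = t

-- The next letter is either positive, written `suc y` with y ≤ h, and then imposes nothing new, or
-- a 0, which has to be followed by 12.
Tail-suc : ∀ h n → Tail h (suc n) ↔ (Σ (Fin (suc h)) (λ y → Tail (suc (toℕ y)) n) ⊎ ZeroTail n)
Tail-suc h n = mk↔ₛ′ to′ from′ to∘from from∘to
  where
  letter : ∀ y → T (y <ᵇ suc h) → Fin (suc h)
  letter y y<h = fromℕ< (<ᵇ⇒< y (suc h) y<h)
  toℕ-letter : ∀ y y<h → toℕ (letter y y<h) ≡ y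
  toℕ-letter y y<h = toℕ-fromℕ< (<ᵇ⇒< y (suc h) y<h)
  recast : ∀ {y z} → y ≡ z → Tail (suc y) n → Tail (suc z) n
  recast = subst (λ z → Tail (suc z) n)
  proj₁-recast : ∀ {y z} (e : y ≡ z) (w : Tail (suc y) n) → proj₁ (recast e w) ≡ proj₁ w
  proj₁-recast refl w = refl
  to′ : Tail h (suc n) → Σ (Fin (suc h)) (λ y → Tail (suc (toℕ y)) n) ⊎ ZeroTail n
  to′ (zero ∷ w , t)  = inj₂ (w , t)
  to′ (suc y ∷ w , t) = let (y<h , t′) = ∧-swap {y <ᵇ suc h} t in
    inj₁ (letter y y<h , recast (sym (toℕ-letter y y<h)) (w , t′))
  from′ : Σ (Fin (suc h)) (λ y → Tail (suc (toℕ y)) n) ⊎ ZeroTail n → Tail h (suc n)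
  from′ (inj₁ (y , w , t)) = suc (toℕ y) ∷ w , ∧-unswap {toℕ y <ᵇ suc h} (<⇒<ᵇ (toℕ<n y)) t
  from′ (inj₂ (w , t))     = zero ∷ w , t
  Σ-Tail-≡ : ∀ {x y : Σ (Fin (suc h)) (λ y → Tail (suc (toℕ y)) n)} →
             toℕ (proj₁ x) ≡ toℕ (proj₁ y) → proj₁ (proj₂ x) ≡ proj₁ (proj₂ y) → x ≡ y
  Σ-Tail-≡ {x , _} {y , _} e e′ with toℕ-injective {i = x} {y} e
  ... | refl = cong (x ,_) (Σ-T-≡ e′)
  to∘from : ∀ x → to′ (from′ x) ≡ x
  to∘from (inj₁ (y , w , t)) =
    let (y<h , t′) = ∧-swap {toℕ y <ᵇ suc h} (∧-unswap {toℕ y <ᵇ suc h} {stepOK (suc (toℕ y) ∷ toList w)} (<⇒<ᵇ (toℕ<n y)) t) in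
    cong inj₁ (Σ-Tail-≡ (toℕ-letter (toℕ y) y<h) (proj₁-recast (sym (toℕ-letter (toℕ y) y<h)) (w , t′)))
  to∘from (inj₂ (w , t))     = refl
  from∘to : ∀ x → from′ (to′ x) ≡ x
  from∘to (zero ∷ w , t)  = refl
  from∘to (suc y ∷ w , t) = let (y<h , t′) = ∧-swap {y <ᵇ suc h} t in
    Σ-T-≡ (cong₂ _∷_ (cong suc (toℕ-letter y y<h)) (proj₁-recast (sym (toℕ-letter y y<h)) (w , t′)))

private
  starts12-short : ∀ x → T (starts12 (x ∷ [])) → ⊥
  starts12-short zero          ()
  starts12-short (suc zero)    ()
  starts12-short (suc (suc x)) ()

  starts12-tail : ∀ {n} (w : Vec ℕ (2 + n)) → T (starts12 (toList w)) →
                  Σ (Vec ℕ n) λ w′ → w ≡ 1 ∷ 2 ∷ w′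
  starts12-tail (1 ∷ 2 ∷ w) t = w , refl
  starts12-tail (1 ∷ 0 ∷ w) ()
  starts12-tail (1 ∷ 1 ∷ w) ()
  starts12-tail (1 ∷ suc (suc (suc x)) ∷ w) ()
  starts12-tail (0 ∷ w) ()
  starts12-tail (suc (suc x) ∷ w) ()

  ZeroTail⇒starts12 : ∀ {n} (w : Vec ℕ n) →
    T (stepOK (0 ∷ toList w) ∧ (starts12 (toList w) ∧ zeroCond (toList w))) → T (starts12 (toList w))
  ZeroTail⇒starts12 w t =
    proj₁ (to T-∧ (proj₂ (to (T-∧ {stepOK (0 ∷ toList w)}) t)))

mutual
  Tail↔ : ∀ n h → Tail h n ↔ Fin (W n h)
  Tail↔ zero    h = mk↔ₛ′ (λ _ → zero) (λ _ → [] , _) (λ { zero → refl }) (λ { ([] , _) → refl })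
  Tail↔ (suc n) h = ↔-trans (Tail-suc h n) (↔-trans
    (↔-trans (Σ-Fin-range (λ y → W n (suc y)) 0 (suc h) (λ y → Tail↔ n (suc (toℕ y))))
             (≡⇒Fin↔ (∑[]≡∑ (λ y → W n (suc y)) (suc h)))
     ⊎-cong ZeroTail↔ n)
    (↔-sym +↔⊎))

  ZeroTail↔ : ∀ n → ZeroTail n ↔ Fin (Z n)
  ZeroTail↔ zero          = mk↔ₛ′ (λ { ([] , ()) }) (λ ()) (λ ()) (λ { ([] , ()) })
  ZeroTail↔ (suc zero)    = mk↔ₛ′ (⊥-elim ∘ no₁) (λ ()) (λ ()) (⊥-elim ∘ no₁)
    where
    no₁ : ZeroTail 1 → ⊥
    no₁ (x ∷ [] , t) = starts12-short x (ZeroTail⇒starts12 (x ∷ []) t)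
  ZeroTail↔ (suc (suc n)) = ↔-trans (mk↔ₛ′ to′ from′ to∘from from∘to) (Tail↔ n 2)
    where
    to′ : ZeroTail (suc (suc n)) → Tail 2 n
    to′ (w , t) with starts12-tail w (ZeroTail⇒starts12 w t)
    ... | w′ , refl = w′ , t
    from′ : Tail 2 n → ZeroTail (suc (suc n))
    from′ (w , t) = 1 ∷ 2 ∷ w , t
    to∘from : ∀ x → to′ (from′ x) ≡ x
    to∘from (w , t) = refl
    from∘to : ∀ x → from′ (to′ x) ≡ x
    from∘to (w , t) with starts12-tail w (ZeroTail⇒starts12 w t)
    ... | w′ , refl = refl

F13↔ : ∀ m → F13 (suc m) ↔ Fin (W m 0)
F13↔ m = ↔-trans (mk↔ₛ′ to′ (λ { (w , t) → 0 ∷ w , t }) (λ _ → refl) from∘to) (Tail↔ m 0)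
  where
  to′ : F13 (suc m) → Tail 0 m
  to′ (zero ∷ w , t) = w , t
  from∘to : ∀ x → (0 ∷ proj₁ (to′ x) , proj₂ (to′ x)) ≡ x
  from∘to (zero ∷ w , t) = refl

-- Patterns as chains of inequalities

-- `order` is the inverse of `word`: it lists the positions by increasing value. Both are stored so
-- that inversion is a mere exchange of fields in `rci`.
record Pattern : Set where
  field
    word order : Vec (Fin 4) 4
    word∘order : ∀ i → lookup word (lookup order i) ≡ i
    order∘word : ∀ i → lookup order (lookup word i) ≡ i

open Pattern public

⟦_⟧ : Pattern → List ℕ
⟦ P ⟧ = toList (tabulate λ i → suc (toℕ (lookup (word P) i)))

-- Three comparisons along increasing values replace all pairwise ones. The relation is a parameter
-- because the same chain is read on values, on entries in `Fin` and on the symbolic comparisons of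
-- `cmp`.
Chain : Pattern → (Fin 4 → Fin 4 → Set) → Set
Chain P _⊏_ = at 0F ⊏ at 1F × at 1F ⊏ at 2F × at 2F ⊏ at 3F
  where
  at : Fin 4 → Fin 4
  at = lookup (order P)

Chain-map : ∀ P {R R′ : Fin 4 → Fin 4 → Set} → (∀ i j → R i j → R′ i j) → Chain P R → Chain P R′
Chain-map P f (r , s , t) = f _ _ r , f _ _ s , f _ _ t

Values : Vec ℕ 4 → Fin 4 → Fin 4 → Set
Values s i j = lookup s i < lookup s j

mono₄ : ∀ (f : Fin 4 → ℕ) → f 0F < f 1F → f 1F < f 2F → f 2F < f 3F → ∀ {i j} → i Fin.< j → f i < f j
mono₄ f a b c {0F} {1F} _ = a
mono₄ f a b c {0F} {2F} _ = <-trans a b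
mono₄ f a b c {0F} {3F} _ = <-trans a (<-trans b c)
mono₄ f a b c {1F} {2F} _ = b
mono₄ f a b c {1F} {3F} _ = <-trans b c
mono₄ f a b c {2F} {3F} _ = c
mono₄ f a b c {_} {0F} ()
mono₄ f a b c {1F} {1F} (s≤s ())
mono₄ f a b c {2F} {1F} (s≤s ())
mono₄ f a b c {3F} {1F} (s≤s ())
mono₄ f a b c {2F} {2F} (s≤s (s≤s ()))
mono₄ f a b c {3F} {2F} (s≤s (s≤s ()))
mono₄ f a b c {3F} {3F} (s≤s (s≤s (s≤s ())))

private
  <ᵇ-true : ∀ {m n} → m < n → (m <ᵇ n) ≡ true
  <ᵇ-true {m} {n} m<n with m <ᵇ n | <⇒<ᵇ m<n
  ... | true | _ = refl

  <ᵇ-false : ∀ {m n} → n ≤ m → (m <ᵇ n) ≡ false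
  <ᵇ-false {m} {n} n≤m with m <ᵇ n | <ᵇ⇒< m n
  ... | false | _ = refl
  ... | true  | f = ⊥-elim (<⇒≱ (f _) n≤m)

  true-<ᵇ : ∀ {m n} → (m <ᵇ n) ≡ true → m < n
  true-<ᵇ {m} {n} eq = <ᵇ⇒< m n (subst T (sym eq) _)

  strict-<ᵇ : ∀ (f g : Fin 4 → ℕ) → (∀ {i j} → i Fin.< j → f i < f j) → (∀ {i j} → i Fin.< j → g i < g j) →
              ∀ i j → (f i <ᵇ f j) ≡ (g i <ᵇ g j)
  strict-<ᵇ f g f↑ g↑ i j with Finₚ.<-cmp i j
  ... | tri< i<j _ _ = trans (<ᵇ-true (f↑ i<j)) (sym (<ᵇ-true (g↑ i<j)))
  ... | tri≈ _ refl _ = trans (<ᵇ-false {f i} ≤-refl) (sym (<ᵇ-false {g i} ≤-refl))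
  ... | tri> _ _ j<i = trans (<ᵇ-false (<⇒≤ (f↑ j<i))) (sym (<ᵇ-false (<⇒≤ (g↑ j<i))))

  all-false : ∀ {A : Set} (f : A → Bool) xs → all f xs ≡ false → ∃ λ x → x ∈ xs × f x ≡ false
  all-false f (x ∷ xs) eq with f x in fx
  ... | false = x , here refl , fx
  ... | true with y , y∈xs , fy ← all-false f xs eq = y , there y∈xs , fy

  all-true : ∀ {A : Set} (f : A → Bool) {x} xs → T (all f xs) → x ∈ xs → T (f x)
  all-true f xs t x∈xs = All.lookup (Allₚ.all⁺ f xs t) x∈xs

SameOrder : List (ℕ × ℕ) → Set
SameOrder ps = ∀ p q → p ∈ ps → q ∈ ps → (proj₁ p <ᵇ proj₁ q) ≡ (proj₂ p <ᵇ proj₂ q)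

orderIso⁻ : ∀ σ τ → T (orderIso σ τ) → SameOrder (zip σ τ)
orderIso⁻ σ τ t p q p∈ q∈
  with proj₁ p <ᵇ proj₁ q | proj₂ p <ᵇ proj₂ q
     | all-true _ (zip σ τ) (all-true _ (zip σ τ) (proj₂ (to (T-∧ {length σ ≡ᵇ length τ}) t)) p∈) q∈
... | true  | true  | _ = refl
... | false | false | _ = refl

-- The comparison of Booleans in orderIso is local to it, so it cannot be named in a
-- goal: the proof examines a pair of entries on which that comparison fails.
orderIso⁺ : ∀ σ τ → length σ ≡ length τ → SameOrder (zip σ τ) → T (orderIso σ τ)
orderIso⁺ σ τ len same with orderIso σ τ in eq
... | true  = _
... | false rewrite len with length τ ≡ᵇ length τ | ≡⇒≡ᵇ (length τ) (length τ) refl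
... | true | _
  with p , p∈ , eq′ ← all-false _ (zip σ τ) eq
  with q , q∈ , eq″ ← all-false _ (zip σ τ) eq′
  with proj₁ p <ᵇ proj₁ q | proj₂ p <ᵇ proj₂ q | same p q p∈ q∈ | eq″
... | true  | true  | _  | ()
... | false | false | _  | ()
... | true  | false | () | _
... | false | true  | () | _

private
  zip-∈ : ∀ {n} (s t : Vec ℕ n) i → (lookup s i , lookup t i) ∈ zip (toList s) (toList t)
  zip-∈ (a ∷ s) (b ∷ t) zero    = here refl
  zip-∈ (a ∷ s) (b ∷ t) (suc i) = there (zip-∈ s t i)

  zip-∈⁻ : ∀ {n} (s t : Vec ℕ n) {p} → p ∈ zip (toList s) (toList t) → ∃ λ i → p ≡ (lookup s i , lookup t i)
  zip-∈⁻ (a ∷ s) (b ∷ t) (here refl) = zero , refl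
  zip-∈⁻ (a ∷ s) (b ∷ t) (there p∈) with i , eq ← zip-∈⁻ s t p∈ = suc i , eq

  toList-length : ∀ {n} (s : Vec ℕ n) → length (toList s) ≡ n
  toList-length []      = refl
  toList-length (x ∷ s) = cong suc (toList-length s)

-- Read in the order of the pattern's values, a chain is a strictly increasing map, and any two
-- strictly increasing maps on four points compare alike.
orderIso-⟦⟧ : ∀ s P → T (orderIso (toList s) ⟦ P ⟧) ⇔ Chain P (Values s)
orderIso-⟦⟧ s P = mk⇔ to′ from′
  where
  t = tabulate λ i → suc (toℕ (lookup (word P) i))
  f = lookup s ∘ lookup (order P)
  g = suc ∘ toℕ
  t≡ : ∀ i → lookup t i ≡ suc (toℕ (lookup (word P) i))
  t≡ = lookup∘tabulate λ i → suc (toℕ (lookup (word P) i))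
  to′ : T (orderIso (toList s) ⟦ P ⟧) → Chain P (Values s)
  to′ iso = step 0F 1F (s≤s (s≤s z≤n)) , step 1F 2F (s≤s (s≤s (s≤s z≤n))) , step 2F 3F ≤-refl
    where
    step : ∀ i j → g i < g j → f i < f j
    step i j i<j = true-<ᵇ (trans
      (orderIso⁻ (toList s) ⟦ P ⟧ iso _ _ (zip-∈ s t (lookup (order P) i)) (zip-∈ s t (lookup (order P) j)))
      (trans (cong₂ _<ᵇ_ (t-order i) (t-order j)) (<ᵇ-true i<j)))
      where
      t-order : ∀ i → lookup t (lookup (order P) i) ≡ g i
      t-order i = trans (t≡ _) (cong g (word∘order P i))
  from′ : Chain P (Values s) → T (orderIso (toList s) ⟦ P ⟧)
  from′ (a , b , c) = orderIso⁺ (toList s) ⟦ P ⟧ (trans (toList-length s) (sym (toList-length t))) same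
    where
    same : SameOrder (zip (toList s) ⟦ P ⟧)
    same p q p∈ q∈ with i , refl ← zip-∈⁻ s t p∈ | j , refl ← zip-∈⁻ s t q∈ =
      trans (cong₂ _<ᵇ_ (s-word i) (s-word j))
        (trans (strict-<ᵇ f g (mono₄ f a b c) s≤s (lookup (word P) i) (lookup (word P) j))
          (sym (cong₂ _<ᵇ_ (t≡ i) (t≡ j))))
      where
      s-word : ∀ i → lookup s i ≡ f (lookup (word P) i)
      s-word i = cong (lookup s) (sym (order∘word P i))

Matches : List Pattern → (Fin 4 → Fin 4 → Set) → Set
Matches Ps R = Any (λ P → Chain P R) Ps

Matches-map : ∀ Ps {R R′ : Fin 4 → Fin 4 → Set} → (∀ i j → R i j → R′ i j) → Matches Ps R → Matches Ps R′
Matches-map Ps f = Any.map (λ {P} → Chain-map P f)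

private
  digit : ℕ → Fin 4
  digit 1 = 0F
  digit 2 = 1F
  digit 3 = 2F
  digit _ = 3F

  positions : Vec (Fin 4) 4 → Vec (Fin 4) 4
  positions w = tabulate λ i →
    if does (lookup w 0F Fin.≟ i) then 0F else
    if does (lookup w 1F Fin.≟ i) then 1F else
    if does (lookup w 2F Fin.≟ i) then 2F else 3F

  digits : (a b c d : ℕ) → Vec (Fin 4) 4
  digits a b c d = digit a ∷ digit b ∷ digit c ∷ digit d ∷ []

  _inverts_ : Vec (Fin 4) 4 → Vec (Fin 4) 4 → Set
  v inverts w = True (Finₚ.all? λ i → lookup v (lookup w i) Fin.≟ i)

-- The two inverse laws are decided by evaluation, so a pattern is given by its digits alone.
pat : (a b c d : ℕ) → let w = digits a b c d in
      {w inverts positions w} → {positions w inverts w} → Pattern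
pat a b c d {p} {q} = record
  { word       = digits a b c d
  ; order      = positions (digits a b c d)
  ; word∘order = toWitness p
  ; order∘word = toWitness q
  }

-- Exchanging `word` and `order` is inversion; conjugating by `opposite` reverses positions and
-- complements values.
rci : Pattern → Pattern
rci P = record
  { word       = tabulate rciOrder
  ; order      = tabulate rciWord
  ; word∘order = λ i → begin
      lookup (tabulate rciOrder) (lookup (tabulate rciWord) i)
        ≡⟨ cong (lookup (tabulate rciOrder)) (lookup∘tabulate rciWord i) ⟩
      lookup (tabulate rciOrder) (rciWord i)
        ≡⟨ lookup∘tabulate rciOrder (rciWord i) ⟩
      opposite (lookup (order P) (opposite (rciWord i)))
        ≡⟨ cong (opposite ∘ lookup (order P)) (opposite-involutive (lookup (word P) (opposite i))) ⟩
      opposite (lookup (order P) (lookup (word P) (opposite i)))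
        ≡⟨ cong opposite (order∘word P (opposite i)) ⟩
      opposite (opposite i)
        ≡⟨ opposite-involutive i ⟩
      i ∎
  ; order∘word = λ i → begin
      lookup (tabulate rciWord) (lookup (tabulate rciOrder) i)
        ≡⟨ cong (lookup (tabulate rciWord)) (lookup∘tabulate rciOrder i) ⟩
      lookup (tabulate rciWord) (rciOrder i)
        ≡⟨ lookup∘tabulate rciWord (rciOrder i) ⟩
      opposite (lookup (word P) (opposite (rciOrder i)))
        ≡⟨ cong (opposite ∘ lookup (word P)) (opposite-involutive (lookup (order P) (opposite i))) ⟩
      opposite (lookup (word P) (lookup (order P) (opposite i)))
        ≡⟨ cong opposite (word∘order P (opposite i)) ⟩
      opposite (opposite i)
        ≡⟨ opposite-involutive i ⟩
      i ∎
  }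
  where
  rciOrder rciWord : Fin 4 → Fin 4
  rciOrder i = opposite (lookup (order P) (opposite i))
  rciWord  i = opposite (lookup (word P) (opposite i))

-- Codes and their subsequences

-- punch u is the increasing map ℕ → ℕ whose only missed value is u.
punch : ℕ → ℕ → ℕ
punch zero    x       = suc x
punch (suc u) zero    = zero
punch (suc u) (suc x) = suc (punch u x)

punch-≥ : ∀ {u x} → u ≤ x → punch u x ≡ suc x
punch-≥ {zero}  {x}     _         = refl
punch-≥ {suc u} {suc x} (s≤s u≤x) = cong suc (punch-≥ u≤x)

punch-< : ∀ {u x} → x < u → punch u x ≡ x
punch-< {suc u} {zero}  _         = refl
punch-< {suc u} {suc x} (s≤s x<u) = cong suc (punch-< x<u)

punch-mono-< : ∀ u {x y} → x < y ⇔ punch u x < punch u y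
punch-mono-< u = mk⇔ (mono u) (cancel u)
  where
  mono : ∀ u {x y} → x < y → punch u x < punch u y
  mono zero    x<y                         = s≤s x<y
  mono (suc u) {zero}  {suc y} _           = z<s
  mono (suc u) {suc x} {suc y} (s≤s x<y)   = s≤s (mono u x<y)
  cancel : ∀ u {x y} → punch u x < punch u y → x < y
  cancel zero    (s≤s x<y)                 = x<y
  cancel (suc u) {zero}  {suc y} _         = z<s
  cancel (suc u) {suc x} {suc y} (s≤s x<y) = s≤s (cancel u x<y)

punch-below : ∀ u {x} → x < u ⇔ punch u x < u
punch-below u = mk⇔ (λ x<u → subst (_< u) (sym (punch-< x<u)) x<u) (f u)
  where
  f : ∀ u {x} → punch u x < u → x < u
  f (suc u) {zero}  _         = z<s
  f (suc u) {suc x} (s≤s x<u) = s≤s (f u x<u)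

punch-above : ∀ u {x} → u ≤ x ⇔ u < punch u x
punch-above u = mk⇔ (λ u≤x → subst (u <_) (sym (punch-≥ u≤x)) (s≤s u≤x)) (f u)
  where
  f : ∀ u {x} → u < punch u x → u ≤ x
  f zero            _         = z≤n
  f (suc u) {suc x} (s≤s u<x) = s≤s (f u u<x)

-- Both composites are the increasing map that misses exactly `w` and `suc u`.
punch-punch : ∀ {w u} x → w ≤ u → punch w (punch u x) ≡ punch (suc u) (punch w x)
punch-punch x       z≤n       = refl
punch-punch zero    (s≤s w≤u) = refl
punch-punch (suc x) (s≤s w≤u) = cong suc (punch-punch x w≤u)

module _ {u w : ℕ} (w≤u : w ≤ u) where

  punch-<-low : ∀ {x} → x < w ⇔ punch u x < w
  punch-<-low = mk⇔
    (λ x<w → subst (_< w) (sym (punch-< (<-≤-trans x<w w≤u))) x<w)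
    (λ p → subst (_< w) (punch-< (from (punch-below u) (<-≤-trans p w≤u))) p)

  punch-≤-low : ∀ {x} → w ≤ x ⇔ w ≤ punch u x
  punch-≤-low = mk⇔
    (λ w≤x → ≮⇒≥ λ p → <⇒≱ (from punch-<-low p) w≤x)
    (λ p → ≮⇒≥ λ x<w → <⇒≱ (to punch-<-low x<w) p)

module _ {u w : ℕ} (u≤w : u ≤ w) where

  punch-<-high : ∀ {x} → x < w ⇔ punch u x < suc w
  punch-<-high {x} = mk⇔ grow λ p → ≰⇒> λ w≤x → <⇒≱ p (shift w≤x)
    where
    shift : ∀ {x} → w ≤ x → suc w ≤ punch u x
    shift w≤x = subst (suc w ≤_) (sym (punch-≥ (≤-trans u≤w w≤x))) (s≤s w≤x)
    grow : x < w → punch u x < suc w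
    grow x<w with u ≤? x
    ... | yes u≤x = subst (_< suc w) (sym (punch-≥ u≤x)) (s≤s x<w)
    ... | no  u≰x = subst (_< suc w) (sym (punch-< (≰⇒> u≰x))) (m≤n⇒m≤1+n x<w)

  punch-≤-high : ∀ {x} → w ≤ x ⇔ suc w ≤ punch u x
  punch-≤-high = mk⇔
    (λ w≤x → ≮⇒≥ λ p → <⇒≱ (from punch-<-high p) w≤x)
    (λ p → ≮⇒≥ λ x<w → <⇒≱ (to punch-<-high x<w) p)

-- A code lists the first entry of a permutation relative to the later ones (its site:
-- the number of smaller later entries), then the code of the later ones.
entries : List ℕ → List ℕ
entries []      = []
entries (u ∷ c) = u ∷ map (punch u) (entries c)

-- The subsequences of length one to four are inductive families over the code, so that case
-- analysis tells whether an occurrence starts at the newest entry.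
data Mem : List ℕ → ℕ → Set where
  here  : ∀ {u c} → Mem (u ∷ c) u
  there : ∀ {u c x} → Mem c x → Mem (u ∷ c) (punch u x)

-- Pair c x y: the value x stands to the left of the value y.
data Pair : List ℕ → ℕ → ℕ → Set where
  here  : ∀ {u c x} → Mem c x → Pair (u ∷ c) u (punch u x)
  there : ∀ {u c x y} → Pair c x y → Pair (u ∷ c) (punch u x) (punch u y)

data Triple : List ℕ → ℕ → ℕ → ℕ → Set where
  here  : ∀ {u c x y} → Pair c x y → Triple (u ∷ c) u (punch u x) (punch u y)
  there : ∀ {u c x y z} → Triple c x y z → Triple (u ∷ c) (punch u x) (punch u y) (punch u z)

data Quad : List ℕ → Vec ℕ 4 → Set where
  here  : ∀ {u c x y z} → Triple c x y z → Quad (u ∷ c) (u ∷ punch u x ∷ punch u y ∷ punch u z ∷ [])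
  there : ∀ {u c s} → Quad c s → Quad (u ∷ c) (Vec.map (punch u) s)

subseqs-map : ∀ (f : ℕ → ℕ) k xs → subseqs k (map f xs) ≡ map (map f) (subseqs k xs)
subseqs-map f zero    xs       = refl
subseqs-map f (suc k) []       = refl
subseqs-map f (suc k) (x ∷ xs)
  rewrite subseqs-map f k xs | subseqs-map f (suc k) xs
        | map-++ (map f) (map (x ∷_) (subseqs k xs)) (subseqs (suc k) xs)
  = cong (_++ map (map f) (subseqs (suc k) xs))
      (trans (sym (map-∘ {g = f x ∷_} {map f} (subseqs k xs))) (map-∘ {g = map f} {x ∷_} (subseqs k xs)))

module _ (k : ℕ) {u : ℕ} (c : List ℕ) {s : List ℕ} where

  subseqs-here : s ∈ subseqs k (entries c) → (u ∷ map (punch u) s) ∈ subseqs (suc k) (entries (u ∷ c))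
  subseqs-here s∈ rewrite subseqs-map (punch u) k (entries c) =
    ∈-++⁺ˡ (∈-map⁺ (u ∷_) (∈-map⁺ (map (punch u)) s∈))

  subseqs-there : s ∈ subseqs (suc k) (entries c) → map (punch u) s ∈ subseqs (suc k) (entries (u ∷ c))
  subseqs-there s∈ rewrite subseqs-map (punch u) (suc k) (entries c) =
    ∈-++⁺ʳ _ (∈-map⁺ (map (punch u)) s∈)

  subseqs-∷⁻ : s ∈ subseqs (suc k) (entries (u ∷ c)) →
    (∃ λ t → t ∈ subseqs k (entries c) × s ≡ u ∷ map (punch u) t) ⊎
    (∃ λ t → t ∈ subseqs (suc k) (entries c) × s ≡ map (punch u) t)
  subseqs-∷⁻ s∈ rewrite subseqs-map (punch u) k (entries c) | subseqs-map (punch u) (suc k) (entries c)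
    with ∈-++⁻ (map (u ∷_) (map (map (punch u)) (subseqs k (entries c)))) s∈
  ... | inj₂ s∈′ = inj₂ (∈-map⁻ (map (punch u)) s∈′)
  ... | inj₁ s∈′ with t , t∈ , refl ← ∈-map⁻ (u ∷_) s∈′ with t′ , t′∈ , refl ← ∈-map⁻ (map (punch u)) t∈ =
    inj₁ (t′ , t′∈ , refl)

single⁺ : ∀ {c x} → Mem c x → (x ∷ []) ∈ subseqs 1 (entries c)
single⁺ (here {c = c})      = subseqs-here 0 c (here refl)
single⁺ (there {c = c} m) = subseqs-there 0 c (single⁺ m)

pair⁺ : ∀ {c x y} → Pair c x y → (x ∷ y ∷ []) ∈ subseqs 2 (entries c)
pair⁺ (here {c = c} m)  = subseqs-here 1 c (single⁺ m)
pair⁺ (there {c = c} p) = subseqs-there 1 c (pair⁺ p)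

triple⁺ : ∀ {c x y z} → Triple c x y z → (x ∷ y ∷ z ∷ []) ∈ subseqs 3 (entries c)
triple⁺ (here {c = c} p)  = subseqs-here 2 c (pair⁺ p)
triple⁺ (there {c = c} t) = subseqs-there 2 c (triple⁺ t)

quad⁺ : ∀ {c s} → Quad c s → toList s ∈ subseqs 4 (entries c)
quad⁺ (here {c = c} t)                           = subseqs-here 3 c (triple⁺ t)
quad⁺ (there {c = c} {_ ∷ _ ∷ _ ∷ _ ∷ []} q) = subseqs-there 3 c (quad⁺ q)

single⁻ : ∀ c {s} → s ∈ subseqs 1 (entries c) → ∃ λ x → s ≡ x ∷ [] × Mem c x
single⁻ (u ∷ c) s∈ with subseqs-∷⁻ 0 c s∈
... | inj₁ (_ , here refl , refl) = u , refl , here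
... | inj₂ (_ , t∈ , refl) with x , refl , m ← single⁻ c t∈ = _ , refl , there m

pair⁻ : ∀ c {s} → s ∈ subseqs 2 (entries c) → ∃ λ x → ∃ λ y → s ≡ x ∷ y ∷ [] × Pair c x y
pair⁻ (u ∷ c) s∈ with subseqs-∷⁻ 1 c s∈
... | inj₁ (_ , t∈ , refl) with x , refl , m ← single⁻ c t∈ = _ , _ , refl , here m
... | inj₂ (_ , t∈ , refl) with x , y , refl , p ← pair⁻ c t∈ = _ , _ , refl , there p

triple⁻ : ∀ c {s} → s ∈ subseqs 3 (entries c) → ∃ λ x → ∃ λ y → ∃ λ z → s ≡ x ∷ y ∷ z ∷ [] × Triple c x y z
triple⁻ (u ∷ c) s∈ with subseqs-∷⁻ 2 c s∈
... | inj₁ (_ , t∈ , refl) with x , y , refl , p ← pair⁻ c t∈ = _ , _ , _ , refl , here p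
... | inj₂ (_ , t∈ , refl) with x , y , z , refl , t ← triple⁻ c t∈ = _ , _ , _ , refl , there t

quad⁻ : ∀ c {s} → s ∈ subseqs 4 (entries c) → ∃ λ t → s ≡ toList t × Quad c t
quad⁻ (u ∷ c) s∈ with subseqs-∷⁻ 3 c s∈
... | inj₁ (_ , t∈ , refl) with x , y , z , refl , t ← triple⁻ c t∈ = _ , refl , here t
... | inj₂ (_ , t∈ , refl) with t@(_ ∷ _ ∷ _ ∷ _ ∷ []) , refl , q ← quad⁻ c t∈ = _ , refl , there q

T-not : ∀ {b} → T (not b) ⇔ (¬ T b)
T-not {true}  = mk⇔ (λ ()) (λ f → f _)
T-not {false} = mk⇔ (λ _ ()) _

module _ {Q : Vec ℕ 4 → Set} (π : List ℕ)
         (⁺ : ∀ {s} → Q s → toList s ∈ subseqs 4 π)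
         (⁻ : ∀ {s} → s ∈ subseqs 4 π → ∃ λ t → s ≡ toList t × Q t) where

  -- The description `Q` of the subsequences is a parameter because two are needed: `Quad` for
  -- insertions, and increasing maps of positions for the reflection, which exchanges positions and
  -- values.
  contains⇔ : ∀ P → T (contains π ⟦ P ⟧) ⇔ (∃ λ s → Q s × Chain P (Values s))
  contains⇔ P = mk⇔ f g
    where
    f : T (contains π ⟦ P ⟧) → ∃ λ s → Q s × Chain P (Values s)
    f t with s , s∈ , iso ← find (any⁻ (λ s → orderIso s ⟦ P ⟧) (subseqs 4 π) t)
        with s′ , refl , q ← ⁻ s∈ = s′ , q , to (orderIso-⟦⟧ s′ P) iso
    g : (∃ λ s → Q s × Chain P (Values s)) → T (contains π ⟦ P ⟧)
    g (s , q , ch) = any⁺ (λ s → orderIso s ⟦ P ⟧) (lose (⁺ q) (from (orderIso-⟦⟧ s P) ch))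

  avoidsAll⇔ : ∀ Ps → T (avoidsAll π (map ⟦_⟧ Ps)) ⇔ (∀ {s} → Q s → ¬ Matches Ps (Values s))
  avoidsAll⇔ Ps = mk⇔ (f Ps) (g Ps)
    where
    f : ∀ Ps → T (avoidsAll π (map ⟦_⟧ Ps)) → ∀ {s} → Q s → ¬ Matches Ps (Values s)
    f (P ∷ Ps) t q (here ch) = to T-not (proj₁ (to T-∧ t)) (from (contains⇔ P) (_ , q , ch))
    f (P ∷ Ps) t q (there m) = f Ps (proj₂ (to (T-∧ {not (contains π ⟦ P ⟧)}) t)) q m
    g : ∀ Ps → (∀ {s} → Q s → ¬ Matches Ps (Values s)) → T (avoidsAll π (map ⟦_⟧ Ps))
    g []       avoid = _
    g (P ∷ Ps) avoid = from T-∧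
      ( from T-not (λ t → let (s , q , ch) = to (contains⇔ P) t in avoid q (here ch))
      , g Ps (λ q m → avoid q (there m)))

-- Survival of a site under one insertion

-- How the first entry at site w, the second entry at site u and two later values x, y
-- compare; A and B say whether the first entry is below or above the second.
cmp : (A B : Set) (w u x y : ℕ) → Fin 4 → Fin 4 → Set
cmp A B w u x y 0F 1F = A
cmp A B w u x y 1F 0F = B
cmp A B w u x y 0F 2F = w ≤ x
cmp A B w u x y 0F 3F = w ≤ y
cmp A B w u x y 2F 0F = x < w
cmp A B w u x y 3F 0F = y < w
cmp A B w u x y 1F 2F = u ≤ x
cmp A B w u x y 1F 3F = u ≤ y
cmp A B w u x y 2F 1F = x < u
cmp A B w u x y 3F 1F = y < u
cmp A B w u x y 2F 3F = x < y
cmp A B w u x y 3F 2F = y < x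
cmp A B w u x y 0F 0F = ⊥
cmp A B w u x y 1F 1F = ⊥
cmp A B w u x y 2F 2F = ⊥
cmp A B w u x y 3F 3F = ⊥

Below Above : (w u x y : ℕ) → Fin 4 → Fin 4 → Set
Below = cmp ⊤ ⊥
Above = cmp ⊥ ⊤

-- Here `w°` is the site `w` as seen without the second entry: the same number if `w` is at most
-- `u`, one less otherwise. The later values stay relative to `c`, which frees the five classes of
-- all punching.
cmp⇔ : ∀ {A B} w w° u x y →
  A ⇔ (w < punch w u) → B ⇔ (punch w u < w) →
  (∀ {x} → w° ≤ x ⇔ w ≤ punch u x) → (∀ {x} → x < w° ⇔ punch u x < w) →
  ∀ i j → cmp A B w° u x y i j ⇔
          Values (w ∷ punch w u ∷ punch w (punch u x) ∷ punch w (punch u y) ∷ []) i j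
cmp⇔ {A} {B} w w° u x y A⇔ B⇔ ≤⇔ <⇔ = go
  where
  infixr 2 _▸_
  _▸_ : ∀ {A B C : Set} → A ⇔ B → B ⇔ C → A ⇔ C
  e ▸ f = mk⇔ (to f ∘ to e) (from e ∘ from f)
  irr : ∀ {n} → ⊥ ⇔ (n < n)
  irr = mk⇔ (λ ()) (<-irrefl refl)
  go : ∀ i j → cmp A B w° u x y i j ⇔ Values (w ∷ punch w u ∷ punch w (punch u x) ∷ punch w (punch u y) ∷ []) i j
  go 0F 1F = A⇔
  go 1F 0F = B⇔
  go 0F 2F = ≤⇔ ▸ punch-above w
  go 0F 3F = ≤⇔ ▸ punch-above w
  go 2F 0F = <⇔ ▸ punch-below w
  go 3F 0F = <⇔ ▸ punch-below w
  go 1F 2F = punch-above u ▸ punch-mono-< w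
  go 1F 3F = punch-above u ▸ punch-mono-< w
  go 2F 1F = punch-below u ▸ punch-mono-< w
  go 3F 1F = punch-below u ▸ punch-mono-< w
  go 2F 3F = punch-mono-< u ▸ punch-mono-< w
  go 3F 2F = punch-mono-< u ▸ punch-mono-< w
  go 0F 0F = irr
  go 1F 1F = irr
  go 2F 2F = irr
  go 3F 3F = irr

module Sites (Ps : List Pattern) where

  -- Opaque, so that unification does not unfold the search for patterns.
  opaque
    avoids : List ℕ → Bool
    avoids c = avoidsAll (entries c) (map ⟦_⟧ Ps)

    avoids≡ : ∀ c → avoids c ≡ avoidsAll (entries c) (map ⟦_⟧ Ps)
    avoids≡ c = refl

    avoids⇔ : ∀ c → T (avoids c) ⇔ (∀ {s} → Quad c s → ¬ Matches Ps (Values s))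
    avoids⇔ c = avoidsAll⇔ (entries c) quad⁺ (quad⁻ c) Ps

  -- Whether a new first entry may be inserted at site w.
  alive : List ℕ → ℕ → Bool
  alive c w = avoids (w ∷ c)

  alive-[] : T (alive [] 0)
  alive-[] = from (avoids⇔ (0 ∷ [])) λ { (here ()) ; (there ()) }

  Matches-punch : ∀ v s → Matches Ps (Values s) ⇔ Matches Ps (Values (Vec.map (punch v) s))
  Matches-punch v s = mk⇔
    (Matches-map Ps {Values s} {Values (Vec.map (punch v) s)} λ i j → to (Values-punch i j))
    (Matches-map Ps {Values (Vec.map (punch v) s)} {Values s} λ i j → from (Values-punch i j))
    where
    Values-punch : ∀ i j → Values s i j ⇔ Values (Vec.map (punch v) s) i j
    Values-punch i j rewrite lookup-map i (punch v) s | lookup-map j (punch v) s = punch-mono-< v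

  -- Occurrences through the first entry either skip the second one, and then live over
  -- the shorter code, or consist of the first two entries and a later pair.
  alive-∷ : ∀ {A B} {c u} w w° v →
    A ⇔ (w < punch w u) → B ⇔ (punch w u < w) →
    (∀ {x} → w° ≤ x ⇔ w ≤ punch u x) → (∀ {x} → x < w° ⇔ punch u x < w) →
    w ≡ punch v w° → (∀ x → punch w (punch u x) ≡ punch v (punch w° x)) →
    T (alive c u) →
    T (alive (u ∷ c) w) ⇔ (T (alive c w°) × (∀ {x y} → Pair c x y → ¬ Matches Ps (cmp A B w° u x y)))
  alive-∷ {A} {B} {c} {u} w w° v A⇔ B⇔ ≤⇔ <⇔ w≡ pp au = mk⇔ f g
    where
    cmp-Matches : ∀ x y → Matches Ps (cmp A B w° u x y) ⇔
                  Matches Ps (Values (w ∷ punch w u ∷ punch w (punch u x) ∷ punch w (punch u y) ∷ []))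
    cmp-Matches x y = mk⇔ (Matches-map Ps λ i j → to (equiv i j)) (Matches-map Ps λ i j → from (equiv i j))
      where equiv = cmp⇔ w w° u x y A⇔ B⇔ ≤⇔ <⇔
    -- In both uses `v` is the value of the second entry, so `punch v` reinserts the gap left when
    -- that entry is deleted.
    skip : ∀ x y z → Vec.map (punch v) (w° ∷ punch w° x ∷ punch w° y ∷ punch w° z ∷ []) ≡
           w ∷ punch w (punch u x) ∷ punch w (punch u y) ∷ punch w (punch u z) ∷ []
    skip x y z = sym (cong₂ _∷_ w≡ (cong₂ _∷_ (pp x) (cong₂ _∷_ (pp y) (cong (_∷ []) (pp z)))))
    f : T (alive (u ∷ c) w) → T (alive c w°) × (∀ {x y} → Pair c x y → ¬ Matches Ps (cmp A B w° u x y))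
    f t = from (avoids⇔ (w° ∷ c)) old , λ {x} {y} p m → none (here (here p)) (to (cmp-Matches x y) m)
      where
      none : ∀ {s} → Quad (w ∷ u ∷ c) s → ¬ Matches Ps (Values s)
      none = to (avoids⇔ (w ∷ u ∷ c)) t
      old : ∀ {s} → Quad (w° ∷ c) s → ¬ Matches Ps (Values s)
      old (there {s = s} q) m = to (avoids⇔ (u ∷ c)) au (there q) (to (Matches-punch u s) (from (Matches-punch w° s) m))
      old (here {x = x} {y} {z} t) m = none (here (there t))
        (subst (Matches Ps ∘ Values) (skip x y z) (to (Matches-punch v (w° ∷ punch w° x ∷ punch w° y ∷ punch w° z ∷ [])) m))
    g : T (alive c w°) × (∀ {x y} → Pair c x y → ¬ Matches Ps (cmp A B w° u x y)) → T (alive (u ∷ c) w)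
    g (t , noPair) = from (avoids⇔ (w ∷ u ∷ c)) new
      where
      new : ∀ {s} → Quad (w ∷ u ∷ c) s → ¬ Matches Ps (Values s)
      new (there {s = s} q) m = to (avoids⇔ (u ∷ c)) au q (from (Matches-punch w s) m)
      new (here (here {x = x} {y} p)) m = noPair p (from (cmp-Matches x y) m)
      new (here (there {x = x} {y} {z} tr)) m = to (avoids⇔ (w° ∷ c)) t (here tr)
        (from (Matches-punch v (w° ∷ punch w° x ∷ punch w° y ∷ punch w° z ∷ [])) (subst (Matches Ps ∘ Values) (sym (skip x y z)) m))

  alive-below : ∀ {c u w} → w ≤ u → T (alive c u) →
    T (alive (u ∷ c) w) ⇔ (T (alive c w) × (∀ {x y} → Pair c x y → ¬ Matches Ps (Below w u x y)))
  alive-below {c} {u} {w} w≤u = alive-∷ w w (suc u)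
    (mk⇔ (λ _ → to (punch-above w) w≤u) _)
    (mk⇔ (λ ()) (λ lt → <⇒≱ (from (punch-below w) lt) w≤u))
    (punch-≤-low w≤u) (punch-<-low w≤u)
    (sym (punch-< (s≤s w≤u))) (λ x → punch-punch x w≤u)

  alive-above : ∀ {c u w} → u ≤ w → T (alive c u) →
    T (alive (u ∷ c) (suc w)) ⇔ (T (alive c w) × (∀ {x y} → Pair c x y → ¬ Matches Ps (Above w u x y)))
  alive-above {c} {u} {w} u≤w = alive-∷ (suc w) w u
    (mk⇔ (λ ()) (λ lt → <⇒≱ lt (subst (_≤ suc w) (sym (punch-< (s≤s u≤w))) (m≤n⇒m≤1+n u≤w))))
    (mk⇔ (λ _ → subst (_< suc w) (sym (punch-< (s≤s u≤w))) (s≤s u≤w)) _)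
    (punch-≤-high u≤w) (punch-<-high u≤w)
    (sym (punch-≥ u≤w)) (λ x → sym (punch-punch x u≤w))

-- Permutations as codes, and their generation by insertions

≗⇒≡ : ∀ {A : Set} {n} {v w : Vec A n} → (∀ i → lookup v i ≡ lookup w i) → v ≡ w
≗⇒≡ {v = v} {w} eq = trans (sym (tabulate∘lookup v)) (trans (tabulate-cong eq) (tabulate∘lookup w))

Inj : ∀ {m n} → Vec (Fin m) n → Set
Inj v = ∀ {i j} → lookup v i ≡ lookup v j → i ≡ j

T-all⇔ : ∀ {m n} (p : ℕ → Bool) (v : Vec (Fin m) n) →
         T (all p (map toℕ (toList v))) ⇔ (∀ i → T (p (toℕ (lookup v i))))
T-all⇔ p []      = mk⇔ (λ _ ()) _
T-all⇔ p (x ∷ v) = mk⇔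
  (λ { t zero    → proj₁ (to T-∧ t)
     ; t (suc i) → to (T-all⇔ p v) (proj₂ (to (T-∧ {p (toℕ x)}) t)) i })
  (λ f → from T-∧ (f zero , from (T-all⇔ p v) (f ∘ suc)))

distinct⇔ : ∀ {m n} (v : Vec (Fin m) n) → T (distinct (map toℕ (toList v))) ⇔ Inj v
distinct⇔ []      = mk⇔ (λ { _ {()} }) _
distinct⇔ (x ∷ v) = mk⇔ f g
  where
  ≢⇔ : ∀ {m} {x y : Fin m} → T (not (toℕ x ≡ᵇ toℕ y)) ⇔ (x ≢ y)
  ≢⇔ {x = x} {y} = mk⇔
    (λ t eq → to T-not t (≡⇒≡ᵇ _ _ (cong toℕ eq)))
    (λ ne → from T-not (λ t → ne (toℕ-injective (≡ᵇ⇒≡ _ _ t))))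
  f : T (distinct (map toℕ (toList (x ∷ v)))) → Inj (x ∷ v)
  f t {zero}  {zero}  eq = refl
  f t {zero}  {suc j} eq = ⊥-elim (to ≢⇔ (to (T-all⇔ _ v) (proj₁ (to T-∧ t)) j) eq)
  f t {suc i} {zero}  eq = ⊥-elim (to ≢⇔ (to (T-all⇔ _ v) (proj₁ (to T-∧ t)) i) (sym eq))
  f t {suc i} {suc j} eq =
    cong suc (to (distinct⇔ v) (proj₂ (to (T-∧ {all (λ y → not (toℕ x ≡ᵇ y)) (map toℕ (toList v))}) t)) eq)
  g : Inj (x ∷ v) → T (distinct (map toℕ (toList (x ∷ v))))
  g inj = from T-∧
    ( from (T-all⇔ _ v) (λ i → from ≢⇔ (λ eq → Finₚ.0≢1+n (inj {zero} {suc i} eq)))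
    , from (distinct⇔ v) (λ eq → Finₚ.suc-injective (inj eq)))

infixr 5 _∷_

-- The bounds on the sites are kept in the type for the bijection with permutations; `sites` drops
-- them for the arithmetic of the classes.
data Code : ℕ → Set where
  []  : Code 0
  _∷_ : ∀ {m} → Fin (suc m) → Code m → Code (suc m)

sites : ∀ {m} → Code m → List ℕ
sites []      = []
sites (u ∷ c) = toℕ u ∷ sites c

length-sites : ∀ {m} (c : Code m) → length (sites c) ≡ m
length-sites []      = refl
length-sites (u ∷ c) = cong suc (length-sites c)

decode : ∀ {m} → Code m → Vec (Fin m) m
decode []      = []
decode (u ∷ c) = u ∷ Vec.map (punchIn u) (decode c)

toℕ-punchIn : ∀ {m} (u : Fin (suc m)) x → toℕ (punchIn u x) ≡ punch (toℕ u) (toℕ x)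
toℕ-punchIn zero    x       = refl
toℕ-punchIn (suc u) zero    = refl
toℕ-punchIn (suc u) (suc x) = cong suc (toℕ-punchIn u x)

permEntries-decode : ∀ {m} (c : Code m) → permEntries (decode c) ≡ entries (sites c)
permEntries-decode []      = refl
permEntries-decode (u ∷ c) = cong (toℕ u ∷_)
  (trans (permEntries-punchIn (decode c)) (cong (map (punch (toℕ u))) (permEntries-decode c)))
  where
  permEntries-punchIn : ∀ {n} (v : Vec _ n) →
    map toℕ (toList (Vec.map (punchIn u) v)) ≡ map (punch (toℕ u)) (map toℕ (toList v))
  permEntries-punchIn []      = refl
  permEntries-punchIn (x ∷ v) = cong₂ _∷_ (toℕ-punchIn u x) (permEntries-punchIn v)

decode-Inj : ∀ {m} (c : Code m) → Inj (decode c)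
decode-Inj (u ∷ c) {zero}  {zero}  eq = refl
decode-Inj (u ∷ c) {zero}  {suc j} eq =
  ⊥-elim (punchInᵢ≢i u _ (sym (trans eq (lookup-map j (punchIn u) (decode c)))))
decode-Inj (u ∷ c) {suc i} {zero}  eq =
  ⊥-elim (punchInᵢ≢i u _ (sym (trans (sym eq) (lookup-map i (punchIn u) (decode c)))))
decode-Inj (u ∷ c) {suc i} {suc j} eq = cong suc (decode-Inj c (punchIn-injective u _ _
  (trans (sym (lookup-map i (punchIn u) (decode c))) (trans eq (lookup-map j (punchIn u) (decode c))))))

decode-injective : ∀ {m} (c d : Code m) → decode c ≡ decode d → c ≡ d
decode-injective []      []      eq = refl
decode-injective (u ∷ c) (v ∷ d) eq with refl , eq′ ← ∷-injective eq =
  cong (u ∷_) (decode-injective c d (≗⇒≡ λ i → punchIn-injective u _ _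
    (trans (sym (lookup-map i (punchIn u) (decode c)))
      (trans (cong (λ w → lookup w i) eq′) (lookup-map i (punchIn u) (decode d))))))

-- Removing the first value with `punchOut` standardises the later entries, which injectivity keeps
-- away from that value.
encode : ∀ {m} (v : Vec (Fin m) m) → Inj v → Σ (Code m) λ c → decode c ≡ v
encode []      inj = [] , refl
encode (x ∷ v) inj = let (c , eq) = encode (tabulate λ i → punchOut (x≢ i)) inj′ in
  x ∷ c , cong (x ∷_) (≗⇒≡ λ i → begin
    lookup (Vec.map (punchIn x) (decode c)) i ≡⟨ lookup-map i (punchIn x) (decode c) ⟩
    punchIn x (lookup (decode c) i)           ≡⟨ cong (λ w → punchIn x (lookup w i)) eq ⟩
    punchIn x (lookup (tabulate λ i → punchOut (x≢ i)) i) ≡⟨ cong (punchIn x) (lookup∘tabulate _ i) ⟩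
    punchIn x (punchOut (x≢ i))               ≡⟨ punchIn-punchOut (x≢ i) ⟩
    lookup v i                                ∎)
  where
  x≢ : ∀ i → x ≢ lookup v i
  x≢ i eq = Finₚ.0≢1+n (inj {zero} {suc i} eq)
  inj′ : Inj (tabulate λ i → punchOut (x≢ i))
  inj′ {i} {j} eq = Finₚ.suc-injective (inj (punchOut-injective (x≢ i) (x≢ j)
    (trans (sym (lookup∘tabulate (λ i → punchOut (x≢ i)) i)) (trans eq (lookup∘tabulate _ j)))))

module _ (Ps : List Pattern) where
  open Sites Ps

  size : ℕ → List ℕ → ℕ
  size zero    c = 1
  size (suc n) c = ∑[ (λ u → when (alive c u) (size n (u ∷ c))) ] 0 (suc (length c))

  Avoiding : ℕ → Set
  Avoiding m = Σ (Code m) (T ∘ avoids ∘ sites)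

  S↔Avoiding : ∀ m → S m (map ⟦_⟧ Ps) ↔ Avoiding m
  S↔Avoiding m = mk↔ₛ′ f g (λ { (c , t) → Σ-T-≡ (f∘g c t) }) (λ { (v , t) → Σ-T-≡ (g∘f v t) })
    where
    E = map ⟦_⟧ Ps
    f : S m E → Avoiding m
    f (v , t) with d , a ← to (T-∧ {distinct (permEntries v)}) t
                 | c , eq ← encode v (to (distinct⇔ v) (proj₁ (to (T-∧ {distinct (permEntries v)}) t))) =
      c , subst T (trans (cong (λ π → avoidsAll π E) (trans (cong permEntries (sym eq)) (permEntries-decode c)))
                         (sym (avoids≡ (sites c)))) a
    g : Avoiding m → S m E
    g (c , t) = decode c , from T-∧
      ( from (distinct⇔ (decode c)) (decode-Inj c)
      , subst T (trans (avoids≡ (sites c)) (cong (λ π → avoidsAll π E) (sym (permEntries-decode c)))) t)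
    g∘f : ∀ v t → proj₁ (g (f (v , t))) ≡ v
    g∘f v t = proj₂ (encode v (to (distinct⇔ v) (proj₁ (to (T-∧ {distinct (permEntries v)}) t))))
    f∘g : ∀ c t → proj₁ (f (g (c , t))) ≡ c
    f∘g c t = decode-injective _ c (g∘f (decode c) (proj₂ (g (c , t))))

  private
    cast : ∀ {k l} → k ≡ l → Avoiding k ↔ Avoiding l
    cast refl = ↔-refl

  Ext : ∀ {m} → ℕ → Code m → Set
  Ext         zero    c = ⊤
  Ext {m = m} (suc n) c = Σ (Fin (suc m)) λ u → T (alive (sites c) (toℕ u)) × Ext n (u ∷ c)

  Ext↔ : ∀ {m} n (c : Code m) → Ext n c ↔ Fin (size n (sites c))
  Ext↔ zero    c = ↔-sym 1↔⊤
  Ext↔ {m} (suc n) c = ↔-trans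
    (Σ-Fin-range (λ u → when (alive (sites c) u) (size n (u ∷ sites c))) 0 (suc m)
      λ u → guard (alive (sites c) (toℕ u)) (Ext↔ n (u ∷ c)))
    (≡⇒Fin↔ (cong (λ k → ∑[ (λ u → when (alive (sites c) u) (size n (u ∷ sites c))) ] 0 (suc k))
                  (sym (length-sites c))))
    where
    guard : ∀ b {A : Set} {k} → A ↔ Fin k → (T b × A) ↔ Fin (when b k)
    guard true  e = ↔-trans (mk↔ₛ′ proj₂ (_ ,_) (λ _ → refl) (λ _ → refl)) e
    guard false e = mk↔ₛ′ (λ { (() , _) }) (λ ()) (λ ()) (λ { (() , _) })

  avoids-tail : ∀ u c → T (avoids (u ∷ c)) → T (avoids c)
  avoids-tail u c t = from (avoids⇔ c) λ {s} q m →
    to (avoids⇔ (u ∷ c)) t (there q) (to (Matches-punch u s) m)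

  -- Deleting the first entry preserves avoidance, so each longer avoider passes through avoiders
  -- only and is reached by insertions at living sites in exactly one way.
  Ext↔Avoiding : ∀ n m → Σ (Avoiding m) (Ext n ∘ proj₁) ↔ Avoiding (n + m)
  Ext↔Avoiding zero    m = mk↔ₛ′ proj₁ (_, _) (λ _ → refl) (λ _ → refl)
  Ext↔Avoiding (suc n) m = ↔-trans
    (mk↔ₛ′ f g (λ { ((u ∷ c , t) , e) → refl })
       λ { ((c , t) , u , t′ , e) → cong (λ t → (c , t) , u , t′ , e) (T-irrelevant {avoids (sites c)} _ _) })
    (↔-trans (Ext↔Avoiding n (suc m)) (cast (+-suc n m)))
    where
    f : Σ (Avoiding m) (Ext (suc n) ∘ proj₁) → Σ (Avoiding (suc m)) (Ext n ∘ proj₁)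
    f ((c , t) , u , t′ , e) = (u ∷ c , t′) , e
    g : Σ (Avoiding (suc m)) (Ext n ∘ proj₁) → Σ (Avoiding m) (Ext (suc n) ∘ proj₁)
    g ((u ∷ c , t) , e) = (c , avoids-tail (toℕ u) (sites c) t) , u , t , e

  S↔size : ∀ m → S m (map ⟦_⟧ Ps) ↔ Fin (size m [])
  S↔size m = ↔-trans (S↔Avoiding m) (↔-trans (cast (sym (+-identityʳ m)))
    (↔-trans (↔-sym (Ext↔Avoiding m 0)) (↔-trans
      (mk↔ₛ′ (λ { (([] , _) , e) → e }) (λ e → ([] , from (avoids⇔ []) λ ()) , e) (λ _ → refl)
         λ { (([] , _) , e) → cong (λ t → ([] , t) , e) (T-irrelevant {avoids []} _ _) })
      (Ext↔ m []))))

-- Reflection in the antidiagonal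

Mono : ∀ {k n} → (Fin k → Fin n) → Set
Mono x = ∀ i j → i Fin.< j → x i Fin.< x j

private
  unsuc : ∀ {k n} (x : Fin k → Fin (suc n)) → (∀ i → 0 < toℕ (x i)) →
          ∃ λ (y : Fin k → Fin n) → ∀ i → x i ≡ suc (y i)
  unsuc x pos = (λ i → proj₁ (unsuc₁ (x i) (pos i))) , λ i → proj₂ (unsuc₁ (x i) (pos i))
    where
    unsuc₁ : ∀ {n} (j : Fin (suc n)) → 0 < toℕ j → ∃ λ i → j ≡ suc i
    unsuc₁ (suc i) _ = i , refl

  unsuc-mono : ∀ {k n} {x : Fin k → Fin (suc n)} {y} → (∀ i → x i ≡ suc (y i)) → Mono x → Mono y
  unsuc-mono eq mono i j i<j = ≤-pred (subst₂ Fin._<_ (eq i) (eq j) (mono i j i<j))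

  positive : ∀ {k n} {x : Fin (suc k) → Fin (suc n)} → Mono x → 0 < toℕ (x 0F) → ∀ i → 0 < toℕ (x i)
  positive mono pos zero    = pos
  positive mono pos (suc i) = <-trans pos (mono _ _ z<s)

module _ {m : ℕ} where
  private
    vals : ∀ {n k} → Vec (Fin m) n → (Fin k → Fin n) → Vec ℕ k
    vals v x = tabulate λ i → toℕ (lookup v (x i))

    xs : ∀ {n} → Vec (Fin m) n → List ℕ
    xs v = map toℕ (toList v)

  increasing⁺ : ∀ {n k} (v : Vec (Fin m) n) (x : Fin k → Fin n) → Mono x → toList (vals v x) ∈ subseqs k (xs v)
  increasing⁺ {k = zero}  v       x mono = here refl
  increasing⁺ {k = suc k} []      x mono with () ← x 0F
  increasing⁺ {k = suc k} (a ∷ v) x mono with x 0F in eq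
  ... | zero with y , x≡ ← unsuc (x ∘ suc) (λ i → subst (Fin._< x (suc i)) eq (mono _ _ z<s)) =
    ∈-++⁺ˡ (subst (λ w → (toℕ a ∷ w) ∈ map (toℕ a ∷_) (subseqs k (xs v)))
      (cong toList (tabulate-cong λ i → cong (toℕ ∘ lookup (a ∷ v)) (sym (x≡ i))))
      (∈-map⁺ (toℕ a ∷_) (increasing⁺ v y (unsuc-mono x≡ (λ i j i<j → mono (suc i) (suc j) (s≤s i<j))))))
  ... | suc i₀ with y , x≡ ← unsuc x (positive mono (subst (λ j → 0 < toℕ j) (sym eq) z<s)) =
    ∈-++⁺ʳ _ (subst (_∈ subseqs (suc k) (xs v))
      (trans (cong toList (tabulate-cong λ i → cong (toℕ ∘ lookup (a ∷ v)) (sym (x≡ i))))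
             (cong (λ j → toℕ (lookup (a ∷ v) j) ∷ toList (vals (a ∷ v) (x ∘ suc))) eq))
      (increasing⁺ v y (unsuc-mono x≡ mono)))

  increasing⁻ : ∀ {n} k (v : Vec (Fin m) n) {s} → s ∈ subseqs k (xs v) →
                ∃ λ (x : Fin k → Fin n) → Mono x × s ≡ toList (vals v x)
  increasing⁻ zero    v       (here refl) = (λ ()) , (λ ()) , refl
  increasing⁻ (suc k) (a ∷ v) s∈ with ∈-++⁻ (map (toℕ a ∷_) (subseqs k (xs v))) s∈
  ... | inj₁ s∈′ with t , t∈ , refl ← ∈-map⁻ (toℕ a ∷_) s∈′ with x , mono , refl ← increasing⁻ k v t∈ =
    (λ { zero → zero ; (suc i) → suc (x i) }) ,
    (λ { zero (suc j) _ → z<s ; (suc i) (suc j) (s≤s i<j) → s≤s (mono i j i<j) }) , refl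
  ... | inj₂ s∈′ with x , mono , refl ← increasing⁻ (suc k) v s∈′ = suc ∘ x , (λ i j i<j → s≤s (mono i j i<j)) , refl

Occurrence : ∀ {m} → Vec (Fin m) m → Pattern → Set
Occurrence {m} v P = ∃ λ (x : Fin 4 → Fin m) → Mono x × Chain P (λ i j → lookup v (x i) Fin.< lookup v (x j))

avoidsAll⇔Occurrence : ∀ {m} (v : Vec (Fin m) m) Ps →
  T (avoidsAll (permEntries v) (map ⟦_⟧ Ps)) ⇔ (¬ Any (Occurrence v) Ps)
avoidsAll⇔Occurrence {m} v Ps = mk⇔
  t′
  (λ none → from equiv λ { (x , mono , refl) match →
    none (Any.map (λ {P} ch → x , mono , Chain-map P (λ i j → from (≡⇔ x i j)) ch) match) })
  where
  Q : Vec ℕ 4 → Set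
  Q s = ∃ λ (x : Fin 4 → Fin m) → Mono x × s ≡ tabulate λ i → toℕ (lookup v (x i))
  equiv : T (avoidsAll (permEntries v) (map ⟦_⟧ Ps)) ⇔ (∀ {s} → Q s → ¬ Matches Ps (Values s))
  equiv = avoidsAll⇔ (permEntries v) (λ { (x , mono , refl) → increasing⁺ v x mono })
    (λ s∈ → let (x , mono , eq) = increasing⁻ 4 v s∈ in _ , eq , x , mono , refl) Ps
  ≡⇔ : ∀ (x : Fin 4 → Fin m) i j →
       (lookup v (x i) Fin.< lookup v (x j)) ⇔ Values (tabulate λ i → toℕ (lookup v (x i))) i j
  ≡⇔ x i j = mk⇔ (subst₂ _<_ (sym (at i)) (sym (at j))) (subst₂ _<_ (at i) (at j))
    where
    at : ∀ i → lookup (tabulate λ i → toℕ (lookup v (x i))) i ≡ toℕ (lookup v (x i))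
    at = lookup∘tabulate λ i → toℕ (lookup v (x i))
  t′ : T (avoidsAll (permEntries v) (map ⟦_⟧ Ps)) → ¬ Any (Occurrence v) Ps
  t′ t occ with P , P∈ , x , mono , ch ← find occ =
    to equiv t (x , mono , refl) (lose P∈ (Chain-map P (λ i j → to (≡⇔ x i j)) ch))

opposite-< : ∀ {n} {i j : Fin n} → i Fin.< j → opposite j Fin.< opposite i
opposite-< {n} {i} {j} i<j = subst₂ _<_ (sym (Finₚ.opposite-prop j)) (sym (Finₚ.opposite-prop i))
  (∸-monoʳ-< (s≤s i<j) (toℕ<n j))

-- A missed value could be punched out, giving an injection into a smaller finite set.
Inj⇒surjective : ∀ {m} (v : Vec (Fin m) m) → Inj v → ∀ y → ∃ λ i → lookup v i ≡ y
Inj⇒surjective {suc m} v inj y with Finₚ.any? (λ i → lookup v i Finₚ.≟ y)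
... | yes found = found
... | no missed = ⊥-elim (1+n≰n (Finₚ.injective⇒≤ {f = λ i → punchOut (y≢ i)}
        (λ {i} {j} eq → inj (punchOut-injective (y≢ i) (y≢ j) eq))))
  where
  y≢ : ∀ i → y ≢ lookup v i
  y≢ i eq = missed (i , sym eq)

-- w is the reverse-complement-inverse of v: its graph is the reflection of the graph of
-- v in the antidiagonal.
_Reflects_ : ∀ {m} → Vec (Fin m) m → Vec (Fin m) m → Set
w Reflects v = ∀ i → lookup w (opposite (lookup v i)) ≡ opposite i

Reflects-sym : ∀ {m} (v w : Vec (Fin m) m) → Inj v → w Reflects v → v Reflects w
Reflects-sym v w inj refl-v k with i , eq ← Inj⇒surjective v inj (opposite k) = begin
  lookup v (opposite (lookup w k))  ≡⟨ cong (λ k → lookup v (opposite (lookup w k))) k≡ ⟩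
  lookup v (opposite (lookup w (opposite (lookup v i)))) ≡⟨ cong (lookup v ∘ opposite) (refl-v i) ⟩
  lookup v (opposite (opposite i)) ≡⟨ cong (lookup v) (opposite-involutive i) ⟩
  lookup v i ≡⟨ eq ⟩
  opposite k ∎
  where
  k≡ : k ≡ opposite (lookup v i)
  k≡ = trans (sym (opposite-involutive k)) (cong opposite (sym eq))

Reflects-unique : ∀ {m} {v w w′ : Vec (Fin m) m} → Inj v → w Reflects v → w′ Reflects v → w ≡ w′
Reflects-unique {v = v} {w} {w′} inj r r′ = ≗⇒≡ λ k → let (i , eq) = Inj⇒surjective v inj (opposite k) in
  subst (λ k → lookup w k ≡ lookup w′ k)
    (trans (cong opposite eq) (opposite-involutive k)) (trans (r i) (sym (r′ i)))

reflect : ∀ {m} (v : Vec (Fin m) m) → Inj v → Vec (Fin m) m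
reflect v inj = tabulate λ k → opposite (proj₁ (Inj⇒surjective v inj (opposite k)))

reflect-Reflects : ∀ {m} (v : Vec (Fin m) m) (inj : Inj v) → reflect v inj Reflects v
reflect-Reflects v inj i = trans (lookup∘tabulate _ (opposite (lookup v i)))
  (cong opposite (inj (trans (proj₂ (Inj⇒surjective v inj _)) (opposite-involutive (lookup v i)))))

Reflects-Inj : ∀ {m} (v w : Vec (Fin m) m) → v Reflects w → Inj w
Reflects-Inj v w r {i} {j} eq = begin
  i ≡⟨ opposite-involutive i ⟨
  opposite (opposite i) ≡⟨ cong opposite (r i) ⟨
  opposite (lookup v (opposite (lookup w i))) ≡⟨ cong (λ y → opposite (lookup v (opposite y))) eq ⟩
  opposite (lookup v (opposite (lookup w j))) ≡⟨ cong opposite (r j) ⟩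
  opposite (opposite j) ≡⟨ opposite-involutive j ⟩
  j ∎

order-rci : ∀ P i → lookup (order (rci P)) i ≡ opposite (lookup (word P) (opposite i))
order-rci P = lookup∘tabulate _

-- This is the relation `Reflects` between the inverses `order P` and `order P′`; since the
-- reflection commutes with inversion, it relates the patterns themselves.
Partner : Pattern → Pattern → Set
Partner P P′ = ∀ i → lookup (order P) (opposite (lookup (order P′) i)) ≡ opposite i

Partner-rci : ∀ P → Partner P (rci P)
Partner-rci P i rewrite order-rci P i =
  trans (cong (lookup (order P)) (opposite-involutive _)) (order∘word P (opposite i))

Partner-rci′ : ∀ P → Partner (rci P) P
Partner-rci′ P i = trans (order-rci P (opposite (lookup (order P) i)))
  (cong opposite (trans (cong (lookup (word P)) (opposite-involutive (lookup (order P) i))) (word∘order P i)))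

-- The reflection turns the values of an occurrence into positions and its positions into values,
-- both read backwards.
Occurrence-reflect : ∀ {m} (v w : Vec (Fin m) m) P P′ → Partner P P′ → w Reflects v →
                     Occurrence v P → Occurrence w P′
Occurrence-reflect v w P P′ partner r (x , mono , a , b , c) =
  y , y-mono , step {0F} {1F} z<s , step {1F} {2F} (s≤s z<s) , step {2F} {3F} (s≤s (s≤s z<s))
  where
  f : Fin 4 → Fin _
  f i = lookup v (x (lookup (order P) i))
  f-mono : Mono f
  f-mono _ _ = mono₄ (toℕ ∘ f) a b c
  -- `f i` is the i-th smallest value of the given occurrence; the complemented values, in reversed
  -- order, are the new positions.
  y : Fin 4 → Fin _
  y i = opposite (f (opposite i))
  y-mono : Mono y
  y-mono i j i<j = opposite-< (f-mono _ _ (opposite-< i<j))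
  w∘y : ∀ i → lookup w (y (lookup (order P′) i)) ≡ opposite (x (opposite i))
  w∘y i = trans (r _) (cong (opposite ∘ x) (partner i))
  step : ∀ {i j} → i Fin.< j → lookup w (y (lookup (order P′) i)) Fin.< lookup w (y (lookup (order P′) j))
  step {i} {j} i<j = subst₂ Fin._<_ (sym (w∘y i)) (sym (w∘y j)) (opposite-< (mono _ _ (opposite-< i<j)))

S-rci : ∀ m Ps → S m (map ⟦_⟧ Ps) ↔ S m (map ⟦_⟧ (map rci Ps))
S-rci m Ps = mk↔ₛ′ f g (λ { (v , t) → Σ-T-≡ (round′ v t) }) (λ { (v , t) → Σ-T-≡ (round v t) })
  where
  inj : ∀ Qs (v : S m (map ⟦_⟧ Qs)) → Inj (proj₁ v)
  inj Qs (v , t) = to (distinct⇔ v) (proj₁ (to (T-∧ {distinct (permEntries v)}) t))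
  avoid : ∀ Qs (v : S m (map ⟦_⟧ Qs)) → ¬ Any (Occurrence (proj₁ v)) Qs
  avoid Qs (v , t) = to (avoidsAll⇔Occurrence v Qs) (proj₂ (to (T-∧ {distinct (permEntries v)}) t))
  move : ∀ Qs Rs (v : S m (map ⟦_⟧ Qs)) →
         (∀ w → proj₁ v Reflects w → Any (Occurrence w) Rs → Any (Occurrence (proj₁ v)) Qs) →
         S m (map ⟦_⟧ Rs)
  move Qs Rs v back = reflect (proj₁ v) (inj Qs v) , from T-∧
    ( from (distinct⇔ w) (Reflects-Inj (proj₁ v) w (Reflects-sym (proj₁ v) w (inj Qs v) r))
    , from (avoidsAll⇔Occurrence w Rs) (λ occ → avoid Qs v (back w (Reflects-sym (proj₁ v) w (inj Qs v) r) occ)))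
    where
    w = reflect (proj₁ v) (inj Qs v)
    r : w Reflects proj₁ v
    r = reflect-Reflects (proj₁ v) (inj Qs v)
  f : S m (map ⟦_⟧ Ps) → S m (map ⟦_⟧ (map rci Ps))
  f v = move Ps (map rci Ps) v λ w r occ →
    Any.map (λ {P} → Occurrence-reflect w (proj₁ v) (rci P) P (Partner-rci′ P) r) (Anyₚ.map⁻ occ)
  g : S m (map ⟦_⟧ (map rci Ps)) → S m (map ⟦_⟧ Ps)
  g v = move (map rci Ps) Ps v λ w r occ →
    Anyₚ.map⁺ (Any.map (λ {P} → Occurrence-reflect w (proj₁ v) P (rci P) (Partner-rci P) r) occ)
  reflect² : ∀ v (i : Inj v) (j : Inj (reflect v i)) → reflect (reflect v i) j ≡ v
  reflect² v i j = Reflects-unique {v = reflect v i} {reflect (reflect v i) j} {v} j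
    (reflect-Reflects (reflect v i) j) (Reflects-sym v (reflect v i) i (reflect-Reflects v i))
  round : ∀ v t → proj₁ (g (f (v , t))) ≡ v
  round v t = reflect² v (inj Ps (v , t)) (inj (map rci Ps) (f (v , t)))
  round′ : ∀ v t → proj₁ (f (g (v , t))) ≡ v
  round′ v t = reflect² v (inj (map rci Ps) (v , t)) (inj Ps (g (v , t)))

-- Cuts and monotone values of a code

pattern 1st m = here m
pattern 2nd m = there (here m)
pattern 3rd m = there (there (here m))
pattern 4th m = there (there (there (here m)))
pattern 5th m = there (there (there (there (here m))))
pattern 6th m = there (there (there (there (there (here m)))))

-- With the bounds restored, every number below the length is a value, so that witnesses for
-- forbidden patterns can be named by their value.
data Valid : List ℕ → Set where
  []  : Valid []
  _∷_ : ∀ {u c} → u ≤ length c → Valid c → Valid (u ∷ c)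

unpunch : ∀ {u x} → x ≢ u → ∃ λ y → x ≡ punch u y
unpunch {u} {x} x≢u with <-cmp x u
... | tri< x<u _ _ = x , sym (punch-< x<u)
... | tri≈ _ x≡u _ = ⊥-elim (x≢u x≡u)
unpunch {u} {suc x} x≢u | tri> _ _ (s≤s u≤x) = x , sym (punch-≥ u≤x)

unpunch-< : ∀ {u x n} → u ≤ n → punch u x < suc n → x < n
unpunch-< u≤n = from (punch-<-high u≤n)

mem : ∀ {c x} → Valid c → x < length c → Mem c x
mem {u ∷ c} {x} (u≤n ∷ v) x<n with x ≟ u
... | yes refl = here
... | no  x≢u with y , refl ← unpunch {u} x≢u = there (mem v (unpunch-< u≤n x<n))

mem-< : ∀ {c x} → Valid c → Mem c x → x < length c
mem-< (u≤n ∷ v) here      = s≤s u≤n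
mem-< (u≤n ∷ v) (there m) = to (punch-<-high u≤n) (mem-< v m)

pair-< : ∀ {c x y} → Valid c → Pair c x y → x < length c × y < length c
pair-< (u≤n ∷ v) (here m)  = s≤s u≤n , to (punch-<-high u≤n) (mem-< v m)
pair-< (u≤n ∷ v) (there p) with x<n , y<n ← pair-< v p =
  to (punch-<-high u≤n) x<n , to (punch-<-high u≤n) y<n

first : ∀ {u c x} → Valid (u ∷ c) → x < length (u ∷ c) → x ≢ u → Pair (u ∷ c) u x
first {u} (u≤n ∷ v) x<n x≢u with y , refl ← unpunch {u} x≢u = here (mem v (unpunch-< u≤n x<n))

-- This is how most sites are shown to die: for a suitable pair of values, each of the two possible
-- orders completes one of the forbidden patterns.
pair : ∀ {c x y} → Valid c → x < length c → y < length c → x ≢ y → Pair c x y ⊎ Pair c y x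
pair {u ∷ c} {x} {y} (u≤n ∷ v) x<n y<n x≢y with x ≟ u | y ≟ u
... | yes refl | yes refl = ⊥-elim (x≢y refl)
... | yes refl | no  y≢u  = inj₁ (first (u≤n ∷ v) y<n y≢u)
... | no  x≢u  | yes refl = inj₂ (first (u≤n ∷ v) x<n x≢u)
... | no  x≢u  | no  y≢u with x′ , refl ← unpunch {u} x≢u | y′ , refl ← unpunch {u} y≢u
  with pair v (unpunch-< u≤n x<n) (unpunch-< u≤n y<n) (λ { refl → x≢y refl })
... | inj₁ p = inj₁ (there p)
... | inj₂ p = inj₂ (there p)

punch-mono-≤ : ∀ u {x y} → x ≤ y → punch u x ≤ punch u y
punch-mono-≤ u x≤y = ≮⇒≥ λ p → <⇒≱ (from (punch-mono-< u) p) x≤y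

punch-top : ∀ {c x} → Valid c → Mem c x → punch (length c) x < length c
punch-top v m = to (punch-<-low ≤-refl) (mem-< v m)

-- A value below `w` is smaller than `x` anyway, so the bound on `x` alone expresses that the values
-- from `w` on decrease.
Dec : List ℕ → ℕ → Set
Dec c w = ∀ {x y} → Pair c x y → w ≤ x → y ≤ x

Dec-∷ : ∀ {u c w} → u ≤ w → Dec c w → Dec (u ∷ c) (suc w)
Dec-∷ u≤w dec (here m)  w<u = ⊥-elim (<⇒≱ w<u u≤w)
Dec-∷ u≤w dec (there p) w<x = punch-mono-≤ _ (dec p (from (punch-≤-high u≤w) w<x))

Dec-top∷ : ∀ {c w} → Valid c → w ≤ length c → Dec c w → Dec (length c ∷ c) w
Dec-top∷ v w≤n dec (here m)  _   = <⇒≤ (punch-top v m)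
Dec-top∷ v w≤n dec (there p) w≤x = punch-mono-≤ _ (dec p (from (punch-≤-low w≤n) w≤x))

Dec-length : ∀ {c w} → Valid c → length c ≤ w → Dec c w
Dec-length v n≤w p w≤x = ⊥-elim (<⇒≱ (proj₁ (pair-< v p)) (≤-trans n≤w w≤x))

-- The values below w appear before the values from w on.
UpCut : List ℕ → ℕ → Set
UpCut c w = ∀ {x y} → Pair c x y → w ≤ x → w ≤ y

UpCut-∷ : ∀ {u c w} → u ≤ w → UpCut c w → UpCut (u ∷ c) (suc w)
UpCut-∷ u≤w cut (here m)  w<u = ⊥-elim (<⇒≱ w<u u≤w)
UpCut-∷ u≤w cut (there p) w<x = to (punch-≤-high u≤w) (cut p (from (punch-≤-high u≤w) w<x))

-- The increasing counterpart of `Dec`; here it suffices to bound the right-hand value.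
Inc : List ℕ → ℕ → Set
Inc c w = ∀ {x y} → Pair c x y → w ≤ y → x ≤ y

Inc-≤ : ∀ {c w w′} → w ≤ w′ → Inc c w → Inc c w′
Inc-≤ w≤w′ inc p w′≤y = inc p (≤-trans w≤w′ w′≤y)

Inc-∷ : ∀ {u c} → Inc c u → Inc (u ∷ c) u
Inc-∷ inc (here m)  u≤y = u≤y
Inc-∷ inc (there p) u≤y = punch-mono-≤ _ (inc p (from (punch-≤-low ≤-refl) u≤y))

Inc-∷-suc : ∀ {u c w} → u ≤ w → Inc c w → Inc (u ∷ c) (suc w)
Inc-∷-suc u≤w inc (here m)  w<y = ≤-trans u≤w (<⇒≤ w<y)
Inc-∷-suc u≤w inc (there p) w<y = punch-mono-≤ _ (inc p (from (punch-≤-high u≤w) w<y))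

T⇒≡ : ∀ {a} → T a → a ≡ true
T⇒≡ {true} _ = refl

¬T⇒≡ : ∀ {a} → ¬ T a → a ≡ false
¬T⇒≡ {true}  ¬a = ⊥-elim (¬a _)
¬T⇒≡ {false} _  = refl

⇔⇒≡ : ∀ {a b} → T a ⇔ T b → a ≡ b
⇔⇒≡ {false} e = sym (¬T⇒≡ (from e))
⇔⇒≡ {true}  e = sym (T⇒≡ (to e _))

when-true : ∀ {b} x → T b → when b x ≡ x
when-true {true} x _ = refl

module Insertion (Ps : List Pattern) where
  open Sites Ps public

  N : ℕ → List ℕ → ℕ
  N = size Ps

  weight : ℕ → List ℕ → ℕ → ℕ
  weight n c u = when (alive c u) (N n (u ∷ c))

  module _ {c : List ℕ} {u : ℕ} (au : T (alive c u)) where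

    below-≡ : ∀ {w} → w ≤ u → (T (alive c w) → ∀ {x y} → Pair c x y → ¬ Matches Ps (Below w u x y)) →
              alive (u ∷ c) w ≡ alive c w
    below-≡ w≤u ok = ⇔⇒≡ (mk⇔ (proj₁ ∘ to (alive-below w≤u au)) λ aw → from (alive-below w≤u au) (aw , ok aw))

    above-≡ : ∀ {w} → u ≤ w → (T (alive c w) → ∀ {x y} → Pair c x y → ¬ Matches Ps (Above w u x y)) →
              alive (u ∷ c) (suc w) ≡ alive c w
    above-≡ u≤w ok = ⇔⇒≡ (mk⇔ (proj₁ ∘ to (alive-above u≤w au)) λ aw → from (alive-above u≤w au) (aw , ok aw))

    below-dead : ∀ {w x y} → w ≤ u → Pair c x y → Matches Ps (Below w u x y) → alive (u ∷ c) w ≡ false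
    below-dead w≤u p m = ¬T⇒≡ λ t → proj₂ (to (alive-below w≤u au) t) p m

    above-dead : ∀ {w x y} → u ≤ w → Pair c x y → Matches Ps (Above w u x y) → alive (u ∷ c) (suc w) ≡ false
    above-dead u≤w p m = ¬T⇒≡ λ t → proj₂ (to (alive-above u≤w au) t) p m

    below-stays-dead : ∀ {w} → w ≤ u → alive c w ≡ false → alive (u ∷ c) w ≡ false
    below-stays-dead w≤u dead = ¬T⇒≡ λ t → subst T dead (proj₁ (to (alive-below w≤u au) t))

    above-stays-dead : ∀ {w} → u ≤ w → alive c w ≡ false → alive (u ∷ c) (suc w) ≡ false
    above-stays-dead u≤w dead = ¬T⇒≡ λ t → subst T dead (proj₁ (to (alive-above u≤w au) t))

-- The class of H₁

patterns₁ : List Pattern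
patterns₁ = pat 1 3 2 4 ∷ pat 2 3 1 4 ∷ pat 2 4 1 3 ∷ pat 3 1 2 4 ∷ pat 3 1 4 2 ∷ pat 3 2 1 4 ∷ []

module Class₁ where
  open Insertion patterns₁

  -- The values from w on appear before the values below w.
  Cut : List ℕ → ℕ → Set
  Cut c w = ∀ {x y} → Pair c x y → x < w → y < w

  -- State B: besides the top site, only j sites that are cuts are alive. State A: the first
  -- value f is not the largest one, and the sites alive are j+1 cuts up to f, the site
  -- just above f, and the top one. The site above f resets the state, since it makes
  -- f + 1, f and the maximum an occurrence of 213.
  record B (c : List ℕ) (j : ℕ) : Set where
    field
      valid : Valid c
      top   : T (alive c (length c))
      cut   : ∀ {w} → w ≤ length c → T (alive c w) → Cut c w
      count : # (alive c) 0 (length c) ≡ j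

  record A (c : List ℕ) (j : ℕ) : Set where
    field
      valid : Valid c
      f z   : ℕ
      size≡ : length c ≡ 2 + f + z
      head  : ∀ {x} → x < length c → x ≢ f → Pair c f x
      cut   : ∀ {w} → w ≤ f → T (alive c w) → Cut c w
      low   : T (alive c f)
      mid   : T (alive c (suc f))
      top   : T (alive c (length c))
      gap   : ∀ {w} → suc f < w → w < length c → alive c w ≡ false
      count : # (alive c) 0 (suc f) ≡ suc j

  Cut-∷ : ∀ {u c w} → w ≤ u → Cut c w → Cut (u ∷ c) w
  Cut-∷ w≤u cut (here m)  u<w = ⊥-elim (<⇒≱ u<w w≤u)
  Cut-∷ w≤u cut (there p) x<w = to (punch-<-low w≤u) (cut p (from (punch-<-low w≤u) x<w))

  Cut-top : ∀ {c w} → Valid c → length c ≤ w → Cut c w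
  Cut-top v n≤w p _ = <-≤-trans (proj₂ (pair-< v p)) n≤w

  -- The patterns 1324, 2314 and 2413 would need a later pair ascending across `u` or `w`, which a
  -- cut excludes; the other three contradict `w ≤ u`.
  stay-below : ∀ {c u w} → T (alive c u) → Cut c u → (T (alive c w) → Cut c w) → w ≤ u →
               alive (u ∷ c) w ≡ alive c w
  stay-below {c} {u} {w} au cut-u cut-w w≤u = below-≡ au w≤u ok
    where
    ok : T (alive c w) → ∀ {x y} → Pair c x y → ¬ Matches patterns₁ (Below w u x y)
    ok aw p (1st (w≤x , x<u , u≤y))        = <⇒≱ (cut-u p x<u) u≤y
    ok aw p (2nd (x<w , _ , u≤y))          = <⇒≱ (cut-u p (<-≤-trans x<w w≤u)) u≤y
    ok aw p (3rd (x<w , w≤y , _))          = <⇒≱ (cut-w aw p x<w) w≤y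
    ok aw p (4th (u≤x , x<w , _))          = <⇒≱ x<w (≤-trans w≤u u≤x)
    ok aw p (5th (u≤y , y<w , _))          = <⇒≱ y<w (≤-trans w≤u u≤y)
    ok aw p (6th (_ , () , _))

  top-above : ∀ {c u} → Valid c → u ≤ length c → T (alive c u) → T (alive c (length c)) → T (alive (u ∷ c) (suc (length c)))
  top-above {c} {u} v u≤m au at = subst T (sym (above-≡ au u≤m above-top)) at
    where
    above-top : T (alive c (length c)) → ∀ {x y} → Pair c x y → ¬ Matches patterns₁ (Above (length c) u x y)
    above-top _ p (1st (m≤x , _)) = <⇒≱ (proj₁ (pair-< v p)) m≤x
    above-top _ p (2nd (_ , () , _))
    above-top _ p (3rd (_ , m≤y , _)) = <⇒≱ (proj₂ (pair-< v p)) m≤y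
    above-top _ p (4th (_ , _ , m≤y)) = <⇒≱ (proj₂ (pair-< v p)) m≤y
    above-top _ p (5th (_ , _ , m≤x)) = <⇒≱ (proj₁ (pair-< v p)) m≤x
    above-top _ p (6th (_ , _ , m≤y)) = <⇒≱ (proj₂ (pair-< v p)) m≤y

  insert-low : ∀ {c u} → Valid c → u < length c → T (alive c u) → T (alive c (length c)) →
               (∀ {w} → w ≤ u → T (alive c w) → Cut c w) → A (u ∷ c) (# (alive c) 0 u)
  insert-low {c} {u} v u<m au at cut = record
    { valid = <⇒≤ u<m ∷ v
    ; f     = u
    ; z     = length c ∸ suc u
    ; size≡ = cong suc (sym (m+[n∸m]≡n u<m))
    ; head  = first (<⇒≤ u<m ∷ v)
    ; cut   = λ w≤u t → Cut-∷ w≤u (cut w≤u (subst T (same w≤u) t))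
    ; low   = subst T (sym (same ≤-refl)) au
    ; mid   = subst T (sym (above-≡ au ≤-refl above-u)) au
    ; top   = top-above v (<⇒≤ u<m) au at
    ; gap   = λ { {suc w} (s≤s u<w) (s≤s w<m) → between u<w w<m }
    ; count = trans (#-snoc (alive (u ∷ c)) 0 u (trans (same ≤-refl) (T⇒≡ au)))
                    (cong suc (#-same (alive (u ∷ c)) (alive c) 0 u λ w _ w<u → same (<⇒≤ w<u)))
    }
    where
    same : ∀ {w} → w ≤ u → alive (u ∷ c) w ≡ alive c w
    same w≤u = stay-below au (cut ≤-refl au) (cut w≤u) w≤u
    above-u : T (alive c u) → ∀ {x y} → Pair c x y → ¬ Matches patterns₁ (Above u u x y)
    above-u _ p (1st (u≤x , x<u , _)) = <⇒≱ x<u u≤x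
    above-u _ p (2nd (_ , () , _))
    above-u _ p (3rd (x<u , u≤y , _)) = <⇒≱ (cut ≤-refl au p x<u) u≤y
    above-u _ p (4th (u≤x , x<u , _)) = <⇒≱ x<u u≤x
    above-u _ p (5th (u≤y , y<u , _)) = <⇒≱ y<u u≤y
    above-u _ p (6th (x<u , _ , u≤y)) = <⇒≱ (cut ≤-refl au p x<u) u≤y
    -- The values `u` and `w` of `c` complete 3124 in one order and 3142 in the other.
    between : ∀ {w} → u < w → w < length c → alive (u ∷ c) (suc w) ≡ false
    between u<w w<m with pair v u<m w<m (<⇒≢ u<w)
    ... | inj₁ p = above-dead au (<⇒≤ u<w) p (4th (≤-refl , u<w , ≤-refl))
    ... | inj₂ p = above-dead au (<⇒≤ u<w) p (5th (≤-refl , u<w , ≤-refl))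

  module _ {c : List ℕ} {j : ℕ} (b : B c j) where
    open B b
    private
      m = length c
      same : ∀ {w} → w ≤ m → alive (m ∷ c) w ≡ alive c w
      same w≤m = stay-below top (Cut-top valid ≤-refl) (cut w≤m) w≤m

    B-top : B (m ∷ c) (suc j)
    B-top = record
      { valid = valid′
      ; top   = top-above valid ≤-refl top top
      ; cut   = cut′
      ; count = trans (#-snoc (alive (m ∷ c)) 0 m (trans (same ≤-refl) (T⇒≡ top)))
                      (cong suc (trans (#-same (alive (m ∷ c)) (alive c) 0 m λ w _ w<m → same (<⇒≤ w<m)) count))
      }
      where
      valid′ : Valid (m ∷ c)
      valid′ = ≤-refl ∷ valid
      cut′ : ∀ {w} → w ≤ suc m → T (alive (m ∷ c) w) → Cut (m ∷ c) w
      cut′ {w} w≤ t with m≤n⇒m<n∨m≡n w≤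
      ... | inj₁ (s≤s w≤m) = Cut-∷ w≤m (cut w≤m (subst T (same w≤m) t))
      ... | inj₂ refl      = Cut-top valid′ ≤-refl

    B-low : ∀ {u} → u < m → T (alive c u) → A (u ∷ c) (# (alive c) 0 u)
    B-low u<m au = insert-low valid u<m au top λ w≤u → cut (≤-trans w≤u (<⇒≤ u<m))

  module _ {c : List ℕ} {j : ℕ} (a : A c j) where
    open A a
    private
      m = length c
      f<m : suc f < m
      f<m = subst (suc f <_) (sym size≡) (s≤s (s≤s (m≤m+n f z)))
      m-1 : ℕ
      m-1 = suc f + z
      m≡ : m ≡ suc m-1
      m≡ = size≡
      m≡′ : m ≡ suc f + suc z
      m≡′ = trans size≡ (cong suc (sym (+-suc f z)))
      last : Pair c f m-1
      last = head (subst (m-1 <_) (sym m≡) ≤-refl) (>⇒≢ (s≤s (m≤m+n f z)))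
      f<last : suc f ≤ m-1
      f<last = s≤s (m≤m+n f z)

    A-low : ∀ {u} → u ≤ f → T (alive c u) → A (u ∷ c) (# (alive c) 0 u)
    A-low u≤f au = insert-low valid (≤-<-trans u≤f (<-trans ≤-refl f<m)) au top λ w≤u → cut (≤-trans w≤u u≤f)

    A-mid : B (suc f ∷ c) 0
    A-mid = record
      { valid = valid′
      ; top   = top-above valid (<⇒≤ f<m) mid top
      ; cut   = cut′
      ; count = #-dead (alive (suc f ∷ c)) 0 (suc m) λ w _ w≤m → dead (≤-pred w≤m)
      }
      where
      valid′ : Valid (suc f ∷ c)
      valid′ = <⇒≤ f<m ∷ valid
      dead : ∀ {w} → w ≤ m → alive (suc f ∷ c) w ≡ false
      dead {w} w≤m with w ≤? suc f
      ... | yes w≤f with w ≤? f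
      ...   | yes w≤f′ = below-dead mid w≤f last (1st (w≤f′ , ≤-refl , f<last))
      ...   | no  w≰f  = below-dead mid w≤f last (2nd (≰⇒> w≰f , _ , f<last))
      dead {suc w} w≤m | no w≰f = above-dead mid (≤-pred (≰⇒> w≰f)) last (6th (≤-refl , _ , ≤-pred (subst (suc w ≤_) m≡ w≤m)))
      dead {zero}  w≤m | no w≰f = ⊥-elim (w≰f z≤n)
      cut′ : ∀ {w} → w ≤ suc m → T (alive (suc f ∷ c) w) → Cut (suc f ∷ c) w
      cut′ {w} w≤ t with m≤n⇒m<n∨m≡n w≤
      ... | inj₁ (s≤s w≤m) = ⊥-elim (subst T (dead w≤m) t)
      ... | inj₂ refl      = Cut-top valid′ ≤-refl

    A-top : B (m ∷ c) (2 + j)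
    A-top = record
      { valid = valid′
      ; top   = top-above valid ≤-refl top top
      ; cut   = cut′
      -- What remains below the new top are the j + 1 cuts and the former top site, now just below
      -- the new maximum.
      ; count = begin
          # alive′ 0 (suc m)                               ≡⟨ #-snoc alive′ 0 m at ⟩
          suc (# alive′ 0 m)                               ≡⟨ cong (suc ∘ # alive′ 0) m≡′ ⟩
          suc (# alive′ 0 (suc f + suc z))                 ≡⟨ cong suc (#-split alive′ 0 (suc f) (suc z)) ⟩
          suc (# alive′ 0 (suc f) + # alive′ (suc f) (suc z))
            ≡⟨ cong suc (cong₂ _+_ (trans (#-same alive′ (alive c) 0 (suc f) λ w _ w≤f → same (≤-pred w≤f)) count)
                 (#-dead alive′ (suc f) (suc z) λ w f<w w<m → dead f<w (subst (w <_) (sym m≡′) w<m))) ⟩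
          suc (suc j + 0)                                  ≡⟨ cong suc (+-identityʳ (suc j)) ⟩
          2 + j                                            ∎
      }
      where
      alive′ = alive (m ∷ c)
      valid′ : Valid (m ∷ c)
      valid′ = ≤-refl ∷ valid
      same : ∀ {w} → w ≤ f → alive′ w ≡ alive c w
      same w≤f = stay-below top (Cut-top valid ≤-refl) (cut w≤f) (≤-trans w≤f (<⇒≤ (<-trans ≤-refl f<m)))
      at : alive′ m ≡ true
      at = trans (stay-below top (Cut-top valid ≤-refl) (λ _ → Cut-top valid ≤-refl) ≤-refl) (T⇒≡ top)
      dead : ∀ {w} → f < w → w < m → alive′ w ≡ false
      dead {w} f<w w<m with m≤n⇒m<n∨m≡n f<w
      ... | inj₁ sf<w = below-stays-dead top (<⇒≤ w<m) (gap sf<w w<m)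
      -- At the site above `f`, the new entry, the new maximum, `f` and the old maximum form 2413.
      ... | inj₂ refl = below-dead top (<⇒≤ w<m) last (3rd (≤-refl , f<last , subst (m-1 <_) (sym m≡) ≤-refl))
      cut′ : ∀ {w} → w ≤ suc m → T (alive′ w) → Cut (m ∷ c) w
      cut′ {w} w≤ t with m≤n⇒m<n∨m≡n w≤
      ... | inj₂ refl      = Cut-top valid′ ≤-refl
      ... | inj₁ (s≤s w≤m) with m≤n⇒m<n∨m≡n w≤m
      ...   | inj₂ refl = Cut-∷ ≤-refl (Cut-top valid ≤-refl)
      ...   | inj₁ w<m with w ≤? f
      ...     | yes w≤f = Cut-∷ w≤m (cut w≤f (subst T (same w≤f) t))
      ...     | no  w≰f = ⊥-elim (subst T (dead (≰⇒> w≰f) w<m) t)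

  mutual
    size-B : ∀ n {c j} → B c j → N n c ≡ β n j
    size-B zero    b = refl
    size-B (suc n) {c} {j} b = begin
      ∑[ weight n c ] 0 (suc m)                ≡⟨ ∑[]-snoc (weight n c) 0 m ⟩
      ∑[ weight n c ] 0 m + weight n c m       ≡⟨ cong₂ _+_
        (∑-by-below (alive c) (λ u → N n (u ∷ c)) (α n) m λ u u<m au → size-A n (B-low b u<m au))
        (trans (when-true _ top) (size-B n (B-top b))) ⟩
      ∑ (α n) (# (alive c) 0 m) + β n (suc j)  ≡⟨ cong (λ k → ∑ (α n) k + β n (suc j)) count ⟩
      ∑ (α n) j + β n (suc j)                  ∎
      where
      open B b
      m = length c

    size-A : ∀ n {c j} → A c j → N n c ≡ α n j
    size-A zero    a = refl
    size-A (suc n) {c} {j} a = begin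
      ∑[ weight n c ] 0 (suc m)
        ≡⟨ ∑[]-snoc (weight n c) 0 m ⟩
      ∑[ weight n c ] 0 m + weight n c m
        ≡⟨ cong (λ k → ∑[ weight n c ] 0 k + weight n c m) m≡′ ⟩
      ∑[ weight n c ] 0 (suc f + suc z) + weight n c m
        ≡⟨ cong (_+ weight n c m) (∑[]-split (weight n c) 0 (suc f) (suc z)) ⟩
      ∑[ weight n c ] 0 (suc f) + (weight n c (suc f) + ∑[ weight n c ] (2 + f) z) + weight n c m
        ≡⟨ cong₂ _+_ (cong₂ _+_
             (trans (∑-by-below (alive c) (λ u → N n (u ∷ c)) (α n) (suc f) λ u u≤f au → size-A n (A-low a (≤-pred u≤f) au))
                    (cong (∑ (α n)) count))
             (cong₂ _+_ (trans (when-true _ mid) (size-B n (A-mid a)))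
                        (∑[]-dead (alive c) (λ u → N n (u ∷ c)) (2 + f) z λ w f<w w<m → gap f<w (subst (w <_) (sym size≡) w<m))))
             (trans (when-true _ top) (size-B n (A-top a))) ⟩
      ∑ (α n) (suc j) + (β n 0 + 0) + β n (2 + j)
        ≡⟨ cong (λ k → ∑ (α n) (suc j) + k + β n (2 + j)) (+-identityʳ (β n 0)) ⟩
      ∑ (α n) (suc j) + β n 0 + β n (2 + j) ∎
      where
      open A a
      m = length c
      m≡′ : m ≡ suc f + suc z
      m≡′ = trans size≡ (cong suc (sym (+-suc f z)))

  size≡β : ∀ n → N n [] ≡ β n 0
  size≡β n = size-B n record { valid = [] ; top = alive-[] ; cut = λ _ _ () ; count = refl }

-- The class of H₂, reflected

patterns₂ : List Pattern
patterns₂ = pat 1 2 3 4 ∷ pat 2 1 3 4 ∷ pat 1 3 2 4 ∷ pat 3 1 2 4 ∷ pat 1 3 4 2 ∷ pat 1 4 2 3 ∷ []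

module Class₂ where
  open Insertion patterns₂

  -- State B: j sites are alive besides the top one, and the values above any site alive
  -- decrease. State A: the first value f is not the largest one, f is the lowest site
  -- alive (and resets the state), and j+1 sites above it, besides the top one, are as in B.
  record B (c : List ℕ) (j : ℕ) : Set where
    field
      valid : Valid c
      top   : T (alive c (length c))
      dec   : ∀ {w} → w ≤ length c → T (alive c w) → Dec c w
      count : # (alive c) 0 (length c) ≡ j

  record A (c : List ℕ) (j : ℕ) : Set where
    field
      valid : Valid c
      f z   : ℕ
      size≡ : length c ≡ 2 + f + z
      head  : ∀ {x} → x < length c → x ≢ f → Pair c f x
      dead  : ∀ {w} → w < f → alive c w ≡ false
      low   : T (alive c f)
      dec   : ∀ {w} → f < w → w ≤ length c → T (alive c w) → Dec c w
      top   : T (alive c (length c))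
      count : # (alive c) (suc f) (suc z) ≡ suc j

  top-above : ∀ {c u} → Valid c → u ≤ length c → T (alive c u) → T (alive c (length c)) →
              T (alive (u ∷ c) (suc (length c)))
  top-above {c} {u} v u≤m au at = subst T (sym (above-≡ au u≤m ok)) at
    where
    ok : T (alive c (length c)) → ∀ {x y} → Pair c x y → ¬ Matches patterns₂ (Above (length c) u x y)
    ok _ p (1st (() , _))
    ok _ p (2nd (_ , m≤x , _)) = <⇒≱ (proj₁ (pair-< v p)) m≤x
    ok _ p (3rd (m≤x , _))     = <⇒≱ (proj₁ (pair-< v p)) m≤x
    ok _ p (4th (_ , _ , m≤y)) = <⇒≱ (proj₂ (pair-< v p)) m≤y
    ok _ p (5th (m≤y , _))     = <⇒≱ (proj₂ (pair-< v p)) m≤y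
    ok _ p (6th (m≤x , _))     = <⇒≱ (proj₁ (pair-< v p)) m≤x

  insert-high : ∀ {c u z} → Valid c → u + suc z ≡ length c → T (alive c u) → T (alive c (length c)) →
                (∀ {w} → u ≤ w → w ≤ length c → T (alive c w) → Dec c w) →
                A (u ∷ c) (# (alive c) (suc u) z)
  insert-high {c} {u} {z} v eq au at dec = record
    { valid = u≤m ∷ v
    ; f     = u
    ; z     = z
    ; size≡ = cong suc (trans (sym eq) (+-suc u z))
    ; head  = first (u≤m ∷ v)
    ; dead  = dead
    ; low   = subst T (sym (below-≡ au ≤-refl below-u)) au
    ; dec   = λ { {suc w} (s≤s u≤w) (s≤s w≤m) t → Dec-∷ u≤w (dec u≤w w≤m (subst T (above u≤w) t)) }
    ; top   = top-above v u≤m au at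
    ; count = trans (#-shift (alive (u ∷ c)) (alive c) u (suc z) λ w u≤w _ → above u≤w)
                    (#-cons (alive c) u z (T⇒≡ au))
    }
    where
    m = length c
    u<m : u < m
    u<m = subst (u <_) eq (m<m+n u z<s)
    u≤m = <⇒≤ u<m
    dec-u : Dec c u
    dec-u = dec ≤-refl u≤m au
    below-u : T (alive c u) → ∀ {x y} → Pair c x y → ¬ Matches patterns₂ (Below u u x y)
    below-u _ p (1st (_ , u≤x , x<y))   = <⇒≱ x<y (dec-u p u≤x)
    below-u _ p (2nd (() , _))
    below-u _ p (3rd (u≤x , x<u , _))   = <⇒≱ x<u u≤x
    below-u _ p (4th (u≤x , x<u , _))   = <⇒≱ x<u u≤x
    below-u _ p (5th (u≤y , y<u , _))   = <⇒≱ y<u u≤y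
    below-u _ p (6th (u≤x , x<y , _))   = <⇒≱ x<y (dec-u p u≤x)
    above : ∀ {w} → u ≤ w → alive (u ∷ c) (suc w) ≡ alive c w
    above {w} u≤w = above-≡ au u≤w ok
      where
      ok : T (alive c w) → ∀ {x y} → Pair c x y → ¬ Matches patterns₂ (Above w u x y)
      ok _ p (1st (() , _))
      ok _ p (2nd (_ , w≤x , x<y)) = <⇒≱ x<y (dec-u p (≤-trans u≤w w≤x))
      ok _ p (3rd (w≤x , x<u , _)) = <⇒≱ x<u (≤-trans u≤w w≤x)
      ok _ p (4th (u≤x , x<w , w≤y)) = <⇒≱ (<-≤-trans x<w w≤y) (dec-u p u≤x)
      ok _ p (5th (w≤y , y<u , _)) = <⇒≱ y<u (≤-trans u≤w w≤y)
      ok _ p (6th (w≤x , x<y , _)) = <⇒≱ x<y (dec-u p (≤-trans u≤w w≤x))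
    -- `u + z` is the largest value of `c`. Behind the entries `w` and `u`, the values `w` and
    -- `u + z` of `c` complete 1324 or 1342.
    dead : ∀ {w} → w < u → alive (u ∷ c) w ≡ false
    dead {w} w<u with pair v (<-trans w<u u<m) (subst (u + z <_) (trans (sym (+-suc u z)) eq) ≤-refl)
                              (<⇒≢ (<-≤-trans w<u (m≤m+n u z)))
    ... | inj₁ p = below-dead au (<⇒≤ w<u) p (3rd (≤-refl , w<u , m≤m+n u z))
    ... | inj₂ p = below-dead au (<⇒≤ w<u) p (5th (≤-refl , w<u , m≤m+n u z))

  below-top : ∀ {c w} → Valid c → T (alive c (length c)) → (T (alive c w) → Dec c w) → w ≤ length c →
              alive (length c ∷ c) w ≡ alive c w
  below-top {c} {w} v at dec w≤m = below-≡ at w≤m ok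
    where
    ok : T (alive c w) → ∀ {x y} → Pair c x y → ¬ Matches patterns₂ (Below w (length c) x y)
    ok aw p (1st (_ , m≤x , _)) = <⇒≱ (proj₁ (pair-< v p)) m≤x
    ok aw p (2nd (() , _))
    ok aw p (3rd (_ , _ , m≤y)) = <⇒≱ (proj₂ (pair-< v p)) m≤y
    ok aw p (4th (m≤x , _))     = <⇒≱ (proj₁ (pair-< v p)) m≤x
    ok aw p (5th (_ , _ , m≤x)) = <⇒≱ (proj₁ (pair-< v p)) m≤x
    ok aw p (6th (w≤x , x<y , _)) = <⇒≱ x<y (dec aw p w≤x)

  B-top : ∀ {c j} → B c j → B (length c ∷ c) (suc j)
  B-top {c} {j} b = record
    { valid = ≤-refl ∷ valid
    ; top   = top-above valid ≤-refl top top
    ; dec   = dec′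
    ; count = trans (#-snoc (alive (m ∷ c)) 0 m (trans (same ≤-refl) (T⇒≡ top)))
                    (cong suc (trans (#-same (alive (m ∷ c)) (alive c) 0 m λ w _ w<m → same (<⇒≤ w<m)) count))
    }
    where
    open B b
    m = length c
    same : ∀ {w} → w ≤ m → alive (m ∷ c) w ≡ alive c w
    same w≤m = below-top valid top (dec w≤m) w≤m
    dec′ : ∀ {w} → w ≤ suc m → T (alive (m ∷ c) w) → Dec (m ∷ c) w
    dec′ w≤ t with m≤n⇒m<n∨m≡n w≤
    ... | inj₁ (s≤s w≤m) = Dec-top∷ valid w≤m (dec w≤m (subst T (same w≤m) t))
    ... | inj₂ refl      = Dec-length (≤-refl ∷ valid) ≤-refl

  module _ {c : List ℕ} {j : ℕ} (a : A c j) where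
    open A a
    private
      m = length c
      l : ℕ
      l = suc f + z
      f<l : f < l
      f<l = s≤s (m≤m+n f z)
      f<m : f < m
      f<m = subst (f <_) (sym size≡) (<-trans f<l ≤-refl)
      l<m : l < m
      l<m = subst (l <_) (sym size≡) ≤-refl
      last : Pair c f l
      last = head l<m (>⇒≢ f<l)

    A-low : B (f ∷ c) 0
    A-low = record
      { valid = <⇒≤ f<m ∷ valid
      ; top   = top-above valid (<⇒≤ f<m) low top
      ; dec   = dec′
      ; count = #-dead (alive (f ∷ c)) 0 (suc m) λ w _ w≤m → dead′ (≤-pred w≤m)
      }
      where
      -- The new entry `f`, the old one, now f + 1, and the maximum form 123; an entry in front at
      -- any site but the top makes it 1234, 2134 or 3124.
      dead′ : ∀ {w} → w ≤ m → alive (f ∷ c) w ≡ false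
      dead′ {w} w≤m with w ≤? f
      ... | yes w≤f = below-dead low w≤f last (1st (_ , ≤-refl , f<l))
      dead′ {zero}  w≤m | no w≰f = ⊥-elim (w≰f z≤n)
      dead′ {suc w} w≤m | no w≰f with m≤n⇒m<n∨m≡n (≤-pred (≰⇒> w≰f))
      ... | inj₁ f<w  = above-dead low (<⇒≤ f<w) last (4th (≤-refl , f<w , ≤-pred (subst (suc w ≤_) size≡ w≤m)))
      ... | inj₂ refl = above-dead low ≤-refl last (2nd (_ , ≤-refl , f<l))
      dec′ : ∀ {w} → w ≤ suc m → T (alive (f ∷ c) w) → Dec (f ∷ c) w
      dec′ w≤ t with m≤n⇒m<n∨m≡n w≤
      ... | inj₁ (s≤s w≤m) = ⊥-elim (subst T (dead′ w≤m) t)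
      ... | inj₂ refl      = Dec-length (<⇒≤ f<m ∷ valid) ≤-refl

    A-top : B (m ∷ c) (2 + j)
    A-top = record
      { valid = ≤-refl ∷ valid
      ; top   = top-above valid ≤-refl top top
      ; dec   = dec′
      ; count = begin
          # alive′ 0 (suc m)               ≡⟨ #-snoc alive′ 0 m (trans (same f<m ≤-refl) (T⇒≡ top)) ⟩
          suc (# alive′ 0 m)               ≡⟨ cong (suc ∘ # alive′ 0) m≡ ⟩
          suc (# alive′ 0 (suc f + suc z)) ≡⟨ cong suc (#-split alive′ 0 (suc f) (suc z)) ⟩
          suc (# alive′ 0 (suc f) + # alive′ (suc f) (suc z))
            ≡⟨ cong suc (cong₂ _+_ (#-dead alive′ 0 (suc f) λ w _ w≤f → dead′ (≤-pred w≤f))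
                 (trans (#-same alive′ (alive c) (suc f) (suc z) λ w f<w w<m →
                           same f<w (<⇒≤ (subst (w <_) (sym m≡) w<m))) count)) ⟩
          2 + j ∎
      }
      where
      alive′ = alive (m ∷ c)
      m≡ : m ≡ suc f + suc z
      m≡ = trans size≡ (cong suc (sym (+-suc f z)))
      same : ∀ {w} → f < w → w ≤ m → alive′ w ≡ alive c w
      same f<w w≤m = below-top valid top (dec f<w w≤m) w≤m
      dead′ : ∀ {w} → w ≤ f → alive′ w ≡ false
      dead′ w≤f with m≤n⇒m<n∨m≡n w≤f
      ... | inj₁ w<f  = below-stays-dead top (≤-trans w≤f (<⇒≤ f<m)) (dead w<f)
      -- The new entry `f`, the new maximum, the old first entry and the old maximum form 1423.
      ... | inj₂ refl = below-dead top (<⇒≤ f<m) last (6th (≤-refl , f<l , l<m))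
      dec′ : ∀ {w} → w ≤ suc m → T (alive′ w) → Dec (m ∷ c) w
      dec′ {w} w≤ t with m≤n⇒m<n∨m≡n w≤ | w ≤? f
      ... | inj₂ refl      | _       = Dec-length (≤-refl ∷ valid) ≤-refl
      ... | inj₁ (s≤s w≤m) | yes w≤f = ⊥-elim (subst T (dead′ w≤f) t)
      ... | inj₁ (s≤s w≤m) | no  w≰f = Dec-top∷ valid w≤m (dec (≰⇒> w≰f) w≤m (subst T (same (≰⇒> w≰f) w≤m) t))

  mutual
    size-B : ∀ n {c j} → B c j → N n c ≡ β n j
    size-B zero    b = refl
    size-B (suc n) {c} {j} b = begin
      ∑[ weight n c ] 0 (suc m)                ≡⟨ ∑[]-snoc (weight n c) 0 m ⟩
      ∑[ weight n c ] 0 m + weight n c m       ≡⟨ cong₂ _+_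
        (∑-by-above (alive c) (λ u → N n (u ∷ c)) (α n) 0 m λ u r eq _ au →
          size-A n (insert-high valid eq au top λ _ → dec))
        (trans (when-true _ top) (size-B n (B-top b))) ⟩
      ∑ (α n) (# (alive c) 0 m) + β n (suc j)  ≡⟨ cong (λ k → ∑ (α n) k + β n (suc j)) count ⟩
      ∑ (α n) j + β n (suc j)                  ∎
      where
      open B b
      m = length c

    size-A : ∀ n {c j} → A c j → N n c ≡ α n j
    size-A zero    a = refl
    size-A (suc n) {c} {j} a = begin
      ∑[ weight n c ] 0 (suc m)
        ≡⟨ ∑[]-snoc (weight n c) 0 m ⟩
      ∑[ weight n c ] 0 m + weight n c m
        ≡⟨ cong (λ k → ∑[ weight n c ] 0 k + weight n c m) m≡ ⟩
      ∑[ weight n c ] 0 (f + suc (suc z)) + weight n c m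
        ≡⟨ cong (_+ weight n c m) (∑[]-split (weight n c) 0 f (suc (suc z))) ⟩
      ∑[ weight n c ] 0 f + (weight n c f + ∑[ weight n c ] (suc f) (suc z)) + weight n c m
        ≡⟨ cong₂ _+_ (cong₂ _+_
             (∑[]-dead (alive c) (λ u → N n (u ∷ c)) 0 f λ w _ w<f → dead w<f)
             (cong₂ _+_ (trans (when-true _ low) (size-B n (A-low a)))
               (trans (∑-by-above (alive c) (λ u → N n (u ∷ c)) (α n) (suc f) (suc z) λ u r eq f<u au →
                        size-A n (insert-high valid (trans eq (trans (sym (+-suc f (suc z))) (sym m≡))) au top
                          λ u≤w → dec (<-≤-trans f<u u≤w)))
                      (cong (∑ (α n)) count))))
             (trans (when-true _ top) (size-B n (A-top a))) ⟩
      β n 0 + ∑ (α n) (suc j) + β n (2 + j)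
        ≡⟨ cong (_+ β n (2 + j)) (+-comm (β n 0) _) ⟩
      ∑ (α n) (suc j) + β n 0 + β n (2 + j) ∎
      where
      open A a
      m = length c
      m≡ : m ≡ f + suc (suc z)
      m≡ = trans size≡ (trans (cong suc (sym (+-suc f z))) (sym (+-suc f (suc z))))

  size≡β : ∀ n → N n [] ≡ β n 0
  size≡β n = size-B n record { valid = [] ; top = alive-[] ; dec = λ _ _ () ; count = refl }

-- The class of H₃, reflected

patterns₃ : List Pattern
patterns₃ = pat 2 3 4 1 ∷ pat 3 1 4 2 ∷ pat 3 2 4 1 ∷ pat 3 4 1 2 ∷ pat 3 4 2 1 ∷ pat 4 2 3 1 ∷ []

module Class₃ where
  open Insertion patterns₃

  -- State B: besides the site 0, j sites are alive, all of them cuts. State A: the first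
  -- value is f = g + 1, and the sites alive are 0, 1 (which resets the state) and j+1
  -- cuts above f.
  record B (c : List ℕ) (j : ℕ) : Set where
    field
      valid : Valid c
      low   : T (alive c 0)
      one   : ∀ {w} → 1 ≤ w → w ≤ length c → T (alive c w) → T (alive c 1)
      cut   : ∀ {w} → w ≤ length c → T (alive c w) → UpCut c w
      count : # (alive c) 1 (length c) ≡ j

  record A (c : List ℕ) (j : ℕ) : Set where
    field
      valid : Valid c
      g z   : ℕ
      size≡ : length c ≡ suc g + suc z
      head  : ∀ {x} → x < length c → x ≢ suc g → Pair c (suc g) x
      low   : T (alive c 0)
      one   : T (alive c 1)
      gap   : ∀ {w} → 1 < w → w ≤ suc g → alive c w ≡ false
      cut   : ∀ {w} → suc g < w → w ≤ length c → T (alive c w) → UpCut c w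
      count : # (alive c) (2 + g) (suc z) ≡ suc j

  low-below : ∀ {c u} → T (alive c u) → T (alive c 0) → T (alive (u ∷ c) 0)
  low-below {c} {u} au a0 = subst T (sym (below-≡ au z≤n ok)) a0
    where
    ok : T (alive c 0) → ∀ {x y} → Pair c x y → ¬ Matches patterns₃ (Below 0 u x y)
    ok _ p (1st (() , _))
    ok _ p (2nd (_ , () , _))
    ok _ p (3rd (_ , () , _))
    ok _ p (4th (_ , () , _))
    ok _ p (5th (_ , () , _))
    ok _ p (6th (_ , _ , ()))

  above-same : ∀ {c u w} → T (alive c u) → UpCut c u → (T (alive c w) → UpCut c w) → u ≤ w →
               alive (u ∷ c) (suc w) ≡ alive c w
  above-same {c} {u} {w} au cut-u cut-w u≤w = above-≡ au u≤w ok
    where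
    ok : T (alive c w) → ∀ {x y} → Pair c x y → ¬ Matches patterns₃ (Above w u x y)
    ok aw p (1st (_ , () , _))
    ok aw p (2nd (_ , y<w , w≤x))  = <⇒≱ y<w (cut-w aw p w≤x)
    ok aw p (3rd (y<u , _ , w≤x))  = <⇒≱ y<u (cut-u p (≤-trans u≤w w≤x))
    ok aw p (4th (_ , _ , ()))
    ok aw p (5th (_ , _ , ()))
    ok aw p (6th (y<u , u≤x , _))  = <⇒≱ y<u (cut-u p u≤x)

  insert-high : ∀ {c u z} → Valid c → 1 ≤ u → u + suc z ≡ suc (length c) → T (alive c u) →
                T (alive c 0) → T (alive c 1) →
                (∀ {w} → u ≤ w → w ≤ length c → T (alive c w) → UpCut c w) →
                A (u ∷ c) (# (alive c) (suc u) z)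
  insert-high {c} {suc g} {z} v 1≤u eq au a0 a1 cut = record
    { valid = u≤m ∷ v
    ; g     = g
    ; z     = z
    ; size≡ = sym eq
    ; head  = first (u≤m ∷ v)
    ; low   = low-below au a0
    ; one   = subst T (sym (below-≡ au 1≤u below-one)) a1
    ; gap   = gap
    ; cut   = λ { {suc w} (s≤s u≤w) (s≤s w≤m) t → UpCut-∷ u≤w (cut u≤w w≤m (subst T (same u≤w w≤m) t)) }
    ; count = trans (#-shift (alive (u ∷ c)) (alive c) u (suc z) λ w u≤w w<m → same u≤w (≤-pred (subst (w <_) eq w<m)))
                    (#-cons (alive c) u z (T⇒≡ au))
    }
    where
    u : ℕ
    u = suc g
    u≤m : u ≤ length c
    u≤m = subst (u ≤_) (suc-injective (trans (sym (+-suc u z)) eq)) (m≤m+n u z)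
    same : ∀ {w} → u ≤ w → w ≤ length c → alive (u ∷ c) (suc w) ≡ alive c w
    same u≤w w≤m = above-same au (cut ≤-refl u≤m au) (cut u≤w w≤m) u≤w
    below-one : T (alive c 1) → ∀ {x y} → Pair c x y → ¬ Matches patterns₃ (Below 1 u x y)
    below-one _ p (1st (y<1 , _ , u≤x))    = <⇒≱ y<1 (≤-trans 1≤u (cut ≤-refl u≤m au p u≤x))
    below-one _ p (2nd (u≤y , y<1 , _))    = <⇒≱ y<1 (≤-trans 1≤u u≤y)
    below-one _ p (3rd (_ , () , _))
    below-one _ p (4th (x<y , s≤s y≤0 , _)) = n≮0 (<-≤-trans x<y y≤0)
    below-one _ p (5th (y<x , s≤s x≤0 , _)) = n≮0 (<-≤-trans y<x x≤0)
    below-one _ p (6th (_ , u≤x , x<1))    = <⇒≱ x<1 (≤-trans 1≤u u≤x)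
    -- The values 0 and 1 lie below both first entries and complete 3412 or 3421.
    gap : ∀ {w} → 1 < w → w ≤ u → alive (u ∷ c) w ≡ false
    gap {w} 1<w w≤u with 1<m ← <-≤-trans 1<w (≤-trans w≤u u≤m)
      with pair {x = 0} {1} v (<-trans z<s 1<m) 1<m (λ ())
    ... | inj₁ p = below-dead au w≤u p (4th (z<s , 1<w , _))
    ... | inj₂ p = below-dead au w≤u p (5th (z<s , 1<w , _))

  B-low : ∀ {c j} → B c j → B (0 ∷ c) (suc j)
  B-low {c} {j} b = record
    { valid = z≤n ∷ valid
    ; low   = low-below low low
    ; one   = λ _ _ _ → subst T (sym (same z≤n)) low
    ; cut   = λ { {zero} _ _ → λ _ _ → z≤n
                ; {suc w} (s≤s w≤m) t → UpCut-∷ z≤n (cut w≤m (subst T (same w≤m) t)) }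
    ; count = trans (#-shift (alive (0 ∷ c)) (alive c) 0 (suc m) λ w _ w≤m → same (≤-pred w≤m))
                    (trans (#-cons (alive c) 0 m (T⇒≡ low)) (cong suc count))
    }
    where
    open B b
    m = length c
    same : ∀ {w} → w ≤ m → alive (0 ∷ c) (suc w) ≡ alive c w
    same w≤m = above-same low (λ _ _ → z≤n) (cut w≤m) z≤n

  module _ {c : List ℕ} {j : ℕ} (a : A c j) where
    open A a
    private
      m f : ℕ
      m = length c
      f = suc g
      f<m : f < m
      f<m = subst (f <_) (sym size≡) (m<m+n f z<s)
      zero-last : Pair c f 0
      zero-last = head (≤-<-trans z≤n f<m) λ ()

    A-low : B (0 ∷ c) (2 + j)
    A-low = record
      { valid = z≤n ∷ valid
      ; low   = low-below low low
      ; one   = λ _ _ _ → one′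
      ; cut   = cut′
      ; count = begin
          # alive′ 1 (suc m)                  ≡⟨ #-cons alive′ 1 m (T⇒≡ one′) ⟩
          suc (# alive′ 2 m)                  ≡⟨ cong (suc ∘ # alive′ 2) size≡ ⟩
          suc (# alive′ 2 (f + suc z))        ≡⟨ cong suc (#-split alive′ 2 f (suc z)) ⟩
          suc (# alive′ 2 f + # alive′ (2 + f) (suc z))
            ≡⟨ cong suc (cong₂ _+_
                 (#-dead alive′ 2 f λ { (suc w) (s≤s 0<w) (s≤s w≤f) → dead′ 0<w (≤-pred w≤f) })
                 (trans (#-shift alive′ (alive c) (suc f) (suc z) λ w f<w w<m →
                           same f<w (≤-pred (subst (w <_) (cong suc (sym size≡)) w<m))) count)) ⟩
          2 + j                               ∎
      }
      where
      alive′ = alive (0 ∷ c)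
      one′ : T (alive′ 1)
      one′ = subst T (sym (above-same low (λ _ _ → z≤n) (λ _ _ _ → z≤n) z≤n)) low
      same : ∀ {w} → f < w → w ≤ m → alive′ (suc w) ≡ alive c w
      same f<w w≤m = above-same low (λ _ _ → z≤n) (cut f<w w≤m) z≤n
      -- `f` stands before 0 in `c`, so an entry between them in value, followed by the new 0,
      -- completes 3142.
      dead′ : ∀ {w} → 0 < w → w ≤ f → alive′ (suc w) ≡ false
      dead′ 0<w w≤f = above-dead low z≤n zero-last (2nd (z≤n , 0<w , w≤f))
      cut′ : ∀ {w} → w ≤ suc m → T (alive′ w) → UpCut (0 ∷ c) w
      cut′ {zero}        _ _ _ _ = z≤n
      cut′ {suc zero}    _ _     = UpCut-∷ z≤n λ _ _ → z≤n
      cut′ {suc (suc w)} (s≤s w≤m) t with suc w ≤? f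
      ... | yes w≤f = ⊥-elim (subst T (dead′ z<s w≤f) t)
      ... | no  w≰f = UpCut-∷ z≤n (cut (≰⇒> w≰f) w≤m (subst T (same (≰⇒> w≰f) w≤m) t))

    A-one : B (1 ∷ c) 0
    A-one = record
      { valid = <⇒≤ (≤-<-trans (s≤s z≤n) f<m) ∷ valid
      ; low   = low-below one low
      ; one   = λ 1≤w _ t → ⊥-elim (subst T (dead′ 1≤w) t)
      ; cut   = λ { {zero} _ _ → λ _ _ → z≤n ; {suc w} _ t → ⊥-elim (subst T (dead′ {suc w} (s≤s z≤n)) t) }
      ; count = #-dead (alive (1 ∷ c)) 1 (suc m) λ w 1≤w _ → dead′ 1≤w
      }
      where
      -- The new 1, the old first entry and 0 form 231; every entry in front except a new minimum
      -- makes it 2341, 3241 or 4231.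
      dead′ : ∀ {w} → 1 ≤ w → alive (1 ∷ c) w ≡ false
      dead′ {suc zero}    _ = below-dead one ≤-refl zero-last (1st (z<s , _ , s≤s z≤n))
      dead′ {suc (suc w)} _ with suc w ≤? f
      ... | yes w≤f = above-dead one (s≤s z≤n) zero-last (3rd (z<s , _ , w≤f))
      ... | no  w≰f = above-dead one (s≤s z≤n) zero-last (6th (z<s , s≤s z≤n , ≰⇒> w≰f))

  mutual
    size-B : ∀ n {c j} → B c j → N n c ≡ β n j
    size-B zero    b = refl
    size-B (suc n) {c} {j} b = begin
      weight n c 0 + ∑[ weight n c ] 1 m        ≡⟨ cong₂ _+_
        (trans (when-true _ low) (size-B n (B-low b)))
        (trans (∑-by-above (alive c) (λ u → N n (u ∷ c)) (α n) 1 m λ u r eq 1≤u au →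
                 let u≤m = subst (u ≤_) (suc-injective (trans (sym (+-suc u r)) eq)) (m≤m+n u r) in
                 -- State A requires site 1 to be alive; the field `one` of state B supplies this as
                 -- soon as any positive site is alive.
                 size-A n (insert-high valid 1≤u eq au low (one 1≤u u≤m au) λ _ → cut))
               (cong (∑ (α n)) count)) ⟩
      β n (suc j) + ∑ (α n) j                   ≡⟨ +-comm (β n (suc j)) _ ⟩
      ∑ (α n) j + β n (suc j)                   ∎
      where
      open B b
      m = length c

    size-A : ∀ n {c j} → A c j → N n c ≡ α n j
    size-A zero    a = refl
    size-A (suc n) {c} {j} a = begin
      weight n c 0 + ∑[ weight n c ] 1 m
        ≡⟨ cong (λ k → weight n c 0 + ∑[ weight n c ] 1 k) size≡ ⟩
      weight n c 0 + (weight n c 1 + ∑[ weight n c ] 2 (g + suc z))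
        ≡⟨ cong (λ k → weight n c 0 + (weight n c 1 + k)) (∑[]-split (weight n c) 2 g (suc z)) ⟩
      weight n c 0 + (weight n c 1 + (∑[ weight n c ] 2 g + ∑[ weight n c ] (2 + g) (suc z)))
        ≡⟨ cong₂ _+_ (trans (when-true _ low) (size-B n (A-low a)))
             (cong₂ _+_ (trans (when-true _ one) (size-B n (A-one a)))
               (cong₂ _+_
                 (∑[]-dead (alive c) (λ u → N n (u ∷ c)) 2 g λ w 1<w w≤g → gap 1<w (≤-pred w≤g))
                 (trans (∑-by-above (alive c) (λ u → N n (u ∷ c)) (α n) (2 + g) (suc z) λ u r eq f<u au →
                          size-A n (insert-high valid (≤-trans (s≤s z≤n) f<u) (trans eq (cong suc (sym size≡))) au low one
                            λ u≤w → cut (<-≤-trans f<u u≤w)))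
                        (cong (∑ (α n)) count)))) ⟩
      β n (2 + j) + (β n 0 + ∑ (α n) (suc j))
        ≡⟨ +-comm (β n (2 + j)) _ ⟩
      β n 0 + ∑ (α n) (suc j) + β n (2 + j)
        ≡⟨ cong (_+ β n (2 + j)) (+-comm (β n 0) _) ⟩
      ∑ (α n) (suc j) + β n 0 + β n (2 + j) ∎
      where
      open A a
      m = length c

  size≡β : ∀ n → N n [] ≡ β n 0
  size≡β n = size-B n record
    { valid = [] ; low = alive-[] ; one = λ { z<s () } ; cut = λ { _ _ () } ; count = refl }

-- The class of H₄, reflected

patterns₄ : List Pattern
patterns₄ = pat 1 2 4 3 ∷ pat 2 1 4 3 ∷ pat 1 3 4 2 ∷ pat 1 4 2 3 ∷ pat 1 4 3 2 ∷ pat 4 1 3 2 ∷ []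

module Class₄ where
  open Insertion patterns₄

  -- In both states the sites alive form an interval that starts at l; inserting at the
  -- bottom of the interval of a code in state A resets the state.
  record Interval (c : List ℕ) (l k : ℕ) : Set where
    field
      inside : ∀ {w} → l ≤ w → w < l + k → T (alive c w)
      under  : ∀ {w} → w < l → alive c w ≡ false
      over   : ∀ {w} → l + k ≤ w → w ≤ length c → alive c w ≡ false

  record B (c : List ℕ) (j : ℕ) : Set where
    field
      valid    : Valid c
      l z      : ℕ
      size≡    : suc (length c) ≡ l + (1 + j + z)
      interval : Interval c l (1 + j)
      inc      : Inc c l

  record A (c : List ℕ) (j : ℕ) : Set where
    field
      valid    : Valid c
      l z      : ℕ
      size≡    : suc (length c) ≡ l + (3 + j + z)
      head     : ∀ {x} → x < length c → x ≢ suc l → Pair c (suc l) x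
      interval : Interval c l (3 + j)
      inc      : Inc c (suc l)

  module _ {c : List ℕ} {u : ℕ} (au : T (alive c u)) (inc : Inc c u) where

    above-same : ∀ {w} → u ≤ w → alive (u ∷ c) (suc w) ≡ alive c w
    above-same {w} u≤w = above-≡ au u≤w ok
      where
      ok : T (alive c w) → ∀ {x y} → Pair c x y → ¬ Matches patterns₄ (Above w u x y)
      ok _ p (1st (() , _))
      ok _ p (2nd (_ , w≤y , y<x))   = <⇒≱ y<x (inc p (≤-trans u≤w w≤y))
      ok _ p (3rd (w≤y , y<u , _))   = <⇒≱ y<u (≤-trans u≤w w≤y)
      ok _ p (4th (w≤x , x<y , y<u)) = <⇒≱ (<-trans x<y y<u) (≤-trans u≤w w≤x)
      ok _ p (5th (w≤y , y<x , x<u)) = <⇒≱ (<-trans y<x x<u) (≤-trans u≤w w≤y)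
      ok _ p (6th (u≤y , y<x , _))   = <⇒≱ y<x (inc p u≤y)

    below-same : alive (u ∷ c) u ≡ alive c u
    below-same = below-≡ au ≤-refl ok
      where
      ok : T (alive c u) → ∀ {x y} → Pair c x y → ¬ Matches patterns₄ (Below u u x y)
      ok _ p (1st (_ , u≤y , y<x))   = <⇒≱ y<x (inc p u≤y)
      ok _ p (2nd (() , _))
      ok _ p (3rd (u≤y , y<u , _))   = <⇒≱ y<u u≤y
      ok _ p (4th (u≤x , x<y , y<u)) = <⇒≱ (<-trans x<y y<u) u≤x
      ok _ p (5th (u≤y , y<x , x<u)) = <⇒≱ (<-trans y<x x<u) u≤y
      ok _ p (6th (u≤y , y<x , _))   = <⇒≱ y<x (inc p u≤y)

  module _ {c : List ℕ} {l k : ℕ} (int : Interval c l k) where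
    open Interval int

    -- Since the values from `u` on increase, site `u` survives and is doubled: the living sites
    -- from `u` on also reappear one step higher. Hence the upper end moves from l + k to l + k + 1.
    insert-within : ∀ {u} → l ≤ u → u < l + k → Inc c u → (∀ {w} → w < u → alive (u ∷ c) w ≡ false) →
                    ∀ {k′} → u + k′ ≡ suc (l + k) → Interval (u ∷ c) u k′
    insert-within {u} l≤u u<l+k inc dead eq = record
      { inside = in′
      ; under  = dead
      ; over   = over′
      }
      where
      au = inside l≤u u<l+k
      in′ : ∀ {w} → u ≤ w → w < u + _ → T (alive (u ∷ c) w)
      in′ u≤w w< with m≤n⇒m<n∨m≡n u≤w
      ... | inj₂ refl      = subst T (sym (below-same au inc)) au
      ... | inj₁ (s≤s u≤w) = subst T (sym (above-same au inc u≤w))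
                               (inside (≤-trans l≤u u≤w) (≤-pred (≤-trans w< (≤-reflexive eq))))
      over′ : ∀ {w} → u + _ ≤ w → w ≤ suc (length c) → alive (u ∷ c) w ≡ false
      over′ {w} ≤w w≤ with subst (_≤ w) eq ≤w | w≤
      ... | s≤s l+k≤w | s≤s w≤m = above-stays-dead au (≤-trans (<⇒≤ u<l+k) l+k≤w) (over l+k≤w w≤m)

    -- Inserting at v + 1 leaves the site `v` just below alive, which is why the new interval starts
    -- at `v` and not at the new first value; with the doubled site v + 1 and the r sites above it,
    -- it has 3 + r members.
    insert-high : ∀ {v r z} → Valid c → suc (length c) ≡ l + (k + z) → l ≤ v → Inc c v →
                  suc v + suc r ≡ l + k → A (suc v ∷ c) r
    insert-high {v} {r} {z} val size≡ l≤v inc eq = record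
      { valid    = u≤m ∷ val
      ; l        = v
      ; z        = z
      ; size≡    = trans (cong suc (trans size≡ (trans (sym (+-assoc l k z)) (cong (_+ z) (sym eq))))) (lemma v r z)
      ; head     = first (u≤m ∷ val)
      ; interval = record { inside = in′ ; under = dead ; over = over′ }
      ; inc      = Inc-∷ (Inc-≤ (n≤1+n v) inc)
      }
      where
      lemma : ∀ v r z → suc (suc v + suc r + z) ≡ v + (3 + r + z)
      lemma = solve-∀
      u<l+k : suc v < l + k
      u<l+k = subst (suc v <_) eq (m<m+n (suc v) z<s)
      l+k≤ : l + k ≤ suc (length c)
      l+k≤ = subst (l + k ≤_) (trans (+-assoc l k z) (sym size≡)) (m≤m+n (l + k) z)
      u≤m : suc v ≤ length c
      u≤m = ≤-pred (<-≤-trans u<l+k l+k≤)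
      au : T (alive c (suc v))
      au = inside (m≤n⇒m≤1+n l≤v) u<l+k
      inc-u : Inc c (suc v)
      inc-u = Inc-≤ (n≤1+n v) inc
      -- Below `v`, the values `w` and `suc w` both lie under the second entry and complete 1423 or
      -- 1432.
      dead : ∀ {w} → w < v → alive (suc v ∷ c) w ≡ false
      dead {w} w<v with pair {x = w} {suc w} val (<-trans w<v u≤m) (≤-trans (s≤s w<v) u≤m) (<⇒≢ ≤-refl)
      ... | inj₁ p = below-dead au (<⇒≤ (m<n⇒m<1+n w<v)) p (4th (≤-refl , ≤-refl , s≤s w<v))
      ... | inj₂ p = below-dead au (<⇒≤ (m<n⇒m<1+n w<v)) p (5th (≤-refl , ≤-refl , s≤s w<v))
      -- Only the value `v` lies between the two first entries, too few for 1423 and 1432.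
      step : alive (suc v ∷ c) v ≡ alive c v
      step = below-≡ au (n≤1+n v) ok
        where
        ok : T (alive c v) → ∀ {x y} → Pair c x y → ¬ Matches patterns₄ (Below v (suc v) x y)
        ok _ p (1st (_ , u≤y , y<x))   = <⇒≱ y<x (inc-u p u≤y)
        ok _ p (2nd (() , _))
        ok _ p (3rd (v≤y , y<u , u≤x)) = <⇒≱ (<-≤-trans y<u u≤x) (inc p v≤y)
        ok _ p (4th (v≤x , x<y , y<u)) = <⇒≱ (<-≤-trans x<y (≤-pred y<u)) v≤x
        ok _ p (5th (v≤y , y<x , x<u)) = <⇒≱ (<-≤-trans y<x (≤-pred x<u)) v≤y
        ok _ p (6th (u≤y , y<x , _))   = <⇒≱ y<x (inc-u p u≤y)
      bound : v + (3 + r) ≡ suc (l + k)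
      bound = trans (lemma′ v r) (cong suc eq)
        where
        lemma′ : ∀ v r → v + (3 + r) ≡ suc (suc v + suc r)
        lemma′ = solve-∀
      in′ : ∀ {w} → v ≤ w → w < v + (3 + r) → T (alive (suc v ∷ c) w)
      in′ {w} v≤w w< with m≤n⇒m<n∨m≡n v≤w
      ... | inj₂ refl = subst T (sym step) (inside l≤v (<-trans ≤-refl u<l+k))
      ... | inj₁ v<w with m≤n⇒m<n∨m≡n v<w
      ...   | inj₂ refl      = subst T (sym (below-same au inc-u)) au
      ...   | inj₁ (s≤s v<w) = subst T (sym (above-same au inc-u v<w))
                                 (inside (≤-trans l≤v (<⇒≤ v<w)) (≤-pred (≤-trans w< (≤-reflexive bound))))
      over′ : ∀ {w} → v + (3 + r) ≤ w → w ≤ suc (length c) → alive (suc v ∷ c) w ≡ false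
      over′ {w} ≤w w≤ with subst (_≤ w) bound ≤w | w≤
      ... | s≤s l+k≤w | s≤s w≤m = above-stays-dead au (≤-trans (<⇒≤ u<l+k) l+k≤w) (over l+k≤w w≤m)

    interval-sum : ∀ n {z} → suc (length c) ≡ l + (k + z) →
                   ∑[ weight n c ] 0 (suc (length c)) ≡ ∑[ (λ u → N n (u ∷ c)) ] l k
    interval-sum n {z} size≡ = begin
      ∑[ weight n c ] 0 (suc (length c)) ≡⟨ cong (∑[ weight n c ] 0) size≡ ⟩
      ∑[ weight n c ] 0 (l + (k + z))    ≡⟨ ∑[]-split (weight n c) 0 l (k + z) ⟩
      ∑[ weight n c ] 0 l + ∑[ weight n c ] l (k + z)
        ≡⟨ cong₂ _+_ (∑[]-dead (alive c) size′ 0 l λ w _ → under) (∑[]-split (weight n c) l k z) ⟩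
      ∑[ weight n c ] l k + ∑[ weight n c ] (l + k) z
        ≡⟨ cong₂ _+_
             (∑[]-cong {weight n c} {size′} l l k λ i i<k → when-true _ (inside (m≤m+n l i) (+-monoʳ-< l i<k)))
             (∑[]-dead (alive c) size′ (l + k) z λ w l+k≤w w< →
               over l+k≤w (≤-pred (≤-trans w< (≤-reflexive (trans (+-assoc l k z) (sym size≡)))))) ⟩
      ∑[ size′ ] l k + 0                 ≡⟨ +-identityʳ _ ⟩
      ∑[ size′ ] l k                     ∎
      where
      size′ : ℕ → ℕ
      size′ u = N n (u ∷ c)

  B-low : ∀ {c j} (b : B c j) → B (B.l b ∷ c) (suc j)
  B-low {c} {j} b = record
    { valid    = ≤-pred (subst (l <_) (sym size≡) (m<m+n l z<s)) ∷ valid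
    ; l        = l
    ; z        = z
    ; size≡    = trans (cong suc size≡) (sym (+-suc l (1 + j + z)))
    ; interval = insert-within interval ≤-refl (m<m+n l z<s) inc
                   (λ w<l → below-stays-dead (Interval.inside interval ≤-refl (m<m+n l z<s)) (<⇒≤ w<l) (Interval.under interval w<l))
                   (+-suc l (1 + j))
    ; inc      = Inc-∷ inc
    }
    where open B b

  module _ {c : List ℕ} {j : ℕ} (a : A c j) where
    open A a
    open Interval interval
    private
      m = length c
      sl<m : suc l < m
      sl<m = ≤-pred (subst (2 + l <_) (sym size≡) (subst (2 + l <_) (lemma l j z) (s≤s (s≤s (s≤s (m≤m+n l (j + z)))))))
        where
        lemma : ∀ l j z → 3 + (l + (j + z)) ≡ l + (3 + j + z)
        lemma = solve-∀
      desc : Pair c (suc l) l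
      desc = head (<-trans ≤-refl sl<m) (<⇒≢ ≤-refl)
      al : T (alive c l)
      al = inside ≤-refl (m<m+n l z<s)
      sl< : suc l < l + (3 + j)
      sl< = subst (suc l <_) (sym (+-suc l (2 + j))) (s≤s (m<m+n l z<s))
      asl : T (alive c (suc l))
      asl = inside (n≤1+n l) sl<

    A-low : B (l ∷ c) 0
    A-low = record
      { valid    = <⇒≤ (<-trans ≤-refl sl<m) ∷ valid
      -- The permutation now contains l, l + 2, l + 1 as a 132 starting at its first entry. A
      -- further entry makes it 1243, 2143 or 4132, except at site l + 2, where the result is 3142,
      -- which is allowed.
      ; l        = 2 + l
      ; z        = 1 + j + z
      ; size≡    = trans (cong suc size≡) (lemma l j z)
      ; interval = record { inside = in′ ; under = under′ ; over = over′ }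
      ; inc      = Inc-∷-suc (n≤1+n l) inc
      }
      where
      lemma : ∀ l j z → suc (l + (3 + j + z)) ≡ 2 + l + (1 + 0 + (1 + j + z))
      lemma = solve-∀
      ok : T (alive c (suc l)) → ∀ {x y} → Pair c x y → ¬ Matches patterns₄ (Above (suc l) l x y)
      ok _ p (1st (() , _))
      ok _ p (2nd (_ , w≤y , y<x))   = <⇒≱ y<x (inc p w≤y)
      ok _ p (3rd (w≤y , y<l , _))   = <⇒≱ y<l (<⇒≤ w≤y)
      ok _ p (4th (w≤x , x<y , y<l)) = <⇒≱ (<-trans x<y y<l) (<⇒≤ w≤x)
      ok _ p (5th (w≤y , y<x , x<l)) = <⇒≱ (<-trans y<x x<l) (<⇒≤ w≤y)
      ok _ p (6th (l≤y , y<x , x<w)) = <⇒≱ (<-≤-trans y<x (≤-pred x<w)) l≤y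
      in′ : ∀ {w} → 2 + l ≤ w → w < 2 + l + 1 → T (alive (l ∷ c) w)
      in′ {w} ≤w w< with ≤-antisym ≤w (≤-pred (subst (w <_) (+-comm (2 + l) 1) w<))
      ... | refl = subst T (sym (above-≡ al (n≤1+n l) ok)) asl
      under′ : ∀ {w} → w < 2 + l → alive (l ∷ c) w ≡ false
      under′ (s≤s w≤sl) with m≤n⇒m<n∨m≡n w≤sl
      ... | inj₁ (s≤s w≤l) = below-dead al w≤l desc (1st (_ , ≤-refl , ≤-refl))
      ... | inj₂ refl      = above-dead al ≤-refl desc (2nd (_ , ≤-refl , ≤-refl))
      over′ : ∀ {w} → 2 + l + 1 ≤ w → w ≤ suc m → alive (l ∷ c) w ≡ false
      over′ {w} ≤w _ with subst (_≤ w) (+-comm (2 + l) 1) ≤w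
      ... | s≤s ssl≤w = above-dead al (≤-trans (m≤n+m l 2) ssl≤w) desc (6th (≤-refl , ≤-refl , ssl≤w))

    A-mid : B (suc l ∷ c) (2 + j)
    A-mid = record
      { valid    = <⇒≤ sl<m ∷ valid
      ; l        = suc l
      ; z        = z
      ; size≡    = cong suc size≡
      ; interval = insert-within interval (n≤1+n l) sl< inc
                     -- The new entry, the old first entry and `l` form 231 above any site up to
                     -- `l`, which gives 1342.
                     (λ { (s≤s w≤l) → below-dead asl (m≤n⇒m≤1+n w≤l) desc (3rd (w≤l , ≤-refl , ≤-refl)) }) refl
      ; inc      = Inc-∷ inc
      }

  mutual
    size-B : ∀ n {c j} → B c j → N n c ≡ β n j
    size-B zero    b = refl
    size-B (suc n) {c} {j} b = begin
      ∑[ weight n c ] 0 (suc (length c))                 ≡⟨ interval-sum interval n size≡ ⟩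
      N n (l ∷ c) + ∑[ (λ u → N n (u ∷ c)) ] (suc l) j   ≡⟨ cong₂ _+_
        (size-B n (B-low b))
        (∑-by-distance (λ u → N n (u ∷ c)) (α n) (suc l) j λ { (suc v) r eq (s≤s l≤v) →
          size-A n (insert-high interval valid size≡ l≤v (Inc-≤ l≤v inc) (trans eq (sym (+-suc l j)))) }) ⟩
      β n (suc j) + ∑ (α n) j                            ≡⟨ +-comm (β n (suc j)) _ ⟩
      ∑ (α n) j + β n (suc j)                            ∎
      where
      open B b

    size-A : ∀ n {c j} → A c j → N n c ≡ α n j
    size-A zero    a = refl
    size-A (suc n) {c} {j} a = begin
      ∑[ weight n c ] 0 (suc (length c))
        ≡⟨ interval-sum interval n size≡ ⟩
      N n (l ∷ c) + (N n (suc l ∷ c) + ∑[ (λ u → N n (u ∷ c)) ] (2 + l) (suc j))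
        ≡⟨ cong₂ _+_ (size-B n (A-low a)) (cong₂ _+_ (size-B n (A-mid a))
             (∑-by-distance (λ u → N n (u ∷ c)) (α n) (2 + l) (suc j) λ { (suc v) r eq (s≤s l<v) →
               size-A n (insert-high interval valid size≡ (<⇒≤ l<v) (Inc-≤ l<v inc) (trans eq (lemma₁ l j))) })) ⟩
      β n 0 + (β n (2 + j) + ∑ (α n) (suc j))
        ≡⟨ lemma₂ (β n 0) (β n (2 + j)) (∑ (α n) (suc j)) ⟩
      ∑ (α n) (suc j) + β n 0 + β n (2 + j) ∎
      where
      open A a
      lemma₁ : ∀ l j → 2 + l + suc j ≡ l + (3 + j)
      lemma₁ = solve-∀
      lemma₂ : ∀ a b c → a + (b + c) ≡ c + a + b
      lemma₂ = solve-∀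

  size≡β : ∀ n → N n [] ≡ β n 0
  size≡β n = size-B n record
    { valid = [] ; l = 0 ; z = 0 ; size≡ = refl
    ; interval = record { inside = λ { z≤n z<s → alive-[] } ; under = λ () ; over = λ { (s≤s _) () } }
    ; inc = λ () }

-- The class of H₅

patterns₅ : List Pattern
patterns₅ = pat 1 2 3 4 ∷ pat 1 2 4 3 ∷ pat 1 3 2 4 ∷ pat 1 4 2 3 ∷ pat 2 1 3 4 ∷ pat 3 1 2 4 ∷ []

module Class₅ where
  open Insertion patterns₅

  -- State B: the j sites alive below the top one have only decreasing values above them,
  -- and the highest of them is next to the top. State A: the first value f is the second
  -- largest one, the two highest sites are alive, and the j+1 sites alive below them
  -- reset the state.
  record B (c : List ℕ) (j : ℕ) : Set where
    field
      valid  : Valid c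
      top    : T (alive c (length c))
      second : ∀ {w l} → length c ≡ suc l → w ≤ l → T (alive c w) → T (alive c l)
      dec    : ∀ {w} → w ≤ length c → T (alive c w) → Dec c w
      count  : # (alive c) 0 (length c) ≡ j

  record A (c : List ℕ) (j : ℕ) : Set where
    field
      valid : Valid c
      f     : ℕ
      size≡ : length c ≡ 2 + f
      head  : ∀ {x} → x < length c → x ≢ f → Pair c f x
      mid   : T (alive c (suc f))
      top   : T (alive c (length c))
      count : # (alive c) 0 (suc f) ≡ suc j

  top-above : ∀ {c u} → Valid c → u ≤ length c → T (alive c u) → T (alive c (length c)) →
              T (alive (u ∷ c) (suc (length c)))
  top-above {c} {u} v u≤m au at = subst T (sym (above-≡ au u≤m ok)) at
    where
    ok : T (alive c (length c)) → ∀ {x y} → Pair c x y → ¬ Matches patterns₅ (Above (length c) u x y)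
    ok _ p (1st (() , _))
    ok _ p (2nd (() , _))
    ok _ p (3rd (m≤x , _))     = <⇒≱ (proj₁ (pair-< v p)) m≤x
    ok _ p (4th (m≤x , _))     = <⇒≱ (proj₁ (pair-< v p)) m≤x
    ok _ p (5th (_ , m≤x , _)) = <⇒≱ (proj₁ (pair-< v p)) m≤x
    ok _ p (6th (_ , _ , m≤y)) = <⇒≱ (proj₂ (pair-< v p)) m≤y

  below-top : ∀ {c w} → Valid c → T (alive c (length c)) → (T (alive c w) → Dec c w) → w ≤ length c →
              alive (length c ∷ c) w ≡ alive c w
  below-top {c} {w} v at dec w≤m = below-≡ at w≤m ok
    where
    ok : T (alive c w) → ∀ {x y} → Pair c x y → ¬ Matches patterns₅ (Below w (length c) x y)
    ok aw p (1st (_ , m≤x , _)) = <⇒≱ (proj₁ (pair-< v p)) m≤x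
    ok aw p (2nd (_ , m≤y , _)) = <⇒≱ (proj₂ (pair-< v p)) m≤y
    ok aw p (3rd (_ , _ , m≤y)) = <⇒≱ (proj₂ (pair-< v p)) m≤y
    ok aw p (4th (w≤x , x<y , _)) = <⇒≱ x<y (dec aw p w≤x)
    ok aw p (5th (() , _))
    ok aw p (6th (m≤x , _))     = <⇒≱ (proj₁ (pair-< v p)) m≤x

  above-same : ∀ {c u w} → T (alive c u) → Dec c u → u ≤ w → alive (u ∷ c) (suc w) ≡ alive c w
  above-same {c} {u} {w} au dec u≤w = above-≡ au u≤w ok
    where
    ok : T (alive c w) → ∀ {x y} → Pair c x y → ¬ Matches patterns₅ (Above w u x y)
    ok _ p (1st (() , _))
    ok _ p (2nd (() , _))
    ok _ p (3rd (w≤x , x<u , _))   = <⇒≱ x<u (≤-trans u≤w w≤x)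
    ok _ p (4th (w≤x , x<y , y<u)) = <⇒≱ (<-trans x<y y<u) (≤-trans u≤w w≤x)
    ok _ p (5th (_ , w≤x , x<y))   = <⇒≱ x<y (dec p (≤-trans u≤w w≤x))
    ok _ p (6th (u≤x , x<w , w≤y)) = <⇒≱ (<-≤-trans x<w w≤y) (dec p u≤x)

  -- At most one value lies above the site l.
  below-second : ∀ {c l w} → Valid c → length c ≡ suc l → T (alive c l) → (T (alive c w) → Dec c w) → w ≤ l →
                 alive (l ∷ c) w ≡ alive c w
  below-second {c} {l} {w} v m≡ al dec w≤l = below-≡ al w≤l ok
    where
    ok : T (alive c w) → ∀ {x y} → Pair c x y → ¬ Matches patterns₅ (Below w l x y)
    ok aw p (1st (_ , l≤x , x<y)) = <⇒≱ (subst (_ <_) m≡ (proj₂ (pair-< v p))) (≤-<-trans l≤x x<y)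
    ok aw p (2nd (_ , l≤y , y<x)) = <⇒≱ (subst (_ <_) m≡ (proj₁ (pair-< v p))) (≤-<-trans l≤y y<x)
    ok aw p (3rd (w≤x , x<l , l≤y)) = <⇒≱ (<-≤-trans x<l l≤y) (dec aw p w≤x)
    ok aw p (4th (w≤x , x<y , _)) = <⇒≱ x<y (dec aw p w≤x)
    ok aw p (5th (() , _))
    ok aw p (6th (l≤x , x<w , _)) = <⇒≱ x<w (≤-trans w≤l l≤x)

  Dec-second : ∀ {c l} → Valid c → length c ≡ suc l → Dec c l
  Dec-second v m≡ p l≤x = ≤-trans (≤-pred (subst (_ <_) m≡ (proj₂ (pair-< v p)))) l≤x

  module _ {c : List ℕ} {j : ℕ} (b : B c j) where
    open B b
    private
      m = length c

    B-top : B (m ∷ c) (suc j)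
    B-top = record
      { valid  = ≤-refl ∷ valid
      ; top    = top-above valid ≤-refl top top
      ; second = λ { refl _ _ → subst T (sym (same ≤-refl)) top }
      ; dec    = dec′
      ; count  = trans (#-snoc (alive (m ∷ c)) 0 m (trans (same ≤-refl) (T⇒≡ top)))
                       (cong suc (trans (#-same (alive (m ∷ c)) (alive c) 0 m λ w _ w<m → same (<⇒≤ w<m)) count))
      }
      where
      same : ∀ {w} → w ≤ m → alive (m ∷ c) w ≡ alive c w
      same w≤m = below-top valid top (dec w≤m) w≤m
      dec′ : ∀ {w} → w ≤ suc m → T (alive (m ∷ c) w) → Dec (m ∷ c) w
      dec′ w≤ t with m≤n⇒m<n∨m≡n w≤
      ... | inj₁ (s≤s w≤m) = Dec-top∷ valid w≤m (dec w≤m (subst T (same w≤m) t))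
      ... | inj₂ refl      = Dec-length (≤-refl ∷ valid) ≤-refl

    B-second : ∀ {l} → m ≡ suc l → T (alive c l) → A (l ∷ c) (# (alive c) 0 l)
    B-second {l} m≡ al = record
      { valid = l≤m ∷ valid
      ; f     = l
      ; size≡ = cong suc m≡
      ; head  = first (l≤m ∷ valid)
      ; mid   = subst T (sym (above-same al (dec l≤m al) ≤-refl)) al
      ; top   = top-above valid l≤m al top
      ; count = trans (#-same (alive (l ∷ c)) (alive c) 0 (suc l) λ w _ w≤l →
                        below-second valid m≡ al (dec (≤-trans (≤-pred w≤l) l≤m)) (≤-pred w≤l))
                      (#-snoc (alive c) 0 l (T⇒≡ al))
      }
      where
      l≤m : l ≤ m
      l≤m = subst (l ≤_) (sym m≡) (n≤1+n l)

    -- The summand 2 counts the images of `u` and `l`, which survive one step higher together with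
    -- the living sites between them.
    B-low : ∀ {l u r} → m ≡ suc l → T (alive c l) → u + suc r ≡ l → T (alive c u) →
            B (u ∷ c) (2 + # (alive c) (suc u) r)
    B-low {l} {u} {r} m≡ al eq au = record
      { valid  = u≤m ∷ valid
      ; top    = top-above valid u≤m au top
      ; second = λ { refl _ _ → subst (T ∘ alive (u ∷ c)) (sym m≡) (subst T (sym (above-same au dec-u u≤l)) al) }
      ; dec    = dec′
      ; count  = begin
          # alive′ 0 (suc m)                        ≡⟨ cong (# alive′ 0) m≡′ ⟩
          # alive′ 0 (suc u + (2 + r))              ≡⟨ #-split alive′ 0 (suc u) (2 + r) ⟩
          # alive′ 0 (suc u) + # alive′ (suc u) (2 + r)
            ≡⟨ cong₂ _+_ (#-dead alive′ 0 (suc u) λ w _ w≤u → dead (≤-pred w≤u))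
                 (#-shift alive′ (alive c) u (2 + r) λ w u≤w _ → above-same au dec-u u≤w) ⟩
          # (alive c) u (2 + r)                     ≡⟨ #-cons (alive c) u (suc r) (T⇒≡ au) ⟩
          suc (# (alive c) (suc u) (suc r))         ≡⟨ cong suc (#-snoc (alive c) (suc u) r (trans (cong (alive c) l≡) (T⇒≡ al))) ⟩
          2 + # (alive c) (suc u) r                 ∎
      }
      where
      alive′ = alive (u ∷ c)
      l≡ : suc u + r ≡ l
      l≡ = trans (sym (+-suc u r)) eq
      m≡′ : suc m ≡ suc u + (2 + r)
      m≡′ = cong suc (trans m≡ (trans (cong suc (sym eq)) (sym (+-suc u (suc r)))))
      u≤l : u ≤ l
      u≤l = subst (u ≤_) eq (m≤m+n u (suc r))
      u≤m : u ≤ m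
      u≤m = subst (u ≤_) (sym m≡) (m≤n⇒m≤1+n u≤l)
      dec-u : Dec c u
      dec-u = dec u≤m au
      -- `u + r` and its successor are the two largest values of `c`; behind an ascent of the two
      -- first entries they complete 1234 or 1243.
      dead : ∀ {w} → w ≤ u → alive′ w ≡ false
      dead w≤u with pair {x = u + r} {suc u + r} valid (subst (u + r <_) (sym m≡) (≤-trans (≤-reflexive l≡) (n≤1+n l)))
                                                       (subst (suc u + r <_) (sym m≡) (s≤s (≤-reflexive l≡))) (<⇒≢ ≤-refl)
      ... | inj₁ p = below-dead au w≤u p (1st (_ , m≤m+n u r , ≤-refl))
      ... | inj₂ p = below-dead au w≤u p (2nd (_ , m≤m+n u r , ≤-refl))
      dec′ : ∀ {w} → w ≤ suc m → T (alive′ w) → Dec (u ∷ c) w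
      dec′ {w} w≤ t with w ≤? u
      ... | yes w≤u = ⊥-elim (subst T (dead w≤u) t)
      dec′ {zero}  w≤ t | no w≰u = ⊥-elim (w≰u z≤n)
      dec′ {suc w} (s≤s w≤m) t | no w≰u =
        Dec-∷ (≤-pred (≰⇒> w≰u)) (dec w≤m (subst T (above-same au dec-u (≤-pred (≰⇒> w≰u))) t))

  module _ {c : List ℕ} {j : ℕ} (a : A c j) where
    open A a
    private
      m = length c
      f<m : suc f < m
      f<m = subst (suc f <_) (sym size≡) ≤-refl
      asc : Pair c f (suc f)
      asc = head f<m (>⇒≢ ≤-refl)

    A-low : ∀ {u} → u ≤ f → T (alive c u) → B (u ∷ c) 0
    A-low {u} u≤f au = record
      { valid  = u≤m ∷ valid
      ; top    = top-above valid u≤m au top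
      ; second = λ { refl w≤m t → ⊥-elim (subst T (dead w≤m) t) }
      ; dec    = dec′
      ; count  = #-dead (alive (u ∷ c)) 0 (suc m) λ w _ w≤m → dead (≤-pred w≤m)
      }
      where
      u≤m : u ≤ m
      u≤m = ≤-trans u≤f (<⇒≤ (<-trans ≤-refl f<m))
      -- The new entry, `f` and f + 1 are raised to a 123, so that every site but the top completes
      -- 1234, 2134 or 3124.
      dead : ∀ {w} → w ≤ m → alive (u ∷ c) w ≡ false
      dead {w} w≤m with w ≤? u
      ... | yes w≤u = below-dead au w≤u asc (1st (_ , u≤f , ≤-refl))
      dead {zero}  w≤m | no w≰u = ⊥-elim (w≰u z≤n)
      dead {suc w} w≤m | no w≰u with w ≤? f
      ... | yes w≤f = above-dead au (≤-pred (≰⇒> w≰u)) asc (5th (_ , w≤f , ≤-refl))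
      ... | no  w≰f = above-dead au (≤-pred (≰⇒> w≰u)) asc (6th (u≤f , ≰⇒> w≰f , ≤-pred (subst (suc w ≤_) size≡ w≤m)))
      dec′ : ∀ {w} → w ≤ suc m → T (alive (u ∷ c) w) → Dec (u ∷ c) w
      dec′ w≤ t with m≤n⇒m<n∨m≡n w≤
      ... | inj₁ (s≤s w≤m) = ⊥-elim (subst T (dead w≤m) t)
      ... | inj₂ refl      = Dec-length (u≤m ∷ valid) ≤-refl

    A-mid : A (suc f ∷ c) 0
    A-mid = record
      { valid = <⇒≤ f<m ∷ valid
      ; f     = suc f
      ; size≡ = cong suc size≡
      ; head  = first (<⇒≤ f<m ∷ valid)
      ; mid   = subst T (sym (above-same mid (Dec-second valid size≡) ≤-refl)) mid
      ; top   = top-above valid (<⇒≤ f<m) mid top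
      ; count = trans (#-snoc (alive (suc f ∷ c)) 0 (suc f)
                        (trans (below-second valid size≡ mid (λ _ → Dec-second valid size≡) ≤-refl) (T⇒≡ mid)))
                      -- At a site up to `f`, the two largest-but-one values descend before the
                      -- maximum and complete 1324.
                      (cong suc (#-dead (alive (suc f ∷ c)) 0 (suc f) λ { w _ (s≤s w≤f) →
                        below-dead mid (m≤n⇒m≤1+n w≤f) asc (3rd (w≤f , ≤-refl , ≤-refl)) }))
      }

    A-top : B (m ∷ c) 2
    A-top = record
      { valid  = ≤-refl ∷ valid
      ; top    = top-above valid ≤-refl top top
      ; second = λ { refl _ _ → alive′-m }
      ; dec    = dec′
      ; count  = trans (#-snoc alive′ 0 m (T⇒≡ alive′-m)) (cong suc (trans (cong (# alive′ 0) size≡)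
                   (trans (#-snoc alive′ 0 (suc f) (trans (below-top valid top (λ _ → Dec-second valid size≡) (<⇒≤ f<m)) (T⇒≡ mid)))
                     (cong suc (#-dead alive′ 0 (suc f) λ { w _ (s≤s w≤f) → dead w≤f })))))
      }
      where
      alive′ = alive (m ∷ c)
      alive′-m : T (alive′ m)
      alive′-m = subst T (sym (below-top valid top (λ _ → Dec-length valid ≤-refl) ≤-refl)) top
      -- The new maximum followed by the ascent from `f` to f + 1 completes 1423 at every site up to
      -- `f`.
      dead : ∀ {w} → w ≤ f → alive′ w ≡ false
      dead w≤f = below-dead top (≤-trans w≤f (<⇒≤ (<-trans ≤-refl f<m))) asc (4th (w≤f , ≤-refl , f<m))
      dec′ : ∀ {w} → w ≤ suc m → T (alive′ w) → Dec (m ∷ c) w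
      dec′ {w} w≤ t with m≤n⇒m<n∨m≡n w≤ | w ≤? f
      ... | inj₂ refl      | _       = Dec-length (≤-refl ∷ valid) ≤-refl
      ... | inj₁ (s≤s w≤m) | yes w≤f = ⊥-elim (subst T (dead w≤f) t)
      ... | inj₁ (s≤s w≤m) | no  w≰f = Dec-top∷ valid w≤m λ p w≤x → Dec-second valid size≡ p (≤-trans (≰⇒> w≰f) w≤x)

  mutual
    size-B : ∀ n {c j} → B c j → N n c ≡ β′ n j
    size-B zero    b = refl
    size-B (suc n) {c} {j} b = begin
      ∑[ weight n c ] 0 (suc m)          ≡⟨ ∑[]-snoc (weight n c) 0 m ⟩
      ∑[ weight n c ] 0 m + weight n c m ≡⟨ cong (∑[ weight n c ] 0 m +_) (trans (when-true _ top) (size-B n (B-top b))) ⟩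
      ∑[ weight n c ] 0 m + β′ n (suc j) ≡⟨ rest m refl ⟩
      β′ (suc n) j                       ∎
      where
      open B b
      m = length c
      -- The rule of β′ distinguishes j = 0 from j > 0. By `second`, j > 0 holds exactly when the
      -- site next to the top exists and is alive, so the split is made on that site and `count`
      -- then identifies `j`.
      rest : ∀ k → m ≡ k → ∑[ weight n c ] 0 m + β′ n (suc j) ≡ β′ (suc n) j
      rest zero m≡ = subst₂ (λ k i → ∑[ weight n c ] 0 k + β′ n (suc i) ≡ β′ (suc n) i)
        (sym m≡) (trans (cong (# (alive c) 0) (sym m≡)) count) refl
      rest (suc l) m≡ with alive c l in eq
      ... | false = subst₂ (λ k i → k + β′ n (suc i) ≡ β′ (suc n) i)
        (sym (∑[]-dead (alive c) (λ u → N n (u ∷ c)) 0 m λ w _ → dead))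
        (trans (sym (#-dead (alive c) 0 m λ w _ → dead)) count) refl
        where
        dead : ∀ {w} → w < m → alive c w ≡ false
        dead {w} w<m = ¬T⇒≡ λ aw → subst T eq (second m≡ (≤-pred (subst (w <_) m≡ w<m)) aw)
      ... | true = subst (λ i → ∑[ weight n c ] 0 m + β′ n (suc i) ≡ β′ (suc n) i)
        (trans (sym (#-snoc (alive c) 0 l eq)) (trans (cong (# (alive c) 0) (sym m≡)) count))
        (cong (_+ β′ n (2 + # (alive c) 0 l)) (begin
          ∑[ weight n c ] 0 m                 ≡⟨ cong (∑[ weight n c ] 0) m≡ ⟩
          ∑[ weight n c ] 0 (suc l)           ≡⟨ ∑[]-snoc (weight n c) 0 l ⟩
          ∑[ weight n c ] 0 l + weight n c l  ≡⟨ cong₂ _+_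
            (∑-by-above (alive c) (λ u → N n (u ∷ c)) (λ i → β′ n (2 + i)) 0 l λ u r eq′ _ au →
              size-B n (B-low b m≡ al eq′ au))
            (trans (when-true _ al) (size-A n (B-second b m≡ al))) ⟩
          ∑ (λ i → β′ n (2 + i)) (# (alive c) 0 l) + α′ n (# (alive c) 0 l) ∎))
        where
        al : T (alive c l)
        al = subst T (sym eq) _

    size-A : ∀ n {c j} → A c j → N n c ≡ α′ n j
    size-A zero    a = refl
    size-A (suc n) {c} {j} a = begin
      ∑[ weight n c ] 0 (suc m)          ≡⟨ ∑[]-snoc (weight n c) 0 m ⟩
      ∑[ weight n c ] 0 m + weight n c m ≡⟨ cong (λ k → ∑[ weight n c ] 0 k + weight n c m) size≡ ⟩
      ∑[ weight n c ] 0 (2 + f) + weight n c m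
        ≡⟨ cong (_+ weight n c m) (∑[]-snoc (weight n c) 0 (suc f)) ⟩
      ∑[ weight n c ] 0 (suc f) + weight n c (suc f) + weight n c m
        ≡⟨ cong₂ _+_ (cong₂ _+_
             (trans (∑-by-above (alive c) (λ u → N n (u ∷ c)) (λ _ → β′ n 0) 0 (suc f) λ u r eq _ au →
                      size-B n (A-low a (≤-pred (subst (u <_) eq (m<m+n u z<s))) au))
                    (trans (cong (∑ (λ _ → β′ n 0)) count) (∑-const (β′ n 0) (suc j))))
             (trans (when-true _ mid) (size-A n (A-mid a))))
             (trans (when-true _ top) (size-B n (A-top a))) ⟩
      suc j * β′ n 0 + α′ n 0 + β′ n 2   ∎
      where
      open A a
      m = length c

  size≡β : ∀ n → N n [] ≡ β n 0
  size≡β n = trans (size-B n record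
    { valid = [] ; top = alive-[] ; second = λ () ; dec = λ _ _ () ; count = refl }) (β′≡β n 0)

-- Putting the five classes together

-- Up to reverse-complement-inverse these are patterns₂, patterns₃ and patterns₄.
patterns₂° patterns₃° patterns₄° : List Pattern
patterns₂° = pat 1 2 3 4 ∷ pat 1 2 4 3 ∷ pat 1 3 2 4 ∷ pat 1 4 2 3 ∷ pat 2 3 1 4 ∷ pat 3 1 2 4 ∷ []
patterns₃° = pat 2 3 4 1 ∷ pat 2 4 1 3 ∷ pat 2 4 3 1 ∷ pat 3 4 1 2 ∷ pat 3 4 2 1 ∷ pat 4 2 3 1 ∷ []
patterns₄° = pat 2 1 3 4 ∷ pat 2 1 4 3 ∷ pat 2 3 1 4 ∷ pat 3 1 2 4 ∷ pat 3 2 1 4 ∷ pat 4 2 1 3 ∷ []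

S↔Fin : ∀ m Ps {k} → size Ps m [] ≡ k → S m (map ⟦_⟧ Ps) ↔ Fin k
S↔Fin m Ps eq = ↔-trans (S↔size Ps m) (≡⇒Fin↔ eq)

S-H↔Fin : ∀ m j → S m (H j) ↔ Fin (β m 0)
S-H↔Fin m 0F = S↔Fin m patterns₁ (Class₁.size≡β m)
-- The reflected patterns evaluate to the words of `patterns₂` in the same order, so no reordering
-- of the list is needed; the next two classes are arranged likewise.
S-H↔Fin m 1F = ↔-trans (S-rci m patterns₂°) (S↔Fin m patterns₂ (Class₂.size≡β m))
S-H↔Fin m 2F = ↔-trans (S-rci m patterns₃°) (S↔Fin m patterns₃ (Class₃.size≡β m))
S-H↔Fin m 3F = ↔-trans (S-rci m patterns₄°) (S↔Fin m patterns₄ (Class₄.size≡β m))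
S-H↔Fin m 4F = S↔Fin m patterns₅ (Class₅.size≡β m)

theorem4 : (n : ℕ) → 2 ≤ n → (j : Fin 5) → F13 n ↔ S (n ∸ 1) (H j)
theorem4 (suc m) _ j = ↔-trans (F13↔ m) (↔-trans (≡⇒Fin↔ (sym (β≡W₀ m))) (↔-sym (S-H↔Fin m j)))
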